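{- For every $\alpha,\varepsilon\in(0,1/7]$ there exists $n_0$ such that the following holds for every integer $n\ge n_0$. Let $H$ be a $3$-graph on $n$ vertices such that $$e(H)\ge \binom{n}{3}-\binom{n-\alpha n}{3}+\varepsilon n^3.$$ Then $H$ contains a $Y_{3,2}$-tiling covering at least $4\alpha n$ vertices.
   Context: A $3$-graph ($3$-uniform hypergraph) $H=(V,E)$ consists of a finite vertex set $V$ and a family $E$ of $3$-element subsets of $V$; $e(H)=|E|$. $Y_{3,2}$ is the $3$-graph on four vertices consisting of two edges that intersect in exactly two vertices. A $Y_{3,2}$-tiling in $H$ is a collection of vertex-disjoint copies of $Y_{3,2}$ in $H$ (not necessarily induced); it covers the vertices of its copies. For real $x$, $\binom{x}{3}=x(x-1)(x-2)/6$. -}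

module Defs where

open import Data.Fin using (Fin)
import Data.Fin.Properties as Fin
open import Data.Fin.Subset using (Subset; inside; outside; _∩_; ⋃; ∣_∣; ⊤; Empty)
open import Data.Fin.Subset.Properties using (_∈?_)
open import Data.Integer using (+_)
open import Data.List using (List; []; _∷_; length; map)
open import Data.List.Membership.Propositional using (_∈_)
open import Data.List.Relation.Unary.All using (All; []; _∷_)
open import Data.List.Relation.Unary.AllPairs using (AllPairs; []; _∷_)
open import Data.List.Relation.Unary.Unique.Propositional using (Unique)
open import Data.Nat as ℕ using (ℕ)
import Data.Nat.Properties as ℕ
open import Data.Product using (∃; _×_; _,_)
open import Data.Rational as ℚ using (ℚ; 0ℚ; 1ℚ; ½)
import Data.Rational.Properties as ℚ
open import Data.Rational.Solver using (module +-*-Solver)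
open import Data.Vec using ([]; _∷_; tabulate)
open import Function.Definitions using (Injective)
open import Relation.Binary.PropositionalEquality
open import Relation.Nullary using (does; _×-dec_)

------------------------------------------------------------------------
-- Real numbers, as Cauchy sequences of rationals.  Two sequences denote the
-- same real when x ≤ y and y ≤ x; the order below does not distinguish them.

Cauchy : (ℕ → ℚ) → Set
Cauchy s = ∀ δ → 0ℚ ℚ.< δ →
  ∃ λ N → ∀ m n → N ℕ.≤ m → N ℕ.≤ n → ℚ.∣ s m ℚ.- s n ∣ ℚ.< δ

record ℝ : Set where
  constructor mkℝ
  field
    seq    : ℕ → ℚ
    cauchy : Cauchy seq

open ℝ public

fromℚ : ℚ → ℝ
fromℚ q = mkℝ (λ _ → q) λ δ 0<δ →
  0 , λ _ _ _ _ → subst (λ r → ℚ.∣ r ∣ ℚ.< δ) (sym (ℚ.+-inverseʳ q)) 0<δ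

fromℕ : ℕ → ℝ
fromℕ n = fromℚ (+ n ℚ./ 1)

private
  halve : ∀ δ → 0ℚ ℚ.< δ → 0ℚ ℚ.< δ ℚ.* ½
  halve δ 0<δ = subst (ℚ._< δ ℚ.* ½) (ℚ.*-zeroˡ ½) (ℚ.*-monoˡ-<-pos ½ 0<δ)

  halves : ∀ δ → δ ℚ.* ½ ℚ.+ δ ℚ.* ½ ≡ δ
  halves δ = trans (sym (ℚ.*-distribˡ-+ δ ½ ½)) (ℚ.*-identityʳ δ)

  +-rearrange : ∀ a b c d →
    (a ℚ.+ b) ℚ.- (c ℚ.+ d) ≡ (a ℚ.- c) ℚ.+ (b ℚ.- d)
  +-rearrange = solve 4 (λ a b c d →
    (a :+ b) :- (c :+ d) := (a :- c) :+ (b :- d)) refl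
    where open +-*-Solver

  neg-rearrange : ∀ a b → (ℚ.- a) ℚ.- (ℚ.- b) ≡ ℚ.- (a ℚ.- b)
  neg-rearrange = solve 2 (λ a b → (:- a) :- (:- b) := :- (a :- b)) refl
    where open +-*-Solver

  *-rearrange : ∀ a b c d →
    (a ℚ.* b) ℚ.- (c ℚ.* d) ≡ a ℚ.* (b ℚ.- d) ℚ.+ d ℚ.* (a ℚ.- c)
  *-rearrange = solve 4 (λ a b c d →
    (a :* b) :- (c :* d) := a :* (b :- d) :+ d :* (a :- c)) refl
    where open +-*-Solver

  split : ∀ a b → a ≡ b ℚ.+ (a ℚ.- b)
  split = solve 2 (λ a b → a := b :+ (a :- b)) refl
    where open +-*-Solver

  eventually-bounded : ∀ x → ∃ λ B → 0ℚ ℚ.< B ×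
    ∃ λ N → ∀ k → N ℕ.≤ k → ℚ.∣ seq x k ∣ ℚ.≤ B
  eventually-bounded x with cauchy x 1ℚ (ℚ.positive⁻¹ 1ℚ)
  ... | N , close = ℚ.∣ seq x N ∣ ℚ.+ 1ℚ
    , ℚ.+-mono-≤-< (ℚ.0≤∣p∣ (seq x N)) (ℚ.positive⁻¹ 1ℚ)
    , N
    , λ k N≤k → begin
        ℚ.∣ seq x k ∣
          ≡⟨ cong ℚ.∣_∣ (split (seq x k) (seq x N)) ⟩
        ℚ.∣ seq x N ℚ.+ (seq x k ℚ.- seq x N) ∣
          ≤⟨ ℚ.∣p+q∣≤∣p∣+∣q∣ (seq x N) _ ⟩
        ℚ.∣ seq x N ∣ ℚ.+ ℚ.∣ seq x k ℚ.- seq x N ∣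
          ≤⟨ ℚ.+-monoʳ-≤ ℚ.∣ seq x N ∣ (ℚ.<⇒≤ (close k N N≤k ℕ.≤-refl)) ⟩
        ℚ.∣ seq x N ∣ ℚ.+ 1ℚ ∎
    where open ℚ.≤-Reasoning

  +-cauchy : ∀ x y → Cauchy (λ k → seq x k ℚ.+ seq y k)
  +-cauchy x y δ 0<δ
    with cauchy x (δ ℚ.* ½) (halve δ 0<δ) | cauchy y (δ ℚ.* ½) (halve δ 0<δ)
  ... | M , closeˣ | N , closeʸ = M ℕ.⊔ N , λ m n p q → begin-strict
        ℚ.∣ (seq x m ℚ.+ seq y m) ℚ.- (seq x n ℚ.+ seq y n) ∣
          ≡⟨ cong ℚ.∣_∣ (+-rearrange (seq x m) (seq y m) (seq x n) (seq y n)) ⟩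
        ℚ.∣ (seq x m ℚ.- seq x n) ℚ.+ (seq y m ℚ.- seq y n) ∣
          ≤⟨ ℚ.∣p+q∣≤∣p∣+∣q∣ (seq x m ℚ.- seq x n) _ ⟩
        ℚ.∣ seq x m ℚ.- seq x n ∣ ℚ.+ ℚ.∣ seq y m ℚ.- seq y n ∣
          <⟨ ℚ.+-mono-<
               (closeˣ m n (ℕ.m⊔n≤o⇒m≤o M N p) (ℕ.m⊔n≤o⇒m≤o M N q))
               (closeʸ m n (ℕ.m⊔n≤o⇒n≤o M N p) (ℕ.m⊔n≤o⇒n≤o M N q)) ⟩
        δ ℚ.* ½ ℚ.+ δ ℚ.* ½
          ≡⟨ halves δ ⟩
        δ ∎
    where open ℚ.≤-Reasoning

  neg-cauchy : ∀ x → Cauchy (λ k → ℚ.- seq x k)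
  neg-cauchy x δ 0<δ with cauchy x δ 0<δ
  ... | N , close = N , λ m n p q → begin-strict
        ℚ.∣ (ℚ.- seq x m) ℚ.- (ℚ.- seq x n) ∣
          ≡⟨ cong ℚ.∣_∣ (neg-rearrange (seq x m) (seq x n)) ⟩
        ℚ.∣ ℚ.- (seq x m ℚ.- seq x n) ∣
          ≡⟨ ℚ.∣-p∣≡∣p∣ (seq x m ℚ.- seq x n) ⟩
        ℚ.∣ seq x m ℚ.- seq x n ∣
          <⟨ close m n p q ⟩
        δ ∎
    where open ℚ.≤-Reasoning

  divide : ∀ B δ → 0ℚ ℚ.< B → 0ℚ ℚ.< δ → ∃ λ η → 0ℚ ℚ.< η × B ℚ.* η ≡ δ
  divide B δ 0<B 0<δ = r ℚ.* δ , 0<rδ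
    , trans (sym (ℚ.*-assoc B r δ))
        (trans (cong (ℚ._* δ) (ℚ.*-inverseʳ B {{B≢0}})) (ℚ.*-identityˡ δ))
    where
    B≢0 : ℚ.NonZero B
    B≢0 = ℚ.pos⇒nonZero B {{ℚ.positive 0<B}}

    r : ℚ
    r = ℚ.1/_ B {{B≢0}}

    0<rδ : 0ℚ ℚ.< r ℚ.* δ
    0<rδ = subst (ℚ._< r ℚ.* δ) (ℚ.*-zeroʳ r)
      (ℚ.*-monoʳ-<-pos r {{ℚ.1/pos⇒pos B {{ℚ.positive 0<B}}}} 0<δ)

  *-bound : ∀ a b D η → 0ℚ ℚ.< D → ℚ.∣ a ∣ ℚ.≤ D → ℚ.∣ b ∣ ℚ.< η →
    ℚ.∣ a ℚ.* b ∣ ℚ.< D ℚ.* η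
  *-bound a b D η 0<D a≤D b<η = begin-strict
    ℚ.∣ a ℚ.* b ∣         ≡⟨ ℚ.∣p*q∣≡∣p∣*∣q∣ a b ⟩
    ℚ.∣ a ∣ ℚ.* ℚ.∣ b ∣   ≤⟨ ℚ.*-monoʳ-≤-nonNeg ℚ.∣ b ∣ {{ℚ.∣-∣-nonNeg b}} a≤D ⟩
    D ℚ.* ℚ.∣ b ∣         <⟨ ℚ.*-monoʳ-<-pos D {{ℚ.positive 0<D}} b<η ⟩
    D ℚ.* η ∎
    where open ℚ.≤-Reasoning

  *-close : ∀ a b c d B C η → 0ℚ ℚ.< B → 0ℚ ℚ.< C →
    ℚ.∣ a ∣ ℚ.≤ B → ℚ.∣ d ∣ ℚ.≤ C →
    ℚ.∣ a ℚ.- c ∣ ℚ.< η → ℚ.∣ b ℚ.- d ∣ ℚ.< η →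
    ℚ.∣ a ℚ.* b ℚ.- c ℚ.* d ∣ ℚ.< (B ℚ.+ C) ℚ.* η
  *-close a b c d B C η 0<B 0<C a≤B d≤C ac bd = begin-strict
    ℚ.∣ a ℚ.* b ℚ.- c ℚ.* d ∣
      ≡⟨ cong ℚ.∣_∣ (*-rearrange a b c d) ⟩
    ℚ.∣ a ℚ.* (b ℚ.- d) ℚ.+ d ℚ.* (a ℚ.- c) ∣
      ≤⟨ ℚ.∣p+q∣≤∣p∣+∣q∣ (a ℚ.* (b ℚ.- d)) (d ℚ.* (a ℚ.- c)) ⟩
    ℚ.∣ a ℚ.* (b ℚ.- d) ∣ ℚ.+ ℚ.∣ d ℚ.* (a ℚ.- c) ∣
      <⟨ ℚ.+-mono-< (*-bound a (b ℚ.- d) B η 0<B a≤B bd)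
                    (*-bound d (a ℚ.- c) C η 0<C d≤C ac) ⟩
    B ℚ.* η ℚ.+ C ℚ.* η
      ≡⟨ ℚ.*-distribʳ-+ η B C ⟨
    (B ℚ.+ C) ℚ.* η ∎
    where open ℚ.≤-Reasoning

  *-cauchy : ∀ x y → Cauchy (λ k → seq x k ℚ.* seq y k)
  *-cauchy x y δ 0<δ =
    let B , 0<B , K , boundˣ = eventually-bounded x
        C , 0<C , L , boundʸ = eventually-bounded y
        η , 0<η , scaled     = divide (B ℚ.+ C) δ (ℚ.+-mono-< 0<B 0<C) 0<δ
        M , closeˣ           = cauchy x η 0<η
        N , closeʸ           = cauchy y η 0<η
        KL = K ℕ.⊔ L ; MN = M ℕ.⊔ N
    in KL ℕ.⊔ MN , λ m n p q →
      let p₁ = ℕ.m⊔n≤o⇒m≤o KL MN p ; p₂ = ℕ.m⊔n≤o⇒n≤o KL MN p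
          q₁ = ℕ.m⊔n≤o⇒m≤o KL MN q ; q₂ = ℕ.m⊔n≤o⇒n≤o KL MN q
      in subst (ℚ.∣ seq x m ℚ.* seq y m ℚ.- seq x n ℚ.* seq y n ∣ ℚ.<_) scaled
           (*-close (seq x m) (seq y m) (seq x n) (seq y n) B C η 0<B 0<C
             (boundˣ m (ℕ.m⊔n≤o⇒m≤o K L p₁))
             (boundʸ n (ℕ.m⊔n≤o⇒n≤o K L q₁))
             (closeˣ m n (ℕ.m⊔n≤o⇒m≤o M N p₂) (ℕ.m⊔n≤o⇒m≤o M N q₂))
             (closeʸ m n (ℕ.m⊔n≤o⇒n≤o M N p₂) (ℕ.m⊔n≤o⇒n≤o M N q₂)))

infixl 7 _*_
infixl 6 _+_ _-_
infixr 8 _^_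
infix  8 -_
infix  4 _<_ _≤_ _≥_

_+_ : ℝ → ℝ → ℝ
x + y = mkℝ (λ k → seq x k ℚ.+ seq y k) (+-cauchy x y)

-_ : ℝ → ℝ
- x = mkℝ (λ k → ℚ.- seq x k) (neg-cauchy x)

_-_ : ℝ → ℝ → ℝ
x - y = x + (- y)

_*_ : ℝ → ℝ → ℝ
x * y = mkℝ (λ k → seq x k ℚ.* seq y k) (*-cauchy x y)

_^_ : ℝ → ℕ → ℝ
x ^ ℕ.zero  = fromℕ 1
x ^ ℕ.suc k = x * x ^ k

-- The gap δ is needed: a termwise strict inequality only gives ≤ in the limit.
_<_ : ℝ → ℝ → Set
x < y = ∃ λ δ → 0ℚ ℚ.< δ × ∃ λ N → ∀ k → N ℕ.≤ k → seq x k ℚ.+ δ ℚ.≤ seq y k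

-- Equivalent to ¬ (y < x).
_≤_ : ℝ → ℝ → Set
x ≤ y = ∀ δ → 0ℚ ℚ.< δ → ∃ λ N → ∀ k → N ℕ.≤ k → seq x k ℚ.≤ seq y k ℚ.+ δ

_≥_ : ℝ → ℝ → Set
x ≥ y = y ≤ x

choose₃ : ℝ → ℝ
choose₃ x = x * (x - fromℕ 1) * (x - fromℕ 2) * fromℚ (+ 1 ℚ./ 6)

------------------------------------------------------------------------
-- 3-graphs with vertex set Fin n.  The family of edges is a duplicate-free list.

record 3-Graph (n : ℕ) : Set where
  field
    edges   : List (Subset n)
    unique  : Unique edges
    uniform : All (λ S → ∣ S ∣ ≡ 3) edges

open 3-Graph public

e : ∀ {n} → 3-Graph n → ℕ
e H = length (edges H)

image : ∀ {m n} → (Fin m → Fin n) → Subset m → Subset n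
image φ S = tabulate λ v → does (Fin.any? λ i → (i ∈? S) ×-dec (φ i Fin.≟ v))

-- A not necessarily induced copy of F in H, given by an embedding.
record Copy {m n : ℕ} (F : 3-Graph m) (H : 3-Graph n) : Set where
  field
    embed     : Fin m → Fin n
    injective : Injective _≡_ _≡_ embed
    preserves : ∀ {S} → S ∈ edges F → image embed S ∈ edges H

  vertices : Subset n
  vertices = image embed ⊤

open Copy public

record Tiling {m n : ℕ} (F : 3-Graph m) (H : 3-Graph n) : Set where
  field
    copies   : List (Copy F H)
    disjoint : AllPairs (λ c d → Empty (vertices c ∩ vertices d)) copies

  covered : Subset n
  covered = ⋃ (map vertices copies)

open Tiling public

Y₃₂ : 3-Graph 4
Y₃₂ = record
  { edges   = (inside ∷ inside ∷ inside  ∷ outside ∷ [])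
            ∷ (inside ∷ inside ∷ outside ∷ inside  ∷ [])
            ∷ []
  ; unique  = ((λ ()) ∷ []) ∷ [] ∷ []
  ; uniform = refl ∷ refl ∷ []
  }

{-# OPTIONS --safe #-}

-- A tiling with s < αn copies can be enlarged by one copy, as follows.  Adding
-- d = (n - 7s) / 6 vertices adjacent to everything, each starting a new tile,
-- gives t = s + d tiles, and together with three uncovered vertices per tile
-- they partition almost the whole vertex set into t groups of 7.  The missing
-- ordered triples number at most (n - s)³ - εn³, where n - s ≈ 6t, so a positive
-- fraction of the triples of groups span more than 7³ - 6³ = 127 edges.  Many of
-- these have the same edge pattern P ⊆ [7]³, and hence contain a complete
-- tripartite blow-up of P.  By linear programming duality, either the blow-up
-- has a tiling with more copies than the tiles it meets, which is the
-- enlargement (at most d of its copies meet added vertices), or there are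
-- weights y ≥ 0 vanishing on uncovered vertices, of sum at most 1 on each group,
-- such that y(a) + y(b) + y(c) + min(y(a), y(b), y(c)) ≥ 1 for every edge abc of
-- P.  Splitting the triples of tile vertices into perfect matchings shows that
-- at most 127 triples satisfy this inequality, so the second case is impossible.
module Submission where

-- The model to beat is the graph of all triples meeting a fixed set of `s` vertices: weight 1 on
-- one vertex of each group satisfies the weight inequality on exactly the 7³ - 6³ triples meeting
-- those vertices. A competing choice, weight 1/4 on every tile vertex, satisfies it on all 64
-- triples of tile vertices and would win against 4³ - 3³ = 37 in groups of 4. Three weightless
-- vertices per group reverse this, and α ≤ 1/7 supplies them, since 7s ≤ n leaves at least 3s
-- vertices uncovered. The added vertices bring the remaining uncovered vertices into groups: n = 7s
-- + 6d + r gives n - s = 6t + r with r ≤ 5, so (n - s)³ missing triples amount to 6³ per triple of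
-- groups, up to O(t²). The minimum arises because the blow-up of an edge contains three kinds of Y,
-- one for each doubled vertex. Duality is used over the integers, so that its outcome is a multiset
-- of copies to be placed disjointly; the size of that multiset is bounded because there are
-- finitely many patterns. Finally, s < αn is not decidable for Cauchy reals; a rational slightly
-- above α decides when to stop.

module Prelude where

  open import Data.Bool using (Bool; true; false) public
  open import Data.Empty using (⊥-elim) public
  open import Data.Fin using (Fin; zero; suc) public
  open import Data.Fin.Patterns public
  open import Data.List using (List; []; _∷_; _++_; map; concatMap; length; filter; allFin; cartesianProduct) public
  open import Data.List.Membership.Propositional using (_∈_) public
  open import Data.List.Membership.Propositional.Properties using (∈-map⁺; ∈-map⁻; ∈-++⁺ˡ; ∈-++⁺ʳ; ∈-++⁻; ∈-filter⁺; ∈-filter⁻; ∈-allFin; ∈-∃++; ∈-cartesianProduct⁺; ∈-cartesianProduct⁻) public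
  open import Data.List.Properties using (length-++; length-map; length-tabulate; ++-assoc; map-++; concatMap-++) public
  open import Data.List.Relation.Binary.Permutation.Propositional using (_↭_; ↭-refl; ↭-trans; prep) public
  open import Data.List.Relation.Unary.All using (All; []; _∷_) public
  open import Data.List.Relation.Unary.AllPairs using ([]; _∷_) public
  open import Data.List.Relation.Unary.Any using (here; there) public
  open import Data.List.Relation.Unary.Unique.Propositional using (Unique) public
  open import Data.Nat hiding (_≟_) public
  open import Data.Nat.Properties hiding (_≟_) public
  open import Data.Nat.Tactic.RingSolver using (solve-∀) public
  open import Data.Product using (∃; ∃₂; _×_; _,_; proj₁; proj₂) public
  open import Data.Sum using (_⊎_; inj₁; inj₂) public
  open import Data.Vec using (Vec; []; _∷_) public
  open import Function using (_∘_) public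
  open import Relation.Binary.Definitions using (DecidableEquality) public
  open import Relation.Binary.PropositionalEquality hiding ([_]) public
  open import Relation.Nullary using (Dec; ¬_; ¬?; yes; no; does; _×-dec_) public

-- Finite sums over lists and 0/1 indicators.

module Sums where

  open Prelude
  open import Data.List.Relation.Binary.Permutation.Propositional as Perm using (swap)

  ⟦_⟧ : Bool → ℕ
  ⟦ true ⟧  = 1
  ⟦ false ⟧ = 0

  ⟦⟧≤1 : ∀ b → ⟦ b ⟧ ≤ 1
  ⟦⟧≤1 true  = ≤-refl
  ⟦⟧≤1 false = z≤n

  does-yes : ∀ {p} {P : Set p} (d : Dec P) → P → does d ≡ true
  does-yes (yes _) _ = refl
  does-yes (no ¬p) p with () ← ¬p p

  yes-does : ∀ {p} {P : Set p} (d : Dec P) → does d ≡ true → P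
  yes-does (yes p) _ = p

  indicator-mono : ∀ {p q} {P : Set p} {Q : Set q} (P? : Dec P) (Q? : Dec Q) →
    (P → Q) → ⟦ does P? ⟧ ≤ ⟦ does Q? ⟧
  indicator-mono (no _)  _       f = z≤n
  indicator-mono (yes _) (yes _) f = ≤-refl
  indicator-mono (yes p) (no ¬q) f with () ← ¬q (f p)

  indicator-no : ∀ {p} {P : Set p} (P? : Dec P) → (P → 1 ≤ 0) → ⟦ does P? ⟧ ≡ 0
  indicator-no (no _)  f = refl
  indicator-no (yes p) f with () ← f p

  indicator⇒ : ∀ {p} {P : Set p} (P? : Dec P) → 1 ≤ ⟦ does P? ⟧ → P
  indicator⇒ (yes p) _ = p

  module _ {a} {A : Set a} where

    ∑ : List A → (A → ℕ) → ℕ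
    ∑ []       f = 0
    ∑ (x ∷ xs) f = f x + ∑ xs f

    ∑-mono∈ : ∀ xs {f g : A → ℕ} → (∀ x → x ∈ xs → f x ≤ g x) → ∑ xs f ≤ ∑ xs g
    ∑-mono∈ []       h = z≤n
    ∑-mono∈ (x ∷ xs) h = +-mono-≤ (h x (here refl)) (∑-mono∈ xs (λ y → h y ∘ there))

    ∑-mono : ∀ xs {f g : A → ℕ} → (∀ x → f x ≤ g x) → ∑ xs f ≤ ∑ xs g
    ∑-mono xs h = ∑-mono∈ xs (λ x _ → h x)

    ∑-cong : ∀ xs {f g : A → ℕ} → (∀ x → f x ≡ g x) → ∑ xs f ≡ ∑ xs g
    ∑-cong []       h = refl
    ∑-cong (x ∷ xs) h = cong₂ _+_ (h x) (∑-cong xs h)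

    ∑-+ : ∀ xs (f g : A → ℕ) → ∑ xs (λ x → f x + g x) ≡ ∑ xs f + ∑ xs g
    ∑-+ []       f g = refl
    ∑-+ (x ∷ xs) f g = trans (cong (f x + g x +_) (∑-+ xs f g)) (interchange (f x) (g x) _ _)
      where
      interchange : ∀ a b c d → (a + b) + (c + d) ≡ (a + c) + (b + d)
      interchange = solve-∀

    ∑-*ˡ : ∀ xs c (f : A → ℕ) → ∑ xs (λ x → c * f x) ≡ c * ∑ xs f
    ∑-*ˡ []       c f = sym (*-zeroʳ c)
    ∑-*ˡ (x ∷ xs) c f rewrite ∑-*ˡ xs c f = sym (*-distribˡ-+ c (f x) _)

    ∑-*ʳ : ∀ xs c (f : A → ℕ) → ∑ xs (λ x → f x * c) ≡ ∑ xs f * c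
    ∑-*ʳ []       c f = refl
    ∑-*ʳ (x ∷ xs) c f rewrite ∑-*ʳ xs c f = sym (*-distribʳ-+ c (f x) _)

    ∑-const : ∀ xs c → ∑ xs (λ _ → c) ≡ length xs * c
    ∑-const []       c = refl
    ∑-const (x ∷ xs) c = cong (c +_) (∑-const xs c)

    ∑-zero : ∀ xs → ∑ xs (λ _ → 0) ≡ 0
    ∑-zero xs = trans (∑-const xs 0) (*-zeroʳ (length xs))

    ∑-≤const : ∀ xs c {f : A → ℕ} → (∀ x → f x ≤ c) → ∑ xs f ≤ length xs * c
    ∑-≤const xs c h = subst (∑ xs _ ≤_) (∑-const xs c) (∑-mono xs h)

    ∑-++ : ∀ xs ys (f : A → ℕ) → ∑ (xs ++ ys) f ≡ ∑ xs f + ∑ ys f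
    ∑-++ []       ys f = refl
    ∑-++ (x ∷ xs) ys f rewrite ∑-++ xs ys f = sym (+-assoc (f x) _ _)

    ∑-++-comm : ∀ xs ys (f : A → ℕ) → ∑ (xs ++ ys) f ≡ ∑ (ys ++ xs) f
    ∑-++-comm xs ys f = trans (∑-++ xs ys f) (trans (+-comm (∑ xs f) _) (sym (∑-++ ys xs f)))

    ∑-↭ : ∀ {xs ys} (f : A → ℕ) → xs ↭ ys → ∑ xs f ≡ ∑ ys f
    ∑-↭ f Perm.refl    = refl
    ∑-↭ f (prep x p)   = cong (f x +_) (∑-↭ f p)
    ∑-↭ f (swap x y p) rewrite ∑-↭ f p = exchange (f x) (f y) _
      where
      exchange : ∀ a b c → a + (b + c) ≡ b + (a + c)
      exchange = solve-∀
    ∑-↭ f (Perm.trans p q) = trans (∑-↭ f p) (∑-↭ f q)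

    term≤∑ : ∀ {xs x} (f : A → ℕ) → x ∈ xs → f x ≤ ∑ xs f
    term≤∑ f (here refl) = m≤m+n _ _
    term≤∑ {_ ∷ xs} f (there i) = ≤-trans (term≤∑ f i) (m≤n+m _ _)

    ∑-positive : ∀ xs (f : A → ℕ) → 0 < ∑ xs f → ∃ λ x → x ∈ xs × 0 < f x
    ∑-positive (x ∷ xs) f 0<∑ with f x in eq
    ... | suc _ = x , here refl , subst (0 <_) (sym eq) (s≤s z≤n)
    ... | zero  = let y , i , p = ∑-positive xs f 0<∑ in y , there i , p

    pigeonhole : ∀ xs (f : A → ℕ) m → 0 < length xs → length xs * m ≤ ∑ xs f →
      ∃ λ x → x ∈ xs × m ≤ f x
    pigeonhole (x ∷ xs) f m _ h with m ≤? f x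
    ... | yes p = x , here refl , p
    ... | no ¬p with xs
    ...   | [] with () ← ¬p (subst₂ _≤_ (+-identityʳ m) (+-identityʳ (f x)) h)
    ...   | y ∷ ys =
            let z , i , p = pigeonhole (y ∷ ys) f m (s≤s z≤n) (+-cancelˡ-≤ m _ _
                  (≤-trans h (+-monoˡ-≤ _ (<⇒≤ (≰⇒> ¬p)))))
            in z , there i , p

  ∑-swap : ∀ {a b} {A : Set a} {B : Set b} xs ys (f : A → B → ℕ) →
    ∑ xs (λ x → ∑ ys (f x)) ≡ ∑ ys (λ y → ∑ xs (λ x → f x y))
  ∑-swap []       ys f = sym (trans (∑-const ys 0) (*-zeroʳ (length ys)))
  ∑-swap (x ∷ xs) ys f rewrite ∑-swap xs ys f = sym (∑-+ ys (f x) _)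

  ∑-map : ∀ {a b} {A : Set a} {B : Set b} (g : A → B) xs (f : B → ℕ) →
    ∑ (map g xs) f ≡ ∑ xs (f ∘ g)
  ∑-map g []       f = refl
  ∑-map g (x ∷ xs) f = cong (f (g x) +_) (∑-map g xs f)

  ∑-concatMap : ∀ {a b} {A : Set a} {B : Set b} (g : A → List B) xs (f : B → ℕ) →
    ∑ (concatMap g xs) f ≡ ∑ xs (λ x → ∑ (g x) f)
  ∑-concatMap g []       f = refl
  ∑-concatMap g (x ∷ xs) f
    rewrite ∑-++ (g x) (concatMap g xs) f | ∑-concatMap g xs f = refl

-- Farkas' lemma over the integers, by Fourier-Motzkin elimination.

module Farkas where

  open import Data.Integer hiding (suc)
  open import Data.Integer.Properties
  open import Data.Integer.Tactic.RingSolver using (solve-∀)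
  open import Data.List using (List; []; _∷_; _++_; map; filter; cartesianProductWith)
  open import Data.List.Membership.Propositional using (_∈_)
  open import Data.List.Membership.Propositional.Properties using (∈-map⁻; ∈-map⁺; ∈-filter⁻; ∈-filter⁺; ∈-++⁻; ∈-++⁺ˡ; ∈-++⁺ʳ; ∈-cartesianProductWith⁻; ∈-cartesianProductWith⁺)
  open import Data.List.Relation.Unary.Any using (here; there)
  open import Data.Nat using (ℕ; zero; suc; s≤s; z≤n)
  open import Data.Product using (∃; ∃₂; _×_; _,_; proj₁; proj₂)
  open import Data.Sum using (_⊎_; inj₁; inj₂)
  open import Data.Vec using (Vec; []; _∷_)
  import Data.Vec as Vec
  open import Data.Vec.Relation.Unary.All using (All; []; _∷_)
  open import Relation.Binary.PropositionalEquality
  open import Relation.Nullary using (yes; no)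

  -- The row (c , κ) stands for the homogeneous constraint c · z + κ K ≥ 0.
  Row : ℕ → Set
  Row k = Vec ℤ k × ℤ

  dot : ∀ {k} → Vec ℤ k → Vec ℤ k → ℤ
  dot []      []      = 0ℤ
  dot (a ∷ u) (b ∷ v) = a * b + dot u v

  eval : ∀ {k} → Row k → Vec ℤ k → ℤ → ℤ
  eval (c , κ) z K = dot c z + κ * K

  infixl 6 _⊕_
  _⊕_ : ∀ {k} → Row k → Row k → Row k
  (c , κ) ⊕ (d , μ) = Vec.zipWith _+_ c d , κ + μ

  -- 1 + n copies of a row.
  copies₊ : ∀ {k} → ℕ → Row k → Row k
  copies₊ zero    r = r
  copies₊ (suc n) r = r ⊕ copies₊ n r

  -- Closure under sums alone, with repetition in place of scaling, makes every derivation a finite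
  -- multiset of constraints; this is what lets a refutation be read as a list of copies of Y.
  data Cone {k} (L : List (Row k)) : Row k → Set where
    generator : ∀ {r} → r ∈ L → Cone L r
    add       : ∀ {r s} → Cone L r → Cone L s → Cone L (r ⊕ s)

  cone-copies₊ : ∀ {k} {L : List (Row k)} {r} n → Cone L r → Cone L (copies₊ n r)
  cone-copies₊ zero    c = c
  cone-copies₊ (suc n) c = add c (cone-copies₊ n c)

  head : ∀ {k} → Row (suc k) → ℤ
  head (h ∷ _ , _) = h

  tail : ∀ {k} → Row (suc k) → Row k
  tail (_ ∷ c , κ) = c , κ

  dot-zipWith : ∀ {k} (u v z : Vec ℤ k) → dot (Vec.zipWith _+_ u v) z ≡ dot u z + dot v z
  dot-zipWith []      []      []      = refl
  dot-zipWith (a ∷ u) (b ∷ v) (c ∷ z) rewrite dot-zipWith u v z = lemma a b c _ _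
    where
    lemma : ∀ a b c d e → (a + b) * c + (d + e) ≡ (a * c + d) + (b * c + e)
    lemma = solve-∀

  eval-⊕ : ∀ {k} (r s : Row k) z K → eval (r ⊕ s) z K ≡ eval r z K + eval s z K
  eval-⊕ (c , κ) (d , μ) z K rewrite dot-zipWith c d z = lemma (dot c z) (dot d z) κ μ K
    where
    lemma : ∀ a b c d e → (a + b) + (c + d) * e ≡ (a + c * e) + (b + d * e)
    lemma = solve-∀

  eval-copies₊ : ∀ {k} n (r : Row k) z K → eval (copies₊ n r) z K ≡ + suc n * eval r z K
  eval-copies₊ zero    r z K = sym (*-identityˡ _)
  eval-copies₊ (suc n) r z K
    rewrite eval-⊕ r (copies₊ n r) z K | eval-copies₊ n r z K = lemma (eval r z K) (+ suc n)
    where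
    lemma : ∀ a b → a + b * a ≡ (+ 1 + b) * a
    lemma = solve-∀

  tail-⊕ : ∀ {k} (r s : Row (suc k)) → tail (r ⊕ s) ≡ tail r ⊕ tail s
  tail-⊕ (_ ∷ _ , _) (_ ∷ _ , _) = refl

  head-⊕ : ∀ {k} (r s : Row (suc k)) → head (r ⊕ s) ≡ head r + head s
  head-⊕ (_ ∷ _ , _) (_ ∷ _ , _) = refl

  tail-copies₊ : ∀ {k} n (r : Row (suc k)) → tail (copies₊ n r) ≡ copies₊ n (tail r)
  tail-copies₊ zero    r = refl
  tail-copies₊ (suc n) r = trans (tail-⊕ r (copies₊ n r)) (cong (tail r ⊕_) (tail-copies₊ n r))

  head-copies₊ : ∀ {k} n (r : Row (suc k)) → head (copies₊ n r) ≡ + suc n * head r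
  head-copies₊ zero    r = sym (*-identityˡ _)
  head-copies₊ (suc n) r
    rewrite head-⊕ r (copies₊ n r) | head-copies₊ n r = lemma (head r) (+ suc n)
    where
    lemma : ∀ a b → a + b * a ≡ (+ 1 + b) * a
    lemma = solve-∀

  dot-scale : ∀ {k} s (c z : Vec ℤ k) → dot c (Vec.map (s *_) z) ≡ s * dot c z
  dot-scale s []      []      = sym (*-zeroʳ s)
  dot-scale s (a ∷ c) (b ∷ z) rewrite dot-scale s c z = lemma s a b _
    where
    lemma : ∀ s a b d → a * (s * b) + s * d ≡ s * (a * b + d)
    lemma = solve-∀

  eval-∷ : ∀ {k} (r : Row (suc k)) t s z K →
    eval r (t ∷ Vec.map (s *_) z) (s * K) ≡ head r * t + s * eval (tail r) z K
  eval-∷ (h ∷ c , κ) t s z K rewrite dot-scale s c z = lemma h t s _ κ K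
    where
    lemma : ∀ h t s d κ K → (h * t + s * d) + κ * (s * K) ≡ h * t + s * (d + κ * K)
    lemma = solve-∀

  -- One Fourier–Motzkin step: the positive combination of two rows with heads of
  -- opposite signs in which the heads cancel.
  cancel-heads : ∀ {k} → ℤ → ℤ → Row (suc k) → Row (suc k) → Row (suc k)
  cancel-heads +[1+ a ] -[1+ b ] r s = copies₊ b r ⊕ copies₊ a s
  cancel-heads _        _        r s = r

  combine : ∀ {k} → Row (suc k) → Row (suc k) → Row (suc k)
  combine r s = cancel-heads (head r) (head s) r s

  -- The eliminated variable is itself nonnegative, so a row with head ≤ 0 already implies its own
  -- tail; hence such rows are kept, and only positive heads have to be cancelled against negative
  -- ones. Products with other signs merely repeat rows of `L`.
  combinations : ∀ {k} → List (Row (suc k)) → List (Row (suc k))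
  combinations L = filter (λ r → head r ≤? 0ℤ) (L ++ cartesianProductWith combine L L)

  cone-combine : ∀ {k} {L : List (Row (suc k))} {r s} → Cone L r → Cone L s → Cone L (combine r s)
  cone-combine {r = r} {s} c d = go (head r) (head s)
    where
    go : ∀ g h → Cone _ (cancel-heads g h r s)
    go +[1+ a ] -[1+ b ] = add (cone-copies₊ b c) (cone-copies₊ a d)
    go +[1+ a ] (+ _)    = c
    go +0       _        = c
    go -[1+ _ ] _        = c

  cone-combinations : ∀ {k} {L : List (Row (suc k))} {r} →
    r ∈ combinations L → Cone L r × head r ≤ 0ℤ
  cone-combinations {L = L} i with ∈-filter⁻ (λ r → head r ≤? 0ℤ) {xs = L ++ _} i
  ... | j , h≤0 with ∈-++⁻ L j
  ...   | inj₁ r∈L = generator r∈L , h≤0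
  ...   | inj₂ l with ∈-cartesianProductWith⁻ combine L L l
  ...     | p , n , p∈L , n∈L , refl = cone-combine (generator p∈L) (generator n∈L) , h≤0

  -- Taking tails is additive and a sum of nonpositive heads is nonpositive, so a derivation after
  -- elimination can be replayed before it.
  lift-cone : ∀ {k} {L : List (Row (suc k))} {v} → Cone (map tail (combinations L)) v →
    ∃ λ r → Cone L r × head r ≤ 0ℤ × tail r ≡ v
  lift-cone (generator i) with ∈-map⁻ tail i
  ... | r , r∈ , refl = let c , h = cone-combinations r∈ in r , c , h , refl
  lift-cone (add c d) with lift-cone c | lift-cone d
  ... | r , c′ , h , refl | s , d′ , h′ , refl =
    r ⊕ s , add c′ d′ , subst (_≤ 0ℤ) (sym (head-⊕ r s)) (+-mono-≤ h h′) , tail-⊕ r s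

  head-cancel : ∀ {k} a b (r s : Row (suc k)) → head r ≡ +[1+ a ] → head s ≡ -[1+ b ] →
    head (copies₊ b r ⊕ copies₊ a s) ≡ 0ℤ
  head-cancel a b r s p q
    rewrite head-⊕ (copies₊ b r) (copies₊ a s) | head-copies₊ b r | head-copies₊ a s | p | q
    = lemma +[1+ a ] +[1+ b ]
    where
    lemma : ∀ a b → b * a + a * (- b) ≡ 0ℤ
    lemma = solve-∀

  *-nonNeg : ∀ {a b} → 0ℤ ≤ a → 0ℤ ≤ b → 0ℤ ≤ a * b
  *-nonNeg {+ m} {+ n} _ _ = subst (0ℤ ≤_) (pos-* m n) (+≤+ z≤n)

  -- Among the lower bounds -eval (tail p) / head p given by the rows p of positive
  -- head, and the bound 0, the largest one is t / s.
  largest-bound : ∀ {k} (L ps : List (Row (suc k))) z K → (∀ {p} → p ∈ ps → p ∈ L) →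
    (∀ {r} → r ∈ map tail (combinations L) → 0ℤ ≤ eval r z K) →
    ∃₂ λ s t → 0ℤ < s × 0ℤ ≤ t ×
      (∀ {p} → p ∈ ps → 0ℤ < head p → 0ℤ ≤ head p * t + s * eval (tail p) z K) ×
      (∀ {n} → n ∈ L → head n ≤ 0ℤ → 0ℤ ≤ head n * t + s * eval (tail n) z K)
  largest-bound L [] z K sub sat = + 1 , 0ℤ , +<+ (s≤s z≤n) , ≤-refl , (λ ())
    , λ {n} n∈ h≤0 → subst (0ℤ ≤_) (lemma (head n) _)
        (sat (∈-map⁺ tail (∈-filter⁺ (λ r → head r ≤? 0ℤ) (∈-++⁺ˡ n∈) h≤0)))
    where
    lemma : ∀ h e → e ≡ h * 0ℤ + + 1 * e
    lemma = solve-∀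
  largest-bound L (p ∷ ps) z K sub sat
    with largest-bound L ps z K (λ i → sub (there i)) sat
  ... | s , t , 0<s , 0≤t , pos , nonpos
    with 0ℤ ≤? head p * t + s * eval (tail p) z K
  ... | yes ok = s , t , 0<s , 0≤t
    , (λ { (here refl) _ → ok ; (there i) → pos i }) , nonpos
  ... | no bad with head p in eq
  ...   | +0 = s , t , 0<s , 0≤t
          , (λ { (here refl) 0<h → contradiction′ 0<h ; (there i) → pos i }) , nonpos
    where
    contradiction′ : ∀ {A : Set} → 0ℤ < head p → A
    contradiction′ q with subst (0ℤ <_) eq q
    ... | +<+ ()
  ...   | -[1+ _ ] = s , t , 0<s , 0≤t
          , (λ { (here refl) 0<h → contradiction′ 0<h ; (there i) → pos i }) , nonpos
    where
    contradiction′ : ∀ {A : Set} → 0ℤ < head p → A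
    contradiction′ q with subst (0ℤ <_) eq q
    ... | ()
  -- The lower bound given by `p` exceeds `t / s`, so it becomes the new value. For earlier rows of
  -- positive head, the old inequality is added to the failed one with suitable multipliers; for
  -- rows of negative head, the reduced system contains the combination with `p`.
  ...   | +[1+ a ] = +[1+ a ] , - e , +<+ (s≤s z≤n) , <⇒≤ 0<-e , pos′ , nonpos′
    where
    e = eval (tail p) z K

    instance
      s-nonNeg : NonNegative s
      s-nonNeg = nonNegative (<⇒≤ 0<s)

      s-pos : Positive s
      s-pos = positive 0<s

    bad′ : +[1+ a ] * t + s * e < 0ℤ
    bad′ = ≰⇒> bad

    0<-e : 0ℤ < - e
    0<-e = neg-mono-< (*-cancelˡ-<-nonNeg s (≤-<-trans
      (subst (_≤ +[1+ a ] * t + s * e) (+-identityˡ _) (+-monoˡ-≤ (s * e) (*-nonNeg {+[1+ a ]} (+≤+ z≤n) 0≤t)))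
      (subst (+[1+ a ] * t + s * e <_) (sym (*-zeroʳ s)) bad′)))

    pos′ : ∀ {q} → q ∈ p ∷ ps → 0ℤ < head q → 0ℤ ≤ head q * (- e) + +[1+ a ] * eval (tail q) z K
    pos′ (here refl) _ rewrite eq = ≤-reflexive (lemma +[1+ a ] e)
      where
      lemma : ∀ a e → 0ℤ ≡ a * (- e) + a * e
      lemma = solve-∀
    pos′ {q} (there i) 0<h = *-cancelˡ-≤-pos 0ℤ _ s (subst₂ _≤_ (sym (*-zeroʳ s))
      (lemma (head q) s e +[1+ a ] (eval (tail q) z K) t)
      (+-mono-≤ (*-nonNeg {+[1+ a ]} (+≤+ z≤n) (pos i 0<h))
        (*-nonNeg (<⇒≤ 0<h) (neg-mono-≤ (<⇒≤ bad′)))))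
      where
      lemma : ∀ h s e a f t → a * (h * t + s * f) + h * (- (a * t + s * e)) ≡ s * (h * (- e) + a * f)
      lemma = solve-∀

    nonpos′ : ∀ {n} → n ∈ L → head n ≤ 0ℤ → 0ℤ ≤ head n * (- e) + +[1+ a ] * eval (tail n) z K
    nonpos′ {n} n∈ h≤0 with head n in eqn
    ... | +[1+ _ ] with () ← ≤⇒≯ h≤0 (+<+ (s≤s z≤n))
    ... | +0 = subst (0ℤ ≤_) (sym (+-identityˡ _)) (*-nonNeg {+[1+ a ]} (+≤+ z≤n)
          (sat (∈-map⁺ tail (∈-filter⁺ (λ r → head r ≤? 0ℤ) (∈-++⁺ˡ n∈) (≤-reflexive eqn)))))
    ... | -[1+ b ] = subst (0ℤ ≤_) value
          (sat (∈-map⁺ tail (∈-filter⁺ (λ r → head r ≤? 0ℤ) {xs = L ++ _} (∈-++⁺ʳ L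
            (subst (_∈ cartesianProductWith combine L L) combination
              (∈-cartesianProductWith⁺ combine (sub (here refl)) n∈)))
            (≤-reflexive (head-cancel a b p n eq eqn)))))
      where
      combination : combine p n ≡ copies₊ b p ⊕ copies₊ a n
      combination rewrite eq | eqn = refl
      lemma : ∀ a b e f → b * e + a * f ≡ (- b) * (- e) + a * f
      lemma = solve-∀
      value : eval (tail (copies₊ b p ⊕ copies₊ a n)) z K ≡ -[1+ b ] * (- e) + +[1+ a ] * eval (tail n) z K
      value rewrite tail-⊕ (copies₊ b p) (copies₊ a n) | tail-copies₊ b p | tail-copies₊ a n
                  | eval-⊕ (copies₊ b (tail p)) (copies₊ a (tail n)) z K
                  | eval-copies₊ b (tail p) z K | eval-copies₊ a (tail n) z K
                  = lemma +[1+ a ] +[1+ b ] e (eval (tail n) z K)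

  -- A rational solution `z / K` with its denominator cleared, so that everything stays in the
  -- integers.
  Feasible : ∀ {k} → List (Row k) → Set
  Feasible {k} L = ∃₂ λ (z : Vec ℤ k) K →
    All (0ℤ ≤_) z × 0ℤ < K × (∀ {r} → r ∈ L → 0ℤ ≤ eval r z K)

  -- Such a row is negative wherever `z ≥ 0` and `K > 0`, although the constraints that it sums
  -- would make it nonnegative.
  Refuted : ∀ {k} → List (Row k) → Set
  Refuted L = ∃ λ r → Cone L r × All (_≤ 0ℤ) (proj₁ r) × proj₂ r < 0ℤ

  all-scale : ∀ {k s} {z : Vec ℤ k} → 0ℤ ≤ s → All (0ℤ ≤_) z → All (0ℤ ≤_) (Vec.map (s *_) z)
  all-scale 0≤s []       = []
  all-scale 0≤s (p ∷ ps) = *-nonNeg 0≤s p ∷ all-scale 0≤s ps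

  -- Induction on the number of variables: a refutation of the reduced system lifts, and a solution
  -- of it extends by the largest lower bound `t / s` for the new variable, after the other
  -- coordinates and `K` are scaled by `s`.
  farkas : ∀ k (L : List (Row k)) → Feasible L ⊎ Refuted L
  farkas zero    [] = inj₁ ([] , + 1 , [] , +<+ (s≤s z≤n) , λ ())
  farkas zero    (([] , κ) ∷ L) with 0ℤ ≤? κ | farkas zero L
  ... | no  κ<0 | _ = inj₂ (([] , κ) , generator (here refl) , [] , ≰⇒> κ<0)
  ... | yes 0≤κ | inj₂ (r , c , p , q) = inj₂ (r , weaken c , p , q)
    where
    weaken : ∀ {r} → Cone L r → Cone (([] , κ) ∷ L) r
    weaken (generator i) = generator (there i)
    weaken (add c d)     = add (weaken c) (weaken d)
  ... | yes 0≤κ | inj₁ ([] , K , _ , 0<K , sat) = inj₁ ([] , K , [] , 0<K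
    , λ { (here refl) → subst (0ℤ ≤_) (sym (+-identityˡ _)) (*-nonNeg 0≤κ (<⇒≤ 0<K)) ; (there i) → sat i })
  farkas (suc k) L with farkas k (map tail (combinations L))
  ... | inj₂ (v , c , p , q) with lift-cone c
  ...   | (h ∷ _ , _) , c′ , h≤0 , refl = inj₂ (_ , c′ , h≤0 ∷ p , q)
  farkas (suc k) L | inj₁ (z , K , 0≤z , 0<K , sat)
    with largest-bound L L z K (λ i → i) sat
  ... | s , t , 0<s , 0≤t , pos , nonpos = inj₁ (t ∷ Vec.map (s *_) z , s * K
    , 0≤t ∷ all-scale (<⇒≤ 0<s) 0≤z
    , subst (_< s * K) (*-zeroʳ s) (*-monoˡ-<-pos s {{positive 0<s}} 0<K)
    , λ {r} i → subst (0ℤ ≤_) (sym (eval-∷ r t s z K)) (sat′ r i))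
    where
    sat′ : ∀ r → r ∈ L → 0ℤ ≤ head r * t + s * eval (tail r) z K
    sat′ r i with head r ≤? 0ℤ
    ... | yes h≤0 = nonpos i h≤0
    ... | no  h>0 = pos i (≰⇒> h>0)

-- The weight inequality holds on at most 127 triples of three groups.

module Count where

  open Prelude
  open import Data.Fin using (toℕ)
  open import Data.Fin.Properties using (all?; any?; ¬∀⟶∃¬)
  open import Data.Nat.DivMod using (_mod_)
  open Sums

  exchange : ∀ a b c → a + (b + c) ≡ b + (a + c)
  exchange = solve-∀

  ∑-markov : ∀ {a} {A : Set a} xs K (f : A → ℕ) → K * ∑ xs (λ x → ⟦ does (K ≤? f x) ⟧) ≤ ∑ xs f
  ∑-markov xs K f = subst (_≤ ∑ xs f) (∑-*ˡ xs K _) (∑-mono xs λ x → bound (K ≤? f x))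
    where
    bound : ∀ {m} (d : Dec (K ≤ m)) → K * ⟦ does d ⟧ ≤ m
    bound {m} (yes p) = subst (_≤ m) (sym (*-identityʳ K)) p
    bound {m} (no  _) = subst (_≤ m) (sym (*-zeroʳ K)) z≤n

  ∑≡0 : ∀ {a} {A : Set a} xs (f : A → ℕ) → ∑ xs f ≡ 0 → ∀ (φ : ℕ → ℕ) → ∑ xs (λ x → φ (f x)) ≡ length xs * φ 0
  ∑≡0 []       f eq φ = refl
  ∑≡0 (x ∷ xs) f eq φ = cong₂ _+_ (cong φ (m+n≡0⇒m≡0 (f x) eq)) (∑≡0 xs f (m+n≡0⇒n≡0 (f x) eq) φ)

  -- The term of size at least `K` exhausts the total, so every other term is 0 and contributes
  -- `φ 0`.
  ∑-concentrated : ∀ {a} {A : Set a} y ys K (f : A → ℕ) {x} → ∑ (y ∷ ys) f ≤ K → x ∈ y ∷ ys → K ≤ f x →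
    ∀ (φ : ℕ → ℕ) → ∑ (y ∷ ys) (λ x → φ (f x)) ≡ φ (f x) + length ys * φ 0
  ∑-concentrated y ys K f ∑≤K (here refl) K≤ φ = cong (φ (f y) +_) (∑≡0 ys f
    (n≤0⇒n≡0 (+-cancelˡ-≤ (f y) _ _ (≤-trans (≤-trans ∑≤K K≤) (≤-reflexive (sym (+-identityʳ _)))))) φ)
  ∑-concentrated y (z ∷ zs) K f {x} ∑≤K (there i) K≤ φ = begin
    φ (f y) + ∑ (z ∷ zs) (λ x → φ (f x))
      ≡⟨ cong₂ (λ a b → φ a + b) fy≡0 (∑-concentrated z zs K f (≤-trans (m≤n+m _ (f y)) ∑≤K) i K≤ φ) ⟩
    φ 0 + (φ (f x) + length zs * φ 0)   ≡⟨ exchange (φ 0) (φ (f x)) _ ⟩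
    φ (f x) + (φ 0 + length zs * φ 0)   ∎
    where
    open ≡-Reasoning
    fy≡0 : f y ≡ 0
    fy≡0 = n≤0⇒n≡0 (+-cancelʳ-≤ K (f y) 0 (≤-trans (+-monoʳ-≤ (f y) (≤-trans K≤ (term≤∑ f i))) ∑≤K))

  ∑-lower : ∀ {a} {A : Set a} y ys c (f : A → ℕ) {x} → x ∈ y ∷ ys → (∀ x → c ≤ f x) →
    f x + length ys * c ≤ ∑ (y ∷ ys) f
  ∑-lower y ys c f (here refl) h =
    +-monoʳ-≤ (f y) (≤-trans (≤-reflexive (sym (∑-const ys c))) (∑-mono ys h))
  ∑-lower y (z ∷ zs) c f {x} (there i) h = begin
    f x + (c + length zs * c)   ≡⟨ exchange (f x) c _ ⟩
    c + (f x + length zs * c)   ≤⟨ +-mono-≤ (h y) (∑-lower z zs c f i h) ⟩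
    f y + ∑ (z ∷ zs) f          ∎
    where open ≤-Reasoning

  ∑-upper : ∀ {a} {A : Set a} y ys c (f : A → ℕ) {x} → x ∈ y ∷ ys → (∀ x → f x ≤ c) →
    ∑ (y ∷ ys) f ≤ f x + length ys * c
  ∑-upper y ys c f (here refl) h = +-monoʳ-≤ (f y) (∑-≤const ys c h)
  ∑-upper y (z ∷ zs) c f {x} (there i) h = begin
    f y + ∑ (z ∷ zs) f          ≤⟨ +-mono-≤ (h y) (∑-upper z zs c f i h) ⟩
    c + (f x + length zs * c)   ≡⟨ exchange c (f x) _ ⟩
    f x + (c + length zs * c)   ∎
    where open ≤-Reasoning

  -- Opaque, so that sums over the vertices of a group are not expanded term by term.
  opaque
    F4 : List (Fin 4)
    F4 = allFin 4

    F7 : List (Fin 7)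
    F7 = allFin 7

    ∑F4-≤const : ∀ c {f : Fin 4 → ℕ} → (∀ a → f a ≤ c) → ∑ F4 f ≤ 4 * c
    ∑F4-≤const c {f} h = ∑-≤const F4 c {f} h

    ∑F7-≤const : ∀ c {f : Fin 7 → ℕ} → (∀ a → f a ≤ c) → ∑ F7 f ≤ 7 * c
    ∑F7-≤const c {f} h = ∑-≤const F7 c {f} h

    ∑F7-concentrated : ∀ K (f : Fin 7 → ℕ) {a} → ∑ F7 f ≤ K → K ≤ f a →
      ∀ (φ : ℕ → ℕ) → ∑ F7 (λ a → φ (f a)) ≡ φ (f a) + 6 * φ 0
    ∑F7-concentrated K f {a} h K≤ φ = ∑-concentrated 0F (1F ∷ 2F ∷ 3F ∷ 4F ∷ 5F ∷ 6F ∷ []) K f h (∈-allFin a) K≤ φ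

    ∑F4-tight : ∀ c (f : Fin 4 → ℕ) → (∀ a → c ≤ f a) → ∑ F4 f ≤ 4 * c → ∀ a → f a ≤ c
    ∑F4-tight c f lower upper a =
      +-cancelʳ-≤ (3 * c) _ _ (≤-trans (∑-lower 0F (1F ∷ 2F ∷ 3F ∷ []) c f (∈-allFin a) lower) upper)

    ∑F4-all : ∀ (f : Fin 4 → ℕ) → (∀ a → f a ≤ 1) → 3 < ∑ F4 f → ∀ a → 1 ≤ f a
    ∑F4-all f upper lower a =
      +-cancelʳ-≤ 3 _ _ (≤-trans lower (∑-upper 0F (1F ∷ 2F ∷ 3F ∷ []) 1 f (∈-allFin a) upper))

  -- The weights of a group: four vertices of a tile, then three vertices of weight 0.
  extend : (Fin 4 → ℕ) → Fin 7 → ℕ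
  extend p 0F = p 0F
  extend p 1F = p 1F
  extend p 2F = p 2F
  extend p 3F = p 3F
  extend p (suc (suc (suc (suc _)))) = 0

  opaque
    unfolding F4 F7

    ∑-extend : ∀ p (φ : ℕ → ℕ) → ∑ F7 (λ a → φ (extend p a)) ≡ ∑ F4 (λ a → φ (p a)) + 3 * φ 0
    ∑-extend p φ = reassociate (φ (p 0F)) (φ (p 1F)) (φ (p 2F)) (φ (p 3F)) (3 * φ 0)
      where
      reassociate : ∀ a b c d z → a + (b + (c + (d + z))) ≡ (a + (b + (c + (d + 0)))) + z
      reassociate a b c d z = sym (trans (+-assoc a _ z) (cong (a +_) (trans (+-assoc b _ z)
        (cong (b +_) (trans (+-assoc c _ z) (cong (c +_) (+-assoc d 0 z)))))))

  ∑-extend-≤ : ∀ p K → ∑ F4 p ≤ K → ∑ F7 (extend p) ≤ K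
  ∑-extend-≤ p K h = ≤-trans (≤-reflexive (trans (∑-extend p (λ x → x)) (+-identityʳ _))) h

  -- Cyclic shifts: for fixed `k` the pairs `(a , shift k a)` form a perfect matching between two
  -- tiles, and the four values of `k` partition all 16 pairs.
  shift : Fin 4 → Fin 4 → Fin 4
  shift k a = (toℕ k + toℕ a) mod 4

  opaque
    unfolding F4

    ∑-shift : ∀ k (u : Fin 4 → ℕ) → ∑ F4 (λ a → u (shift k a)) ≡ ∑ F4 u
    ∑-shift 0F u = refl
    ∑-shift 1F u = ∑-++-comm (1F ∷ 2F ∷ 3F ∷ []) (0F ∷ []) u
    ∑-shift 2F u = ∑-++-comm (2F ∷ 3F ∷ []) (0F ∷ 1F ∷ []) u
    ∑-shift 3F u = ∑-++-comm (3F ∷ []) (0F ∷ 1F ∷ 2F ∷ []) u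

  shift-comm : ∀ k a → shift k a ≡ shift a k
  shift-comm k a = cong (_mod 4) (+-comm (toℕ k) (toℕ a))

  unshift : Fin 4 → Fin 4 → Fin 4
  unshift k b = ((4 ∸ toℕ k) + toℕ b) mod 4

  shift-unshift : ∀ k b → shift k (unshift k b) ≡ b
  shift-unshift = λ where
    0F 0F → refl ; 0F 1F → refl ; 0F 2F → refl ; 0F 3F → refl
    1F 0F → refl ; 1F 1F → refl ; 1F 2F → refl ; 1F 3F → refl
    2F 0F → refl ; 2F 1F → refl ; 2F 2F → refl ; 2F 3F → refl
    3F 0F → refl ; 3F 1F → refl ; 3F 2F → refl ; 3F 3F → refl

  -- Since `shift` is symmetric, `k` is also moved by a cyclic shift when `a` is fixed; each inner
  -- sum is reindexed in this way before the two sums are exchanged.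
  ∑-latin : ∀ (F : Fin 4 → Fin 4 → ℕ) →
    ∑ F4 (λ a → ∑ F4 (F a)) ≡ ∑ F4 (λ k → ∑ F4 (λ a → F a (shift k a)))
  ∑-latin F = trans
    (∑-cong F4 λ a → trans (sym (∑-shift a (F a))) (∑-cong F4 λ k → cong (F a) (shift-comm a k)))
    (∑-swap F4 F4 λ a k → F a (shift k a))

  opaque
    single : ℕ → ℕ → ℕ
    single K x = ⟦ does (K ≤? x) ⟧

    -- The dual constraint of an edge with weights `x`, `y`, `z`, scaled from 1 to `K`: doubling any
    -- one of the three vertices gives a Y, and doubling the lightest gives the strictest condition.
    triple : ℕ → ℕ → ℕ → ℕ → ℕ
    triple K x y z = ⟦ does (K ≤? x + y + z + (x ⊓ y ⊓ z)) ⟧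

    single≤1 : ∀ K x → single K x ≤ 1
    single≤1 K x = ⟦⟧≤1 (does (K ≤? x))

    light : ∀ {K x} → x < K → single K x ≡ 0
    light {K} {x} x<K = indicator-no (K ≤? x) (λ K≤x → ⊥-elim (<⇒≱ x<K K≤x))

    triple≤1 : ∀ K x y z → triple K x y z ≤ 1
    triple≤1 K x y z = ⟦⟧≤1 (does (K ≤? _))

    -- A zero weight also annihilates the minimum, so only the sum of the other two weights remains.
    triple-0ˡ : ∀ K y z → triple K 0 y z ≤ single K (y + z)
    triple-0ˡ K y z = indicator-mono (K ≤? _) (K ≤? _) λ h → subst (K ≤_) (+-identityʳ (y + z)) h

    triple-0ᵐ : ∀ K x z → triple K x 0 z ≤ single K (x + z)
    triple-0ᵐ K x z = indicator-mono (K ≤? _) (K ≤? _) λ h → subst (K ≤_) lemma h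
      where
      lemma : x + 0 + z + (x ⊓ 0 ⊓ z) ≡ x + z
      lemma rewrite ⊓-zeroʳ x | +-identityʳ x = +-identityʳ (x + z)

    triple-0ʳ : ∀ K x y → triple K x y 0 ≤ single K (x + y)
    triple-0ʳ K x y = indicator-mono (K ≤? _) (K ≤? _) λ h → subst (K ≤_) lemma h
      where
      lemma : x + y + 0 + (x ⊓ y ⊓ 0) ≡ x + y
      lemma rewrite ⊓-zeroʳ (x ⊓ y) | +-identityʳ (x + y) = +-identityʳ (x + y)

    triple⇒≤ : ∀ K x y z → 1 ≤ triple K x y z → K ≤ x + y + z + (x ⊓ y ⊓ z)
    triple⇒≤ K x y z = indicator⇒ (K ≤? _)

    single-markov : ∀ {a} {A : Set a} xs K (f : A → ℕ) → K * ∑ xs (λ x → single K (f x)) ≤ ∑ xs f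
    single-markov = ∑-markov

    triple-swap : ∀ K x y z → triple K x y z ≡ triple K y x z
    triple-swap K x y z = cong (λ w → ⟦ does (K ≤? w) ⟧)
      (cong₂ (λ u v → u + z + (v ⊓ z)) (+-comm x y) (⊓-comm x y))

    triple-rotate : ∀ K x y z → triple K x y z ≡ triple K z x y
    triple-rotate K x y z = cong (λ w → ⟦ does (K ≤? w) ⟧)
      (cong₂ _+_ (rotate x y z) (trans (⊓-comm (x ⊓ y) z) (sym (⊓-assoc z x y))))
      where
      rotate : ∀ x y z → x + y + z ≡ z + x + y
      rotate = solve-∀

  -- Counts the pairs that satisfy the weight inequality together with a third vertex of weight 0.
  pairs : ℕ → (Fin 4 → ℕ) → (Fin 4 → ℕ) → ℕ
  pairs K p q = ∑ F7 λ b → ∑ F7 λ c → single K (extend p b + extend q c)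

  triples : ℕ → (Fin 4 → ℕ) → (Fin 4 → ℕ) → (Fin 4 → ℕ) → ℕ
  triples K p q r = ∑ F7 λ a → ∑ F7 λ b → ∑ F7 λ c → triple K (extend p a) (extend q b) (extend r c)

  module _ (K : ℕ) (0<K : 0 < K) where

    private
      instance
        K≢0 : NonZero K
        K≢0 = >-nonZero 0<K

    count≤ : ∀ {a} {A : Set a} xs m (f : A → ℕ) → ∑ xs f ≤ m * K → ∑ xs (λ x → single K (f x)) ≤ m
    count≤ xs m f h = *-cancelˡ-≤ K (≤-trans (single-markov xs K f) (≤-trans h (≤-reflexive (*-comm m K))))

    Heavy : (Fin 4 → ℕ) → Set
    Heavy p = ∃ λ a → K ≤ extend p a

    opaque
      heavy? : ∀ p → (Heavy p) ⊎ (∀ a → extend p a < K)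
      heavy? p with all? (λ a → extend p a <? K)
      ... | yes all = inj₂ all
      ... | no ¬all with ¬∀⟶∃¬ 7 _ (λ a → extend p a <? K) ¬all
      ...   | a , ≮ = inj₁ (a , ≮⇒≥ ≮)

    pairs-light : ∀ p q → (∀ a → extend p a < K) → (∀ a → extend q a < K) →
      pairs K p q ≡ ∑ F4 λ b → ∑ F4 λ c → single K (p b + q c)
    pairs-light p q p< q< = begin
      pairs K p q
        ≡⟨ ∑-extend p (λ x → ∑ F7 λ c → single K (x + extend q c)) ⟩
      ∑ F4 (λ b → ∑ F7 λ c → single K (p b + extend q c)) + 3 * ∑ F7 (λ c → single K (extend q c))
        ≡⟨ cong₂ (λ u v → u + 3 * v)
             (∑-cong F4 λ b → trans (∑-extend q (λ y → single K (p b + y)))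
               (cong (λ w → ∑ F4 (λ c → single K (p b + q c)) + 3 * w)
                 (light (subst (_< K) (sym (+-identityʳ (p b))) (extended b)))))
             (trans (∑-cong F7 λ c → light (q< c)) (trans (∑-const F7 0) (*-zeroʳ (length F7)))) ⟩
      ∑ F4 (λ b → ∑ F4 (λ c → single K (p b + q c)) + 0) + 0
        ≡⟨ +-identityʳ _ ⟩
      ∑ F4 (λ b → ∑ F4 (λ c → single K (p b + q c)) + 0)
        ≡⟨ ∑-cong F4 (λ b → +-identityʳ _) ⟩
      ∑ F4 (λ b → ∑ F4 λ c → single K (p b + q c)) ∎
      where
      open ≡-Reasoning
      extended : ∀ b → p b < K
      extended = λ where 0F → p< 0F ; 1F → p< 1F ; 2F → p< 2F ; 3F → p< 3F

    -- Without heavy vertices, both members of a counted pair are tile vertices. Each of the four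
    -- shift matchings has total weight at most `2 * K`, hence contains at most two pairs of weight
    -- at least `K`.
    pairs-light≤8 : ∀ p q → ∑ F4 p ≤ K → ∑ F4 q ≤ K →
      (∀ a → extend p a < K) → (∀ a → extend q a < K) → pairs K p q ≤ 8
    pairs-light≤8 p q ∑p ∑q p< q< = begin
      pairs K p q
        ≡⟨ pairs-light p q p< q< ⟩
      ∑ F4 (λ b → ∑ F4 λ c → single K (p b + q c))
        ≡⟨ ∑-latin (λ b c → single K (p b + q c)) ⟩
      ∑ F4 (λ k → ∑ F4 λ b → single K (p b + q (shift k b)))
        ≤⟨ ∑F4-≤const 2 (λ k → count≤ F4 2 (λ b → p b + q (shift k b)) (matching k)) ⟩
      8 ∎
      where
      open ≤-Reasoning
      matching : ∀ k → ∑ F4 (λ b → p b + q (shift k b)) ≤ 2 * K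
      matching k = begin
        ∑ F4 (λ b → p b + q (shift k b))      ≡⟨ ∑-+ F4 p (λ b → q (shift k b)) ⟩
        ∑ F4 p + ∑ F4 (λ b → q (shift k b))   ≡⟨ cong (∑ F4 p +_) (∑-shift k q) ⟩
        ∑ F4 p + ∑ F4 q                       ≤⟨ +-mono-≤ ∑p ∑q ⟩
        K + K                                 ≡⟨ cong (K +_) (+-identityʳ K) ⟨
        2 * K                                 ∎

    pairs-sym : ∀ p q → pairs K p q ≡ pairs K q p
    pairs-sym p q = trans (∑-swap F7 F7 _)
      (∑-cong F7 λ c → ∑-cong F7 λ b → cong (single K) (+-comm (extend p b) (extend q c)))

    -- 13 = 7 + 6: the heavy vertex may pair with all seven vertices, while each of the six others
    -- has weight 0 and needs a partner of weight at least `K`, of which there is at most one.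
    pairs-heavy : ∀ p q → ∑ F4 p ≤ K → ∑ F4 q ≤ K → Heavy p → pairs K p q ≤ 13
    pairs-heavy p q ∑p ∑q (a , K≤) = begin
      pairs K p q
        ≡⟨ ∑F7-concentrated K (extend p) {a} (∑-extend-≤ p K ∑p) K≤ (λ x → ∑ F7 λ c → single K (x + extend q c)) ⟩
      ∑ F7 (λ c → single K (extend p a + extend q c)) + 6 * ∑ F7 (λ c → single K (extend q c))
        ≤⟨ +-mono-≤ (∑F7-≤const 1 λ c → single≤1 K _)
             (*-monoʳ-≤ 6 (count≤ F7 1 (extend q) (≤-trans (∑-extend-≤ q K ∑q) (≤-reflexive (sym (+-identityʳ K)))))) ⟩
      13 ∎
      where open ≤-Reasoning

    pairs≤13 : ∀ p q → ∑ F4 p ≤ K → ∑ F4 q ≤ K → pairs K p q ≤ 13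
    pairs≤13 p q ∑p ∑q with heavy? p | heavy? q
    ... | inj₁ hp | _       = pairs-heavy p q ∑p ∑q hp
    ... | inj₂ _  | inj₁ hq = subst (_≤ 13) (pairs-sym q p) (pairs-heavy q p ∑q ∑p hq)
    ... | inj₂ lp | inj₂ lq = ≤-trans (pairs-light≤8 p q ∑p ∑q lp lq) (m≤m+n 8 5)

    -- 127 = 49 + 6 * 13: the heavy vertex lies in 49 triples, and a triple through one of the six
    -- weightless vertices reduces to a pair.
    triples-heavyˡ : ∀ p q r → ∑ F4 p ≤ K → ∑ F4 q ≤ K → ∑ F4 r ≤ K → Heavy p → triples K p q r ≤ 127
    triples-heavyˡ p q r ∑p ∑q ∑r (a , K≤) = begin
      triples K p q r
        ≡⟨ ∑F7-concentrated K (extend p) {a} (∑-extend-≤ p K ∑p) K≤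
             (λ x → ∑ F7 λ b → ∑ F7 λ c → triple K x (extend q b) (extend r c)) ⟩
      ∑ F7 (λ b → ∑ F7 λ c → triple K (extend p a) (extend q b) (extend r c))
        + 6 * ∑ F7 (λ b → ∑ F7 λ c → triple K 0 (extend q b) (extend r c))
        ≤⟨ +-mono-≤ (∑F7-≤const 7 λ b → ∑F7-≤const 1 λ c → triple≤1 K (extend p a) _ _)
             (*-monoʳ-≤ 6 (≤-trans (∑-mono F7 λ b → ∑-mono F7 λ c → triple-0ˡ K (extend q b) (extend r c))
               (pairs≤13 q r ∑q ∑r))) ⟩
      127 ∎
      where open ≤-Reasoning

    triples-swap : ∀ p q r → triples K p q r ≡ triples K q p r
    triples-swap p q r = trans (∑-swap F7 F7 _)
      (∑-cong F7 λ b → ∑-cong F7 λ a → ∑-cong F7 λ c → triple-swap K (extend p a) (extend q b) (extend r c))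

    triples-rotate : ∀ p q r → triples K p q r ≡ triples K r p q
    triples-rotate p q r = trans
      (∑-cong F7 λ a → trans (∑-swap F7 F7 _)
        (∑-cong F7 λ c → ∑-cong F7 λ b → triple-rotate K (extend p a) (extend q b) (extend r c)))
      (∑-swap F7 F7 _)

    inner : (Fin 4 → ℕ) → (Fin 4 → ℕ) → (Fin 4 → ℕ) → ℕ
    inner p q r = ∑ F4 λ a → ∑ F4 λ b → ∑ F4 λ c → triple K (p a) (q b) (r c)

    ∑F4≤∑F7 : ∀ p (φ : ℕ → ℕ) → ∑ F4 (λ a → φ (p a)) ≤ ∑ F7 (λ a → φ (extend p a))
    ∑F4≤∑F7 p φ = subst (∑ F4 (λ a → φ (p a)) ≤_) (sym (∑-extend p φ)) (m≤m+n _ _)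

    ∑F4-+3* : ∀ (f g : Fin 4 → ℕ) → ∑ F4 (λ a → f a + 3 * g a) ≡ ∑ F4 f + 3 * ∑ F4 g
    ∑F4-+3* f g = trans (∑-+ F4 f (λ a → 3 * g a)) (cong (∑ F4 f +_) (∑-*ˡ F4 3 g))

    -- A triple not made of tile vertices contains one of the three weightless vertices of some
    -- group. Fixing that vertex leaves a pair, which costs `3 * B` for each of the three groups.
    triples-split : ∀ p q r B → pairs K p q ≤ B → pairs K p r ≤ B → pairs K q r ≤ B →
      triples K p q r ≤ inner p q r + 3 * B + 3 * B + 3 * B
    triples-split p q r B pq pr qr = begin
      triples K p q r
        ≡⟨ ∑-extend p X ⟩
      ∑ F4 (λ a → X (p a)) + 3 * X 0
        ≤⟨ +-mono-≤ X-bound (*-monoʳ-≤ 3 (≤-trans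
             (∑-mono F7 λ b → ∑-mono F7 λ c → triple-0ˡ K (extend q b) (extend r c)) qr)) ⟩
      inner p q r + 3 * B + 3 * B + 3 * B ∎
      where
      open ≤-Reasoning
      Y : ℕ → ℕ → ℕ
      Y x y = ∑ F7 λ c → triple K x y (extend r c)
      X : ℕ → ℕ
      X x = ∑ F7 λ b → Y x (extend q b)
      Y-bound : ∑ F4 (λ a → ∑ F4 λ b → Y (p a) (q b)) ≤ inner p q r + 3 * B
      Y-bound = begin
        ∑ F4 (λ a → ∑ F4 λ b → Y (p a) (q b))
          ≡⟨ ∑-cong F4 (λ a → ∑-cong F4 λ b → ∑-extend r (triple K (p a) (q b))) ⟩
        ∑ F4 (λ a → ∑ F4 λ b → ∑ F4 (λ c → triple K (p a) (q b) (r c)) + 3 * triple K (p a) (q b) 0)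
          ≡⟨ ∑-cong F4 (λ a → ∑F4-+3* (λ b → ∑ F4 λ c → triple K (p a) (q b) (r c)) (λ b → triple K (p a) (q b) 0)) ⟩
        ∑ F4 (λ a → ∑ F4 (λ b → ∑ F4 (λ c → triple K (p a) (q b) (r c))) + 3 * ∑ F4 (λ b → triple K (p a) (q b) 0))
          ≡⟨ ∑F4-+3* (λ a → ∑ F4 λ b → ∑ F4 λ c → triple K (p a) (q b) (r c)) (λ a → ∑ F4 λ b → triple K (p a) (q b) 0) ⟩
        inner p q r + 3 * ∑ F4 (λ a → ∑ F4 (λ b → triple K (p a) (q b) 0))
          ≤⟨ +-monoʳ-≤ (inner p q r) (*-monoʳ-≤ 3 (begin
               ∑ F4 (λ a → ∑ F4 (λ b → triple K (p a) (q b) 0))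
                 ≤⟨ ∑-mono F4 (λ a → ∑-mono F4 λ b → triple-0ʳ K (p a) (q b)) ⟩
               ∑ F4 (λ a → ∑ F4 (λ b → single K (p a + q b)))
                 ≤⟨ ∑-mono F4 (λ a → ∑F4≤∑F7 q (λ y → single K (p a + y))) ⟩
               ∑ F4 (λ a → ∑ F7 (λ b → single K (p a + extend q b)))
                 ≤⟨ ∑F4≤∑F7 p (λ x → ∑ F7 (λ b → single K (x + extend q b))) ⟩
               pairs K p q
                 ≤⟨ pq ⟩
               B ∎)) ⟩
        inner p q r + 3 * B ∎
      X-bound : ∑ F4 (λ a → X (p a)) ≤ inner p q r + 3 * B + 3 * B
      X-bound = begin
        ∑ F4 (λ a → X (p a))
          ≡⟨ ∑-cong F4 (λ a → ∑-extend q (Y (p a))) ⟩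
        ∑ F4 (λ a → ∑ F4 (λ b → Y (p a) (q b)) + 3 * Y (p a) 0)
          ≡⟨ ∑F4-+3* (λ a → ∑ F4 λ b → Y (p a) (q b)) (λ a → Y (p a) 0) ⟩
        ∑ F4 (λ a → ∑ F4 (λ b → Y (p a) (q b))) + 3 * ∑ F4 (λ a → Y (p a) 0)
          ≤⟨ +-mono-≤ Y-bound (*-monoʳ-≤ 3 (begin
               ∑ F4 (λ a → Y (p a) 0)
                 ≤⟨ ∑-mono F4 (λ a → ∑-mono F7 λ c → triple-0ᵐ K (p a) (extend r c)) ⟩
               ∑ F4 (λ a → ∑ F7 λ c → single K (p a + extend r c))
                 ≤⟨ ∑F4≤∑F7 p (λ x → ∑ F7 λ c → single K (x + extend r c)) ⟩
               pairs K p r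
                 ≤⟨ pr ⟩
               B ∎)) ⟩
        inner p q r + 3 * B + 3 * B ∎

    -- The 64 triples split into 16 perfect matchings.
    matching-count : (p q r : Fin 4 → ℕ) → Fin 4 → Fin 4 → ℕ
    matching-count p q r k l = ∑ F4 λ a → triple K (p a) (q (shift k a)) (r (shift l a))

    inner-matchings : ∀ p q r → inner p q r ≡ ∑ F4 λ k → ∑ F4 λ l → matching-count p q r k l
    inner-matchings p q r = begin
      inner p q r
        ≡⟨ ∑-latin (λ a b → ∑ F4 λ c → triple K (p a) (q b) (r c)) ⟩
      ∑ F4 (λ k → ∑ F4 λ a → ∑ F4 λ c → triple K (p a) (q (shift k a)) (r c))
        ≡⟨ ∑-cong F4 (λ k → ∑-latin (λ a c → triple K (p a) (q (shift k a)) (r c))) ⟩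
      ∑ F4 (λ k → ∑ F4 λ l → matching-count p q r k l) ∎
      where open ≡-Reasoning

    x⊓y⊓z≤x : ∀ x y z → x ⊓ y ⊓ z ≤ x
    x⊓y⊓z≤x x y z = ≤-trans (m⊓n≤m (x ⊓ y) z) (m⊓n≤m x y)

    x⊓y⊓z≤y : ∀ x y z → x ⊓ y ⊓ z ≤ y
    x⊓y⊓z≤y x y z = ≤-trans (m⊓n≤m (x ⊓ y) z) (m⊓n≤n x y)

    -- The minimum is at most a third of the sum.
    good⇒3K≤ : ∀ x y z → K ≤ x + y + z + (x ⊓ y ⊓ z) → 3 * K ≤ 4 * (x + y + z)
    good⇒3K≤ x y z h = begin
      3 * K                       ≤⟨ *-monoʳ-≤ 3 h ⟩
      3 * (x + y + z + m)         ≡⟨ lemma x y z m ⟩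
      3 * (x + y + z) + (m + m + m) ≤⟨ +-monoʳ-≤ (3 * (x + y + z))
                                     (+-mono-≤ (+-mono-≤ (x⊓y⊓z≤x x y z) (x⊓y⊓z≤y x y z)) (m⊓n≤n (x ⊓ y) z)) ⟩
      3 * (x + y + z) + (x + y + z) ≡⟨ lemma′ (x + y + z) ⟩
      4 * (x + y + z)             ∎
      where
      open ≤-Reasoning
      m = x ⊓ y ⊓ z
      lemma : ∀ x y z m → 3 * (x + y + z + m) ≡ 3 * (x + y + z) + (m + m + m)
      lemma = solve-∀
      lemma′ : ∀ s → 3 * s + s ≡ 4 * s
      lemma′ = solve-∀

    -- Equality in the averaging estimate forces the minimum to be at least `K / 4`, and three
    -- weights of at least `K / 4` whose sum is at most `3K / 4` are all equal to `K / 4`.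
    quarters : ∀ x y z → K ≤ x + y + z + (x ⊓ y ⊓ z) → 4 * (x + y + z) ≤ 3 * K →
      4 * x ≤ K × 4 * y ≤ K × 4 * z ≤ K
    quarters x y z h tight =
        +-cancelʳ-≤ (2 * K) _ _ (≤-trans (+-monoʳ-≤ (4 * x) (2K≤ y z K≤4y K≤4z)) (≤-trans (≤-reflexive (e₁ x y z)) (≤-trans tight (≤-reflexive (e K)))))
      , +-cancelʳ-≤ (2 * K) _ _ (≤-trans (+-monoʳ-≤ (4 * y) (2K≤ x z K≤4x K≤4z)) (≤-trans (≤-reflexive (e₂ x y z)) (≤-trans tight (≤-reflexive (e K)))))
      , +-cancelʳ-≤ (2 * K) _ _ (≤-trans (+-monoʳ-≤ (4 * z) (2K≤ x y K≤4x K≤4y)) (≤-trans (≤-reflexive (e₃ x y z)) (≤-trans tight (≤-reflexive (e K)))))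
      where
      m = x ⊓ y ⊓ z
      e : ∀ K → 3 * K ≡ K + 2 * K
      e = solve-∀
      e₁ : ∀ x y z → 4 * x + (4 * y + 4 * z) ≡ 4 * (x + y + z)
      e₁ = solve-∀
      e₂ : ∀ x y z → 4 * y + (4 * x + 4 * z) ≡ 4 * (x + y + z)
      e₂ = solve-∀
      e₃ : ∀ x y z → 4 * z + (4 * x + 4 * y) ≡ 4 * (x + y + z)
      e₃ = solve-∀
      K≤4m : K ≤ 4 * m
      K≤4m = +-cancelˡ-≤ (3 * K) _ _ (begin
        3 * K + K                 ≡⟨ +-comm (3 * K) K ⟩
        4 * K                     ≤⟨ *-monoʳ-≤ 4 h ⟩
        4 * (x + y + z + m)       ≡⟨ *-distribˡ-+ 4 (x + y + z) m ⟩
        4 * (x + y + z) + 4 * m   ≤⟨ +-monoˡ-≤ (4 * m) tight ⟩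
        3 * K + 4 * m             ∎)
        where open ≤-Reasoning
      K≤4x = ≤-trans K≤4m (*-monoʳ-≤ 4 (x⊓y⊓z≤x x y z))
      K≤4y = ≤-trans K≤4m (*-monoʳ-≤ 4 (x⊓y⊓z≤y x y z))
      K≤4z = ≤-trans K≤4m (*-monoʳ-≤ 4 (m⊓n≤n (x ⊓ y) z))
      2K≤ : ∀ u v → K ≤ 4 * u → K ≤ 4 * v → 2 * K ≤ 4 * u + 4 * v
      2K≤ u v p q = ≤-trans (≤-reflexive (cong (K +_) (+-identityʳ K))) (+-mono-≤ p q)

    -- The four triples of a matching together weigh at most `3 * K`, while each satisfying triple
    -- weighs at least `3K / 4`; so all four are tight.
    full-matching⇒quarters : ∀ p q r → ∑ F4 p ≤ K → ∑ F4 q ≤ K → ∑ F4 r ≤ K →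
      ∀ k l → 3 < matching-count p q r k l →
      (∀ a → 4 * p a ≤ K) × (∀ a → 4 * q a ≤ K) × (∀ a → 4 * r a ≤ K)
    full-matching⇒quarters p q r ∑p ∑q ∑r k l full =
        (λ a → let u , _ , _ = quarter a in u)
      , (λ b → subst (λ b → 4 * q b ≤ K) (shift-unshift k b) (let _ , u , _ = quarter (unshift k b) in u))
      , (λ c → subst (λ c → 4 * r c ≤ K) (shift-unshift l c) (let _ , _ , u = quarter (unshift l c) in u))
      where
      good : ∀ a → K ≤ p a + q (shift k a) + r (shift l a) + (p a ⊓ q (shift k a) ⊓ r (shift l a))
      good a = triple⇒≤ K (p a) (q (shift k a)) (r (shift l a)) (∑F4-all _ (λ a → triple≤1 K (p a) (q (shift k a)) (r (shift l a))) full a)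
      total : Fin 4 → ℕ
      total a = p a + q (shift k a) + r (shift l a)
      ∑total : ∑ F4 (λ a → 4 * total a) ≤ 4 * (3 * K)
      ∑total = begin
        ∑ F4 (λ a → 4 * total a)
          ≡⟨ ∑-*ˡ F4 4 total ⟩
        4 * ∑ F4 total
          ≡⟨ cong (4 *_) (trans (∑-+ F4 (λ a → p a + q (shift k a)) _) (cong₂ _+_ (∑-+ F4 p _) refl)) ⟩
        4 * (∑ F4 p + ∑ F4 (λ a → q (shift k a)) + ∑ F4 (λ a → r (shift l a)))
          ≡⟨ cong₂ (λ u v → 4 * (∑ F4 p + u + v)) (∑-shift k q) (∑-shift l r) ⟩
        4 * (∑ F4 p + ∑ F4 q + ∑ F4 r)
          ≤⟨ *-monoʳ-≤ 4 (+-mono-≤ (+-mono-≤ ∑p ∑q) ∑r) ⟩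
        4 * (K + K + K)
          ≡⟨ lemma K ⟩
        4 * (3 * K) ∎
        where
        open ≤-Reasoning
        lemma : ∀ K → 4 * (K + K + K) ≡ 4 * (3 * K)
        lemma = solve-∀
      quarter : ∀ a → 4 * p a ≤ K × 4 * q (shift k a) ≤ K × 4 * r (shift l a) ≤ K
      quarter a = quarters (p a) (q (shift k a)) (r (shift l a)) (good a)
        (∑F4-tight (3 * K) (λ a → 4 * total a) (λ a → good⇒3K≤ (p a) (q (shift k a)) (r (shift l a)) (good a)) ∑total a)

    pairs-quarters : ∀ p q → (∀ a → extend p a < K) → (∀ a → extend q a < K) →
      (∀ a → 4 * p a ≤ K) → (∀ a → 4 * q a ≤ K) → pairs K p q ≤ 0
    pairs-quarters p q p< q< p≤ q≤ = ≤-trans (≤-reflexive (pairs-light p q p< q<))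
      (∑F4-≤const 0 λ b → ∑F4-≤const 0 λ c → ≤-reflexive (light (*-cancelˡ-< 4 _ _ (begin-strict
        4 * (p b + q c)     ≡⟨ *-distribˡ-+ 4 (p b) (q c) ⟩
        4 * p b + 4 * q c   ≤⟨ +-mono-≤ (p≤ b) (q≤ c) ⟩
        K + K               ≡⟨ cong (K +_) (+-identityʳ K) ⟨
        2 * K               <⟨ *-monoˡ-< K {2} {4} (s≤s (s≤s (s≤s z≤n))) ⟩
        4 * K               ∎))))
      where open ≤-Reasoning

    opaque
      matchings≤3? : ∀ p q r →
        (∀ k l → matching-count p q r k l ≤ 3) ⊎ (∃₂ λ k l → 3 < matching-count p q r k l)
      matchings≤3? p q r = search (λ k l → matching-count p q r k l)
        where
        search : ∀ (f : Fin 4 → Fin 4 → ℕ) → (∀ k l → f k l ≤ 3) ⊎ (∃₂ λ k l → 3 < f k l)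
        search f with any? (λ k → any? λ l → 3 <? f k l)
        ... | yes (k , l , 3<) = inj₂ (k , l , 3<)
        ... | no  none         = inj₁ λ k l → ≮⇒≥ λ 3< → none (k , l , 3<)

    triples-sparse≤127 : ∀ p q r → inner p q r ≤ 48 →
      pairs K p q ≤ 8 → pairs K p r ≤ 8 → pairs K q r ≤ 8 → triples K p q r ≤ 127
    triples-sparse≤127 p q r i pq pr qr = ≤-trans (triples-split p q r 8 pq pr qr)
      (≤-trans (+-monoˡ-≤ 24 (+-monoˡ-≤ 24 (+-monoˡ-≤ 24 i))) (m≤m+n 120 7))

    triples-quarters≤127 : ∀ p q r →
      pairs K p q ≤ 0 → pairs K p r ≤ 0 → pairs K q r ≤ 0 → triples K p q r ≤ 127
    triples-quarters≤127 p q r pq pr qr = ≤-trans (triples-split p q r 0 pq pr qr)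
      (≤-trans (+-monoˡ-≤ 0 (+-monoˡ-≤ 0 (+-monoˡ-≤ 0 inner≤64))) (m≤m+n 64 63))
      where
      inner≤64 : inner p q r ≤ 64
      inner≤64 = ∑F4-≤const 16 λ a → ∑F4-≤const 4 λ b → ∑F4-≤const 1 λ c → triple≤1 K (p a) (q b) (r c)

    -- If no matching is full, the 16 matchings give at most 48 triples inside the tiles, and the
    -- weightless vertices add at most 3 * 3 * 8 = 72, which makes 120. A full matching forces all
    -- weights down to `K / 4`; then no pair counts and at most the 64 inner triples remain.
    triples-light≤127 : ∀ p q r → ∑ F4 p ≤ K → ∑ F4 q ≤ K → ∑ F4 r ≤ K →
      (∀ a → extend p a < K) → (∀ a → extend q a < K) → (∀ a → extend r a < K) → triples K p q r ≤ 127
    triples-light≤127 p q r ∑p ∑q ∑r lp lq lr with matchings≤3? p q r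
    ... | inj₁ all≤3 = triples-sparse≤127 p q r
            (≤-trans (≤-reflexive (inner-matchings p q r))
              (∑F4-≤const 12 λ k → ∑F4-≤const 3 λ l → all≤3 k l))
            (pairs-light≤8 p q ∑p ∑q lp lq) (pairs-light≤8 p r ∑p ∑r lp lr) (pairs-light≤8 q r ∑q ∑r lq lr)
    ... | inj₂ (k , l , full) =
            let p≤ , q≤ , r≤ = full-matching⇒quarters p q r ∑p ∑q ∑r k l full
            in triples-quarters≤127 p q r (pairs-quarters p q lp lq p≤ q≤)
                 (pairs-quarters p r lp lr p≤ r≤) (pairs-quarters q r lq lr q≤ r≤)

    triples≤127 : ∀ p q r → ∑ F4 p ≤ K → ∑ F4 q ≤ K → ∑ F4 r ≤ K → triples K p q r ≤ 127
    triples≤127 p q r ∑p ∑q ∑r with heavy? p | heavy? q | heavy? r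
    ... | inj₁ hp | _       | _       = triples-heavyˡ p q r ∑p ∑q ∑r hp
    ... | inj₂ _  | inj₁ hq | _       = subst (_≤ 127) (triples-swap q p r) (triples-heavyˡ q p r ∑q ∑p ∑r hq)
    ... | inj₂ _  | inj₂ _  | inj₁ hr = subst (_≤ 127) (sym (triples-rotate p q r)) (triples-heavyˡ r p q ∑r ∑p ∑q hr)
    ... | inj₂ lp | inj₂ lq | inj₂ lr = triples-light≤127 p q r ∑p ∑q ∑r lp lq lr

-- A dense ternary relation contains a large complete tripartite box.

module Box where

  open Prelude
  open import Data.List.Relation.Binary.Permutation.Propositional.Properties using (shift; ↭-length)
  open import Data.Nat.DivMod using (_/_; _%_; m/n*n≤m; m*n/n≡m; /-monoˡ-≤; m≡m%n+[m/n]*n; m%n<n)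
  open import Data.Unit using (tt)
  open Sums

  ∏ : ∀ {a} {A : Set a} → List A → (A → ℕ) → ℕ
  ∏ []       f = 1
  ∏ (x ∷ xs) f = f x * ∏ xs f

  ∏≤1 : ∀ {a} {A : Set a} (xs : List A) {f : A → ℕ} → (∀ x → f x ≤ 1) → ∏ xs f ≤ 1
  ∏≤1 []       h = ≤-refl
  ∏≤1 (x ∷ xs) h = *-mono-≤ (h x) (∏≤1 xs h)

  *-positiveˡ : ∀ m {n} → 0 < m * n → 0 < m
  *-positiveˡ (suc m) _ = s≤s z≤n

  *-positiveʳ : ∀ m {n} → 0 < m * n → 0 < n
  *-positiveʳ m {n} p = *-positiveˡ n (subst (0 <_) (*-comm m n) p)

  ∏-positive : ∀ {a} {A : Set a} {xs : List A} (f : A → ℕ) → 0 < ∏ xs f → ∀ {x} → x ∈ xs → 0 < f x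
  ∏-positive f p (here refl) = *-positiveˡ (f _) p
  ∏-positive {xs = y ∷ ys} f p (there i) = ∏-positive f (*-positiveʳ (f y) p) i

  -- A sublist up to order; the permutation transports distinctness of the entries of `is` to
  -- `chosen`.
  record Selection {a} {I : Set a} (is : List I) (b : ℕ) : Set a where
    field
      chosen rest : List I
      selects     : is ↭ chosen ++ rest
      enough      : length chosen ≡ b

  open Selection public

  -- The neighbours are chosen greedily; each choice keeps a 1 / D fraction of the weight.
  common-neighbours : ∀ {i x} {I : Set i} {X : Set x} b (is : List I) (xs : List X) (R : I → X → ℕ) →
    (∀ i x → R i x ≤ 1) → ∀ (w : X → ℕ) d D → 0 < ∑ xs w →
    (∀ x → 0 < w x → d + b ≤ ∑ is (λ i → R i x)) → length is ≤ d * D →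
    ∃ λ (S : Selection is b) → ∑ xs w ≤ D ^ b * ∑ xs (λ x → w x * ∏ (chosen S) (λ i → R i x))
  common-neighbours zero is xs R R≤1 w d D 0<W deg L≤ =
    record { chosen = [] ; rest = is ; selects = ↭-refl ; enough = refl }
    , ≤-reflexive (sym (trans (+-identityʳ _) (∑-cong xs λ x → *-identityʳ (w x))))
  common-neighbours (suc b) is xs R R≤1 w d D 0<W deg L≤ =
    let i , i∈ , W≤           = pigeonhole is (λ i → D * W′ i) W 0<L average
        as , bs , is≡         = ∈-∃++ i∈
        is′                   = as ++ bs
        is↭                   : is ↭ i ∷ is′
        is↭                   = subst (_↭ i ∷ is′) (sym is≡) (shift i as bs)
        S , bound             = common-neighbours b is′ xs R R≤1 (λ x → w x * R i x) d D
          (*-positiveʳ D (≤-trans 0<W W≤))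
          -- Removing `i` costs a point `x` at most one neighbour, and the surplus in the degree
          -- bound `d + suc b` pays for it.
          (λ x p → +-cancelˡ-≤ 1 _ _ (begin
            1 + (d + b)                     ≡⟨ +-suc d b ⟨
            d + suc b                       ≤⟨ deg x (*-positiveˡ (w x) p) ⟩
            ∑ is (λ i → R i x)              ≡⟨ ∑-↭ _ is↭ ⟩
            R i x + ∑ is′ (λ i → R i x)     ≤⟨ +-monoˡ-≤ _ (R≤1 i x) ⟩
            1 + ∑ is′ (λ i → R i x)         ∎))
          (≤-trans (n≤1+n _) (≤-trans (≤-reflexive (sym (↭-length is↭))) L≤))
    in record { chosen = i ∷ chosen S ; rest = rest S
              ; selects = ↭-trans is↭ (prep i (selects S)) ; enough = cong suc (enough S) }
     , (begin
        W                ≤⟨ W≤ ⟩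
        D * W′ i         ≤⟨ *-monoʳ-≤ D bound ⟩
        D * (D ^ b * ∑ xs (λ x → w x * R i x * ∏ (chosen S) (λ i → R i x)))
                         ≡⟨ *-assoc D (D ^ b) _ ⟨
        D ^ suc b * ∑ xs (λ x → w x * R i x * ∏ (chosen S) (λ i → R i x))
                         ≡⟨ cong (D ^ suc b *_) (∑-cong xs λ x → *-assoc (w x) (R i x) _) ⟩
        D ^ suc b * ∑ xs (λ x → w x * (R i x * ∏ (chosen S) (λ i → R i x))) ∎)
    where
    open ≤-Reasoning
    W : ℕ
    W = ∑ xs w
    W′ : _ → ℕ
    W′ i = ∑ xs (λ x → w x * R i x)
    0<L : 0 < length is
    0<L = let x , _ , 0<wx = ∑-positive xs w 0<W in
      ≤-trans (≤-trans (≤-trans (m≤n+m 1 (d + b)) (≤-reflexive (trans (+-comm (d + b) 1) (sym (+-suc d b)))))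
        (≤-trans (deg x 0<wx) (∑-≤const is 1 λ i → R≤1 i x)))
        (≤-reflexive (*-identityʳ (length is)))
    weighted : ∀ x → w x * d ≤ w x * ∑ is (λ i → R i x)
    weighted x with w x in eq
    ... | zero  = z≤n
    ... | suc m = *-monoʳ-≤ (suc m) (≤-trans (m≤m+n d (suc b)) (deg x (subst (0 <_) (sym eq) (s≤s z≤n))))
    average : length is * W ≤ ∑ is (λ i → D * W′ i)
    average = begin
      length is * W                                     ≤⟨ *-monoˡ-≤ W L≤ ⟩
      d * D * W                                         ≡⟨ rearrange d D W ⟩
      D * (W * d)                                       ≡⟨ cong (D *_) (∑-*ʳ xs d w) ⟨
      D * ∑ xs (λ x → w x * d)                          ≤⟨ *-monoʳ-≤ D (∑-mono xs weighted) ⟩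
      D * ∑ xs (λ x → w x * ∑ is (λ i → R i x))         ≡⟨ cong (D *_) (∑-cong xs λ x → ∑-*ˡ is (w x) _) ⟨
      D * ∑ xs (λ x → ∑ is (λ i → w x * R i x))         ≡⟨ cong (D *_) (∑-swap xs is _) ⟩
      D * ∑ is W′                                       ≡⟨ ∑-*ˡ is D W′ ⟨
      ∑ is (λ i → D * W′ i)                             ∎
      where
      rearrange : ∀ d D W → d * D * W ≡ D * (W * d)
      rearrange = solve-∀

  opaque
    -- With `L` indices and density `1 / D`, the degree aimed for is `d = L / (4 * D)`, rounded
    -- down. The threshold makes `d ≥ 1 + b`; then `L ≤ d * (8 * D)`, so each of the `b` choices
    -- costs a factor `8 * D`, after a first factor `2 * D` for discarding points of low degree.
    threshold loss : ℕ → ℕ → ℕ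
    threshold b D = 4 * D * suc b
    loss      b D = 2 * D * (8 * D) ^ b

    threshold≡ : ∀ b D → threshold b D ≡ 4 * D * suc b
    threshold≡ b D = refl

    loss≡ : ∀ b D → loss b D ≡ 2 * D * (8 * D) ^ b
    loss≡ b D = refl

  loss-positive : ∀ b D → 0 < D → 0 < loss b D
  loss-positive b D 0<D = subst (0 <_) (sym (loss≡ b D))
    (>-nonZero⁻¹ _ {{m*n≢0 (2 * D) ((8 * D) ^ b) {{m*n≢0 2 D}} {{m^n≢0 (8 * D) b {{m*n≢0 8 D}}}}}})
    where
    instance
      D≢0 : NonZero D
      D≢0 = >-nonZero 0<D

  -- Points of degree below `d + b` account for at most half of the guaranteed incidences, so at
  -- least a `1 / (2 * D)` fraction of the points survives, and the greedy choice is applied to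
  -- those.
  dense-selection : ∀ b D → 0 < D → ∀ {I X : Set} (is : List I) (xs : List X) (R : I → X → ℕ) →
    (∀ i x → R i x ≤ 1) →
    threshold b D ≤ length is → 0 < length xs → length is * length xs ≤ D * ∑ xs (λ x → ∑ is (λ i → R i x)) →
    ∃ λ (S : Selection is b) → length xs ≤ loss b D * ∑ xs (λ x → ∏ (chosen S) (λ i → R i x))
  dense-selection b D 0<D {I} {X} is xs R R≤1 N≤L 0<X density =
    let S , bound = dense (subst (_≤ length is) (threshold≡ b D) N≤L)
    in S , subst (λ c → length xs ≤ c * ∑ xs (λ x → ∏ (chosen S) (λ i → R i x))) (sym (loss≡ b D)) bound
    where
    instance
      D≢0 : NonZero D
      D≢0 = >-nonZero 0<D
      4D≢0 : NonZero (4 * D)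
      4D≢0 = m*n≢0 4 D
    dense : 4 * D * suc b ≤ length is →
      ∃ λ (S : Selection is b) → length xs ≤ 2 * D * (8 * D) ^ b * ∑ xs (λ x → ∏ (chosen S) (λ i → R i x))
    dense N≤L =
      let S , bound = common-neighbours b is xs R R≤1 w d (8 * D) 0<W
                        (λ x → indicator⇒ (d + b ≤? deg x)) L≤
      in S , (begin
        n                                          ≤⟨ n≤ ⟩
        2 * D * W                                  ≤⟨ *-monoʳ-≤ (2 * D) (≤-trans bound (*-monoʳ-≤ ((8 * D) ^ b)
                                                        (∑-mono xs λ x → ≤-trans (*-monoˡ-≤ _ (⟦⟧≤1 (does (d + b ≤? deg x))))
                                                          (≤-reflexive (*-identityˡ _))))) ⟩
        2 * D * ((8 * D) ^ b * ∑ xs (λ x → ∏ (chosen S) (λ i → R i x)))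
                                                   ≡⟨ *-assoc (2 * D) ((8 * D) ^ b) _ ⟨
        2 * D * (8 * D) ^ b * ∑ xs (λ x → ∏ (chosen S) (λ i → R i x)) ∎)
      where
      open ≤-Reasoning
      L = length is
      n = length xs
      d = L / (4 * D)
      deg : _ → ℕ
      deg x = ∑ is (λ i → R i x)
      w : _ → ℕ
      w x = ⟦ does (d + b ≤? deg x) ⟧
      W = ∑ xs w
      1+b≤d : suc b ≤ d
      1+b≤d = ≤-trans (≤-reflexive (sym (m*n/n≡m (suc b) (4 * D))))
        (/-monoˡ-≤ (4 * D) (≤-trans (≤-reflexive (*-comm (suc b) (4 * D))) N≤L))
      4Dd≤L : 4 * D * d ≤ L
      4Dd≤L = ≤-trans (≤-reflexive (*-comm (4 * D) d)) (m/n*n≤m L (4 * D))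
      L≤ : L ≤ d * (8 * D)
      L≤ = begin
        L                           ≡⟨ m≡m%n+[m/n]*n L (4 * D) ⟩
        L % (4 * D) + d * (4 * D)   ≤⟨ +-monoˡ-≤ _ (<⇒≤ (m%n<n L (4 * D))) ⟩
        4 * D + d * (4 * D)         ≤⟨ +-monoˡ-≤ _ (≤-trans (≤-reflexive (sym (*-identityˡ (4 * D))))
                                         (*-monoˡ-≤ (4 * D) (≤-trans (s≤s z≤n) 1+b≤d))) ⟩
        d * (4 * D) + d * (4 * D)   ≡⟨ double d D ⟩
        d * (8 * D)                 ∎
        where
        double : ∀ d D → d * (4 * D) + d * (4 * D) ≡ d * (8 * D)
        double = solve-∀
      deg≤L : ∀ x → deg x ≤ L
      deg≤L x = ≤-trans (∑-≤const is 1 λ i → R≤1 i x) (≤-reflexive (*-identityʳ L))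
      truncate : ∀ {m c} (P? : Dec (c ≤ m)) → m ≤ L → m ≤ c + L * ⟦ does P? ⟧
      truncate {m} {c} (yes _) m≤L = ≤-trans m≤L (≤-trans (≤-reflexive (sym (*-identityʳ L))) (m≤n+m _ c))
      truncate {m} {c} (no ≰)  m≤L = ≤-trans (<⇒≤ (≰⇒> ≰)) (m≤m+n c _)
      n≤ : n ≤ 2 * D * W
      n≤ = *-cancelˡ-≤ L {{>-nonZero (≤-trans (≤-trans 0<D (≤-trans (m≤n*m D 4) (m≤m*n (4 * D) (suc b)))) N≤L)}}
        (+-cancelˡ-≤ (L * n) _ _ (begin
          L * n + L * n                              ≡⟨ cong (L * n +_) (+-identityʳ (L * n)) ⟨
          2 * (L * n)                                ≤⟨ *-monoʳ-≤ 2 density ⟩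
          2 * (D * ∑ xs deg)                         ≤⟨ *-monoʳ-≤ 2 (*-monoʳ-≤ D (∑-mono xs λ x → truncate (d + b ≤? deg x) (deg≤L x))) ⟩
          2 * (D * ∑ xs (λ x → (d + b) + L * w x))   ≡⟨ cong (λ u → 2 * (D * u)) (trans (∑-+ xs (λ _ → d + b) (λ x → L * w x))
                                                          (cong₂ _+_ (∑-const xs (d + b)) (∑-*ˡ xs L w))) ⟩
          2 * (D * (n * (d + b) + L * W))            ≡⟨ expand D n (d + b) L W ⟩
          2 * D * (d + b) * n + L * (2 * D * W)      ≤⟨ +-monoˡ-≤ _ (*-monoˡ-≤ n (begin
            2 * D * (d + b)                            ≤⟨ *-monoʳ-≤ (2 * D) (+-monoʳ-≤ d (≤-trans (n≤1+n b) 1+b≤d)) ⟩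
            2 * D * (d + d)                            ≡⟨ double D d ⟩
            4 * D * d                                  ≤⟨ 4Dd≤L ⟩
            L                                          ∎)) ⟩
          L * n + L * (2 * D * W)                    ∎))
        where
        expand : ∀ D n c L W → 2 * (D * (n * c + L * W)) ≡ 2 * D * c * n + L * (2 * D * W)
        expand = solve-∀
        double : ∀ D d → 2 * D * (d + d) ≡ 4 * D * d
        double = solve-∀
      0<W : 0 < W
      0<W = *-positiveʳ (2 * D) (≤-trans 0<X n≤)

  length-cartesianProduct : ∀ {a b} {A : Set a} {B : Set b} (xs : List A) (ys : List B) →
    length (cartesianProduct xs ys) ≡ length xs * length ys
  length-cartesianProduct []       ys = refl
  length-cartesianProduct (x ∷ xs) ys = trans (length-++ (map (x ,_) ys))
    (cong₂ _+_ (length-map (x ,_) ys) (length-cartesianProduct xs ys))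

  ∑-cartesianProduct : ∀ {a b} {A : Set a} {B : Set b} (xs : List A) (ys : List B) (f : A → B → ℕ) →
    ∑ (cartesianProduct xs ys) (λ (x , y) → f x y) ≡ ∑ xs (λ x → ∑ ys (f x))
  ∑-cartesianProduct []       ys f = refl
  ∑-cartesianProduct (x ∷ xs) ys f = trans (∑-++ (map (x ,_) ys) _ _)
    (cong₂ _+_ (∑-map (x ,_) ys _) (∑-cartesianProduct xs ys f))

  boxThreshold : ℕ → ℕ → ℕ
  boxThreshold b D =
    threshold b D + threshold b (loss b D) + threshold b (loss b (loss b D))

  -- Three selections in turn: indices `i` with many common neighbours `(j , k)`, then indices `j`
  -- that keep many of the `k`, and last the `k` themselves, selected against a one-point list. A
  -- product of 0/1 values expresses adjacency to all chosen indices.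
  box : ∀ b D → 0 < D → ∀ {I : Set} (is : List I) (R : I → I → I → ℕ) → (∀ i j k → R i j k ≤ 1) →
    boxThreshold b D ≤ length is → 0 < length is →
    length is * (length is * length is) ≤ D * ∑ is (λ i → ∑ is λ j → ∑ is λ k → R i j k) →
    ∃ λ (S : Selection is b) → ∃ λ (T : Selection is b) → ∃ λ (U : Selection is b) →
      ∀ {i j k} → i ∈ chosen S → j ∈ chosen T → k ∈ chosen U → 0 < R i j k
  box b D 0<D {I} is R R≤1 N≤L 0<L density = choose₁ (dense-selection b D 0<D is (cartesianProduct is is)
    (λ i (j , k) → R i j k) (λ i (j , k) → R≤1 i j k)
    (≤-trans (≤-trans (m≤m+n N₁ N₂) (m≤m+n _ N₃)) N≤L)
    (≤-trans (*-mono-≤ 0<L 0<L) (≤-reflexive (sym (length-cartesianProduct is is))))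
    (begin
      length is * length (cartesianProduct is is)   ≡⟨ cong (length is *_) (length-cartesianProduct is is) ⟩
      length is * (length is * length is)           ≤⟨ density ⟩
      D * ∑ is (λ i → ∑ is λ j → ∑ is λ k → R i j k)
        ≡⟨ cong (D *_) (∑-cong is λ i → ∑-cartesianProduct is is (R i)) ⟨
      D * ∑ is (λ i → ∑ (cartesianProduct is is) λ (j , k) → R i j k)
        ≡⟨ cong (D *_) (∑-swap is (cartesianProduct is is) (λ i (j , k) → R i j k)) ⟩
      D * ∑ (cartesianProduct is is) (λ (j , k) → ∑ is λ i → R i j k) ∎))
    where
    open ≤-Reasoning
    D₁ = loss b D
    D₂ = loss b D₁
    D₃ = loss b D₂
    N₁ = threshold b D
    N₂ = threshold b D₁
    N₃ = threshold b D₂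
    0<D₁ : 0 < D₁
    0<D₁ = loss-positive b D 0<D
    0<D₂ : 0 < D₂
    0<D₂ = loss-positive b D₁ 0<D₁

    R₂ : Selection is b → I → I → ℕ
    R₂ S j k = ∏ (chosen S) λ i → R i j k
    R₃ : Selection is b → Selection is b → I → ℕ
    R₃ S T k = ∏ (chosen T) λ j → R₂ S j k

    Result : Set
    Result = ∃ λ (S : Selection is b) → ∃ λ (T : Selection is b) → ∃ λ (U : Selection is b) →
      ∀ {i j k} → i ∈ chosen S → j ∈ chosen T → k ∈ chosen U → 0 < R i j k

    choose₃ : ∀ S T →
      (∃ λ (U : Selection is b) → 1 ≤ D₃ * ∑ (tt ∷ []) (λ _ → ∏ (chosen U) (R₃ S T))) → Result
    choose₃ S T (U , bound₃) = S , T , U , λ {i} {j} {k} i∈ j∈ k∈ →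
      ∏-positive (λ i → R i j k) (∏-positive (λ j → R₂ S j k) (∏-positive (R₃ S T)
        (subst (0 <_) (+-identityʳ _) (*-positiveʳ D₃ bound₃)) k∈) j∈) i∈

    choose₂ : ∀ S → (∃ λ (T : Selection is b) → length is ≤ D₂ * ∑ is (R₃ S T)) → Result
    choose₂ S (T , bound₂) = choose₃ S T (dense-selection b D₂ 0<D₂ is (tt ∷ []) (λ k _ → R₃ S T k)
      (λ k _ → ∏≤1 (chosen T) λ j → ∏≤1 (chosen S) λ i → R≤1 i j k)
      (≤-trans (m≤n+m N₃ (N₁ + N₂)) N≤L) (s≤s z≤n)
      (begin
        length is * 1                ≡⟨ *-identityʳ (length is) ⟩
        length is                    ≤⟨ bound₂ ⟩
        D₂ * ∑ is (R₃ S T)           ≡⟨ cong (D₂ *_) (+-identityʳ _) ⟨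
        D₂ * (∑ is (R₃ S T) + 0)     ∎))

    choose₁ : (∃ λ (S : Selection is b) → length (cartesianProduct is is) ≤
      D₁ * ∑ (cartesianProduct is is) (λ (j , k) → R₂ S j k)) → Result
    choose₁ (S , bound₁) = choose₂ S (dense-selection b D₁ 0<D₁ is is (R₂ S)
      (λ j k → ∏≤1 (chosen S) λ i → R≤1 i j k)
      (≤-trans (≤-trans (m≤n+m N₂ N₁) (m≤m+n _ N₃)) N≤L) 0<L
      (begin
        length is * length is                                         ≡⟨ length-cartesianProduct is is ⟨
        length (cartesianProduct is is)                               ≤⟨ bound₁ ⟩
        D₁ * ∑ (cartesianProduct is is) (λ (j , k) → R₂ S j k)        ≡⟨ cong (D₁ *_) (∑-cartesianProduct is is (R₂ S)) ⟩
        D₁ * ∑ is (λ j → ∑ is λ k → R₂ S j k)                         ≡⟨ cong (D₁ *_) (∑-swap is is (R₂ S)) ⟩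
        D₁ * ∑ is (λ k → ∑ is λ j → R₂ S j k)                         ∎))

-- Integer certificates from the linear program of a pattern.

module Cert where

  open Prelude
  import Data.Bool
  open import Data.Fin using (combine; _↑ˡ_)
  import Data.Fin.Properties as Fin
  open import Data.Integer as ℤ using (ℤ; +_; 0ℤ)
  import Data.Integer.Properties as ℤ
  import Data.Integer.Tactic.RingSolver as ℤ-Solver
  import Data.List
  import Data.List.Properties
  import Data.List.Relation.Unary.All as All
  open import Data.List.Relation.Unary.All.Properties using (++⁺)
  open import Data.Product.Properties using (≡-dec)
  open import Data.Unit using (tt)
  open import Data.Vec as Vec using (lookup; tabulate)
  import Data.Vec.Properties as Vec
  open import Data.Vec.Membership.Propositional.Properties using (∈-lookup)
  import Data.Vec.Relation.Unary.All as VecAll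
  open import Relation.Nullary using (toWitness)
  open Sums
  open Farkas using (Row; Cone; generator; add; dot; eval; farkas; Feasible; Refuted)
  open Count

  Pattern : Set
  Pattern = Vec (Vec (Vec Bool 7) 7) 7

  entry : Pattern → Fin 7 → Fin 7 → Fin 7 → Bool
  entry P a b c = lookup (lookup (lookup P a) b) c

  size : Pattern → ℕ
  size P = ∑ F7 λ a → ∑ F7 λ b → ∑ F7 λ c → ⟦ entry P a b c ⟧

  -- A vertex (g , a) of the pattern is vertex a of its group g.
  Key : Set
  Key = Fin 3 × Fin 7

  _≟ᴷ_ : DecidableEquality Key
  _≟ᴷ_ = ≡-dec Fin._≟_ Fin._≟_

  -- A copy of Y in a blow-up of a pattern: an edge of the pattern, and the
  -- group in which two copies of its vertex are used.
  YType : Set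
  YType = (Fin 7 × Fin 7 × Fin 7) × Fin 3

  -- The vertices of the copy, the two clones last.
  demand : YType → List Key
  demand ((a , b , c) , 0F) = (1F , b) ∷ (2F , c) ∷ (0F , a) ∷ (0F , a) ∷ []
  demand ((a , b , c) , 1F) = (0F , a) ∷ (2F , c) ∷ (1F , b) ∷ (1F , b) ∷ []
  demand ((a , b , c) , 2F) = (0F , a) ∷ (1F , b) ∷ (2F , c) ∷ (2F , c) ∷ []

  demands : List YType → List Key
  demands = concatMap demand

  _fits_ : YType → Pattern → Set
  ((a , b , c) , _) fits P = entry P a b c ≡ true

  occurrences : ∀ {a} {A : Set a} → DecidableEquality A → A → List A → ℕ
  occurrences _≟_ x ys = ∑ ys λ y → ⟦ does (x ≟ y) ⟧

  -- In the blow-up of P, the copies listed in types can replace the tiles of the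
  -- groups listed in caps.
  record Certificate (P : Pattern) : Set where
    field
      types : List YType
      caps  : List (Fin 3)
      fit   : All (_fits P) types
      loads : ∀ g (a : Fin 4) → occurrences _≟ᴷ_ (g , a ↑ˡ 3) (demands types) ≤ occurrences Fin._≟_ g caps
      gain  : length caps < length types

  open Certificate public

  -- The linear program has one variable for each of the 4 tile vertices of the 3 groups.
  slot : Fin 3 → Fin 4 → Fin 12
  slot = combine

  -- The free vertices of a group have no slot: using them destroys no tile, so their dual weight is
  -- 0.
  slots : Key → List (Fin 12)
  slots (g , 0F) = slot g 0F ∷ []
  slots (g , 1F) = slot g 1F ∷ []
  slots (g , 2F) = slot g 2F ∷ []
  slots (g , 3F) = slot g 3F ∷ []
  slots (g , suc (suc (suc (suc _)))) = []

  tile : Fin 3 → List (Fin 12)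
  tile g = slot g 0F ∷ slot g 1F ∷ slot g 2F ∷ slot g 3F ∷ []

  occ : Fin 12 → List (Fin 12) → ℕ
  occ = occurrences Fin._≟_

  row : List (Fin 12) → List (Fin 12) → ℤ → Row 12
  row pos neg κ = tabulate (λ i → + occ i pos ℤ.- + occ i neg) , κ

  data Constraint : Set where
    cap  : Fin 3 → Constraint
    edge : YType → Constraint

  -- A solution is a weighting of the tile vertices with total at most `K` on each tile and at least
  -- `K` on every Y; a refutation combines copies of Y into a packing that beats the tiles it uses.
  rowOf : Constraint → Row 12
  rowOf (cap g)  = row [] (tile g) (+ 1)
  rowOf (edge y) = row (concatMap slots (demand y)) [] (ℤ.- + 1)

  allTypes : List YType
  allTypes = cartesianProduct (cartesianProduct (allFin 7) (cartesianProduct (allFin 7) (allFin 7))) (allFin 3)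

  fits? : ∀ P y → Relation.Nullary.Dec (y fits P)
  fits? P ((a , b , c) , g) = entry P a b c Data.Bool.≟ true

  opaque
    constraints : Pattern → List Constraint
    constraints P = map cap (allFin 3) ++ map edge (filter (fits? P) allTypes)

    cap∈ : ∀ P g → cap g ∈ constraints P
    cap∈ P g = ∈-++⁺ˡ (∈-map⁺ cap (∈-allFin g))

    edge∈ : ∀ P y → y fits P → edge y ∈ constraints P
    edge∈ P y@((a , b , c) , g) f = ∈-++⁺ʳ _ (∈-map⁺ edge (∈-filter⁺ (fits? P)
      (∈-cartesianProduct⁺ (∈-cartesianProduct⁺ (∈-allFin a) (∈-cartesianProduct⁺ (∈-allFin b) (∈-allFin c))) (∈-allFin g)) f))

    edge∈⇒fits : ∀ P {y} → edge y ∈ constraints P → y fits P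
    edge∈⇒fits P i with ∈-++⁻ (map cap (allFin 3)) i
    ... | inj₁ j with ∈-map⁻ cap j
    ...   | _ , _ , ()
    edge∈⇒fits P i | inj₂ j with ∈-map⁻ edge j
    ... | y , y∈ , refl = proj₂ (∈-filter⁻ (fits? P) {xs = allTypes} y∈)

  system : Pattern → List (Row 12)
  system P = map rowOf (constraints P)

  dot-tabulate-+ : ∀ {k} (f g : Fin k → ℤ) z → dot (tabulate (λ i → f i ℤ.+ g i)) z ≡ dot (tabulate f) z ℤ.+ dot (tabulate g) z
  dot-tabulate-+ f g []      = refl
  dot-tabulate-+ f g (x ∷ z) rewrite dot-tabulate-+ (f ∘ suc) (g ∘ suc) z = lemma (f zero) (g zero) x _ _
    where
    lemma : ∀ a b x u v → (a ℤ.+ b) ℤ.* x ℤ.+ (u ℤ.+ v) ≡ (a ℤ.* x ℤ.+ u) ℤ.+ (b ℤ.* x ℤ.+ v)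
    lemma = ℤ-Solver.solve-∀

  dot-tabulate-neg : ∀ {k} (f : Fin k → ℤ) z → dot (tabulate (λ i → ℤ.- f i)) z ≡ ℤ.- dot (tabulate f) z
  dot-tabulate-neg f []      = refl
  dot-tabulate-neg f (x ∷ z) rewrite dot-tabulate-neg (f ∘ suc) z = lemma (f zero) x _
    where
    lemma : ∀ a x u → (ℤ.- a) ℤ.* x ℤ.+ ℤ.- u ≡ ℤ.- (a ℤ.* x ℤ.+ u)
    lemma = ℤ-Solver.solve-∀

  dot-zero : ∀ {k} (z : Vec ℤ k) → dot (tabulate (λ _ → 0ℤ)) z ≡ 0ℤ
  dot-zero []      = refl
  dot-zero (x ∷ z) = trans (ℤ.+-identityˡ _) (dot-zero z)

  dot-unit : ∀ {k} j (z : Vec ℤ k) → dot (tabulate (λ i → + ⟦ does (i Fin.≟ j) ⟧)) z ≡ lookup z j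
  dot-unit zero    (x ∷ z) rewrite dot-zero z = trans (ℤ.+-identityʳ _) (ℤ.*-identityˡ x)
  dot-unit (suc j) (x ∷ z) = trans (ℤ.+-identityˡ _) (dot-unit j z)

  value : Vec ℤ 12 → List (Fin 12) → ℕ
  value z js = ∑ js λ j → ℤ.∣ lookup z j ∣

  lookup-nonNeg : ∀ {k} {z : Vec ℤ k} → VecAll.All (0ℤ ℤ.≤_) z → ∀ j → + ℤ.∣ lookup z j ∣ ≡ lookup z j
  lookup-nonNeg 0≤z j = ℤ.0≤i⇒+∣i∣≡i (VecAll.lookup 0≤z (∈-lookup j _))

  dot-occ : ∀ z js → VecAll.All (0ℤ ℤ.≤_) z → dot (tabulate (λ i → + occ i js)) z ≡ + value z js
  dot-occ z []       0≤z = dot-zero z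
  dot-occ z (j ∷ js) 0≤z = begin
    dot (tabulate (λ i → + (⟦ does (i Fin.≟ j) ⟧ + occ i js))) z
      ≡⟨ dot-tabulate-+ (λ i → + ⟦ does (i Fin.≟ j) ⟧) (λ i → + occ i js) z ⟩
    dot (tabulate (λ i → + ⟦ does (i Fin.≟ j) ⟧)) z ℤ.+ dot (tabulate (λ i → + occ i js)) z
      ≡⟨ cong₂ ℤ._+_ (trans (dot-unit j z) (sym (lookup-nonNeg 0≤z j))) (dot-occ z js 0≤z) ⟩
    + value z (j ∷ js) ∎
    where open ≡-Reasoning

  eval-row : ∀ pos neg κ z K → VecAll.All (0ℤ ℤ.≤_) z →
    eval (row pos neg κ) z K ≡ (+ value z pos ℤ.- + value z neg) ℤ.+ κ ℤ.* K
  eval-row pos neg κ z K 0≤z = cong (ℤ._+ κ ℤ.* K) (begin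
    dot (tabulate (λ i → + occ i pos ℤ.- + occ i neg)) z
      ≡⟨ dot-tabulate-+ (λ i → + occ i pos) (λ i → ℤ.- + occ i neg) z ⟩
    dot (tabulate (λ i → + occ i pos)) z ℤ.+ dot (tabulate (λ i → ℤ.- + occ i neg)) z
      ≡⟨ cong₂ ℤ._+_ (dot-occ z pos 0≤z) (trans (dot-tabulate-neg (λ i → + occ i neg) z) (cong ℤ.-_ (dot-occ z neg 0≤z))) ⟩
    + value z pos ℤ.- + value z neg ∎)
    where open ≡-Reasoning

  drop-minus : ∀ {u v} → 0ℤ ℤ.≤ u ℤ.- v → v ℤ.≤ u
  drop-minus {u} {v} p = subst₂ ℤ._≤_ (ℤ.+-identityˡ v) (lemma u v) (ℤ.+-monoˡ-≤ v p)
    where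
    lemma : ∀ u v → u ℤ.- v ℤ.+ v ≡ u
    lemma = ℤ-Solver.solve-∀

  module _ {P : Pattern} (z : Vec ℤ 12) (k : ℕ) (0≤z : VecAll.All (0ℤ ℤ.≤_) z) (0<k : 0 < k)
           (sat : ∀ {r} → r ∈ system P → 0ℤ ℤ.≤ eval r z (+ k)) where

    weight : Fin 3 → Fin 4 → ℕ
    weight g a = ℤ.∣ lookup z (slot g a) ∣

    opaque
      unfolding F4

      weight≤ : ∀ g → ∑ F4 (weight g) ≤ k
      weight≤ g = ℤ.drop‿+≤+ (drop-minus (subst (0ℤ ℤ.≤_)
        (trans (eval-row [] (tile g) (+ 1) z (+ k) 0≤z) (lemma (+ value z (tile g)) (+ k)))
        (sat (∈-map⁺ rowOf (cap∈ P g)))))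
        where
        lemma : ∀ v k → (0ℤ ℤ.- v) ℤ.+ + 1 ℤ.* k ≡ k ℤ.- v
        lemma = ℤ-Solver.solve-∀

    value-slots : ∀ g a → value z (slots (g , a)) ≡ extend (weight g) a
    value-slots g 0F = +-identityʳ _
    value-slots g 1F = +-identityʳ _
    value-slots g 2F = +-identityʳ _
    value-slots g 3F = +-identityʳ _
    value-slots g (suc (suc (suc (suc _)))) = refl

    value-demand : ∀ y → value z (concatMap slots (demand y)) ≡ ∑ (demand y) (λ (g , a) → extend (weight g) a)
    value-demand y = trans (∑-concatMap slots (demand y) _) (∑-cong (demand y) λ (g , a) → value-slots g a)

    k≤demand : ∀ y → y fits P → k ≤ ∑ (demand y) (λ (g , a) → extend (weight g) a)
    k≤demand y f = subst (k ≤_) (value-demand y) (ℤ.drop‿+≤+ (drop-minus (subst (0ℤ ℤ.≤_)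
      (trans (eval-row (concatMap slots (demand y)) [] (ℤ.- + 1) z (+ k) 0≤z) (lemma (+ value z (concatMap slots (demand y))) (+ k)))
      (sat (∈-map⁺ rowOf (edge∈ P y f))))))
      where
      lemma : ∀ v k → (v ℤ.- 0ℤ) ℤ.+ (ℤ.- + 1) ℤ.* k ≡ v ℤ.- k
      lemma = ℤ-Solver.solve-∀

    -- The three Y types of an edge give the three inequalities with one weight doubled, and
    -- addition distributes over the minimum.
    feasible⇒good : ∀ a b c → entry P a b c ≡ true →
      k ≤ extend (weight 0F) a + extend (weight 1F) b + extend (weight 2F) c
        + (extend (weight 0F) a ⊓ extend (weight 1F) b ⊓ extend (weight 2F) c)
    feasible⇒good a b c f = subst (k ≤_) (sym (begin
        s + (x ⊓ y ⊓ w)             ≡⟨ +-distribˡ-⊓ s (x ⊓ y) w ⟩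
        (s + (x ⊓ y)) ⊓ (s + w)     ≡⟨ cong (_⊓ (s + w)) (+-distribˡ-⊓ s x y) ⟩
        (s + x) ⊓ (s + y) ⊓ (s + w) ∎))
      (⊓-glb (⊓-glb (subst (k ≤_) (l₀ x y w) (k≤demand ((a , b , c) , 0F) f))
                    (subst (k ≤_) (l₁ x y w) (k≤demand ((a , b , c) , 1F) f)))
             (subst (k ≤_) (l₂ x y w) (k≤demand ((a , b , c) , 2F) f)))
      where
      open ≡-Reasoning
      open import Data.Nat.Tactic.RingSolver using (solve-∀)
      x = extend (weight 0F) a
      y = extend (weight 1F) b
      w = extend (weight 2F) c
      s = x + y + w
      l₀ : ∀ x y w → y + (w + (x + (x + 0))) ≡ x + y + w + x
      l₀ = solve-∀
      l₁ : ∀ x y w → x + (w + (y + (y + 0))) ≡ x + y + w + y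
      l₁ = solve-∀
      l₂ : ∀ x y w → x + (y + (w + (w + 0))) ≡ x + y + w + w
      l₂ = solve-∀

    opaque
      unfolding triple

      entry≤triple : ∀ a b c → ⟦ entry P a b c ⟧ ≤ triple k (extend (weight 0F) a) (extend (weight 1F) b) (extend (weight 2F) c)
      entry≤triple a b c with entry P a b c in eq
      ... | false = z≤n
      ... | true  = ≤-reflexive (sym (cong ⟦_⟧ (does-yes (k ≤? _) (feasible⇒good a b c eq))))

    feasible⇒size≤127 : size P ≤ 127
    feasible⇒size≤127 = ≤-trans
      (∑-mono F7 λ a → ∑-mono F7 λ b → ∑-mono F7 λ c → entry≤triple a b c)
      (triples≤127 k 0<k (weight 0F) (weight 1F) (weight 2F) (weight≤ 0F) (weight≤ 1F) (weight≤ 2F))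

  -- The derivation of a row, remembered as the Y types and the tiles that it adds up, with
  -- multiplicity.
  record Multiset (P : Pattern) (r : Row 12) : Set where
    field
      ys     : List YType
      cs     : List (Fin 3)
      ysFit  : All (_fits P) ys
      coeffs : ∀ i → lookup (proj₁ r) i ≡ + occ i (concatMap slots (demands ys)) ℤ.- + occ i (concatMap tile cs)
      const  : proj₂ r ≡ + length cs ℤ.- + length ys

  occ-++ : ∀ i xs ys → occ i (xs ++ ys) ≡ occ i xs + occ i ys
  occ-++ i xs ys = ∑-++ xs ys _

  cone⇒multiset : ∀ {P r} → Cone (system P) r → Multiset P r
  cone⇒multiset {P} (generator i) with ∈-map⁻ rowOf i
  ... | cap g , _ , refl = record
    { ys = [] ; cs = g ∷ [] ; ysFit = [] ; coeffs = Vec.lookup∘tabulate (λ i → + occ i [] ℤ.- + occ i (tile g)) ; const = refl }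
  ... | edge y , y∈ , refl = record
    { ys = y ∷ [] ; cs = [] ; ysFit = edge∈⇒fits P y∈ ∷ []
    ; coeffs = λ i → trans (Vec.lookup∘tabulate (λ i → + occ i (concatMap slots (demand y)) ℤ.- + occ i []) i)
        (cong (λ js → + occ i (concatMap slots js) ℤ.- + 0) (sym (Data.List.Properties.++-identityʳ (demand y))))
    ; const = refl }
  cone⇒multiset {P} (add {r} {s} c d) = record
    { ys = M.ys ++ N.ys ; cs = M.cs ++ N.cs ; ysFit = ++⁺ M.ysFit N.ysFit
    ; coeffs = λ i → trans (Vec.lookup-zipWith ℤ._+_ i (proj₁ r) (proj₁ s)) (trans (cong₂ ℤ._+_ (M.coeffs i) (N.coeffs i))
        (trans (merge (occ i (concatMap slots (demands M.ys))) (occ i (concatMap tile M.cs))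
               (occ i (concatMap slots (demands N.ys))) (occ i (concatMap tile N.cs)))
          (cong₂ (λ u v → + u ℤ.- + v)
            (sym (trans (cong (occ i) (trans (cong (concatMap slots) (concatMap-++ demand M.ys N.ys))
                   (concatMap-++ slots (demands M.ys) (demands N.ys))))
              (occ-++ i (concatMap slots (demands M.ys)) _)))
            (sym (trans (cong (occ i) (concatMap-++ tile M.cs N.cs)) (occ-++ i (concatMap tile M.cs) _))))))
    ; const = trans (cong₂ ℤ._+_ M.const N.const) (trans (merge (length M.cs) (length M.ys) (length N.cs) (length N.ys))
        (cong₂ (λ u v → + u ℤ.- + v) (sym (length-++ M.cs)) (sym (length-++ M.ys)))) }
    where
    module M = Multiset (cone⇒multiset c)
    module N = Multiset (cone⇒multiset d)
    lemma : ∀ a b c d → (a ℤ.- b) ℤ.+ (c ℤ.- d) ≡ (a ℤ.+ c) ℤ.- (b ℤ.+ d)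
    lemma = ℤ-Solver.solve-∀
    merge : ∀ a b c d → (+ a ℤ.- + b) ℤ.+ (+ c ℤ.- + d) ≡ + (a + c) ℤ.- + (b + d)
    merge a b c d = lemma (+ a) (+ b) (+ c) (+ d)

  occ-tile≤ : ∀ g a g′ → occ (slot g a) (tile g′) ≤ ⟦ does (g Fin.≟ g′) ⟧
  occ-tile≤ = toWitness {a? = Fin.all? λ g → Fin.all? λ a → Fin.all? λ g′ → occ (slot g a) (tile g′) ≤? ⟦ does (g Fin.≟ g′) ⟧} tt

  key≤slots : ∀ g (a : Fin 4) k → ⟦ does ((g , a ↑ˡ 3) ≟ᴷ k) ⟧ ≤ occ (slot g a) (slots k)
  key≤slots g a k with (g , a ↑ˡ 3) ≟ᴷ k
  ... | no  _    = z≤n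
  ... | yes refl = own a
    where
    self : ∀ (i : Fin 12) → 1 ≤ ⟦ does (i Fin.≟ i) ⟧ + 0
    self i = ≤-reflexive (sym (trans (+-identityʳ _) (cong ⟦_⟧ (does-yes (i Fin.≟ i) refl))))
    own : ∀ a → 1 ≤ occ (slot g a) (slots (g , a ↑ˡ 3))
    own 0F = self (slot g 0F)
    own 1F = self (slot g 1F)
    own 2F = self (slot g 2F)
    own 3F = self (slot g 3F)

  minus≤0 : ∀ {m n} → + m ℤ.- + n ℤ.≤ 0ℤ → m ≤ n
  minus≤0 {m} {n} p = ℤ.drop‿+≤+ (subst₂ ℤ._≤_ (lemma (+ m) (+ n)) (ℤ.+-identityˡ (+ n)) (ℤ.+-monoˡ-≤ (+ n) p))
    where
    lemma : ∀ u v → u ℤ.- v ℤ.+ v ≡ u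
    lemma = ℤ-Solver.solve-∀

  minus<0 : ∀ {m n} → + m ℤ.- + n ℤ.< 0ℤ → m < n
  minus<0 {m} {n} p = ℤ.drop‿+<+ (subst₂ ℤ._<_ (lemma (+ m) (+ n)) (ℤ.+-identityˡ (+ n)) (ℤ.+-monoˡ-< (+ n) p))
    where
    lemma : ∀ u v → u ℤ.- v ℤ.+ v ≡ u
    lemma = ℤ-Solver.solve-∀

  -- Nonpositive coefficients say that no tile vertex is used more often than its tile is given up,
  -- and the negative constant says that more copies are gained than tiles lost.
  refuted⇒certificate : ∀ {P} → Refuted (system P) → Certificate P
  refuted⇒certificate {P} (r , c , coeffs≤0 , const<0) = record
    { types = ys ; caps = cs ; fit = ysFit
    ; loads = λ g a → begin
        occurrences _≟ᴷ_ (g , a ↑ˡ 3) (demands ys)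
          ≤⟨ ∑-mono (demands ys) (key≤slots g a) ⟩
        ∑ (demands ys) (λ k → occ (slot g a) (slots k))
          ≡⟨ ∑-concatMap slots (demands ys) (λ j → ⟦ does (slot g a Fin.≟ j) ⟧) ⟨
        occ (slot g a) (concatMap slots (demands ys))
          ≤⟨ minus≤0 (subst (ℤ._≤ 0ℤ) (coeffs (slot g a)) (VecAll.lookup coeffs≤0 (∈-lookup (slot g a) _))) ⟩
        occ (slot g a) (concatMap tile cs)
          ≡⟨ ∑-concatMap tile cs (λ j → ⟦ does (slot g a Fin.≟ j) ⟧) ⟩
        ∑ cs (λ g′ → occ (slot g a) (tile g′))
          ≤⟨ ∑-mono cs (occ-tile≤ g a) ⟩
        occurrences Fin._≟_ g cs ∎
    ; gain = minus<0 (subst (ℤ._< 0ℤ) const const<0) }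
    where
    open Multiset (cone⇒multiset c)
    open ≤-Reasoning

  opaque
    -- Opaque because only the existence of an outcome matters; the elimination in 12 variables is
    -- not meant to be evaluated.
    certify : ∀ P → size P ≤ 127 ⊎ Certificate P
    certify P = conclude (farkas 12 (system P))
      where
      conclude : Feasible (system P) ⊎ Refuted (system P) → size P ≤ 127 ⊎ Certificate P
      conclude (inj₂ ref) = inj₂ (refuted⇒certificate ref)
      conclude (inj₁ (z , + k , 0≤z , ℤ.+<+ 0<k , sat)) = inj₁ (feasible⇒size≤127 z k 0≤z 0<k sat)

-- Enlarging a tiling by means of a certificate.

module Augment where

  open Prelude
  import Data.Fin.Properties as Fin
  open import Data.List.Membership.DecPropositional using (_∈?_)
  import Data.List.Relation.Unary.All as All
  import Data.List.Relation.Unary.All.Properties as All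
  import Data.List.Relation.Unary.Unique.Propositional.Properties as Unique
  import Data.Nat.Properties as ℕ
  open import Data.Vec as Vec using (toList)
  open import Data.Fin using (_↑ˡ_)
  open import Data.List.Relation.Binary.Permutation.Propositional.Properties using (shift; ↭-length)
  open Sums
  open Cert

  -- The i-th occurrence of k in ks, counted from the end, becomes (k , i).
  module _ {a} {K : Set a} (_≟_ : DecidableEquality K) where

    number : List K → List (K × ℕ)
    number []       = []
    number (k ∷ ks) = (k , occurrences _≟_ k ks) ∷ number ks

    number-< : ∀ {k n} ks → (k , n) ∈ number ks → n < occurrences _≟_ k ks
    number-< (k ∷ ks) (here refl) =
      +-monoˡ-≤ (occurrences _≟_ k ks) (≤-reflexive (cong ⟦_⟧ (sym (does-yes (k ≟ k) refl))))
    number-< {k} (k′ ∷ ks) (there i) = ≤-trans (number-< ks i) (m≤n+m _ ⟦ does (k ≟ k′) ⟧)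

    number-unique : ∀ ks → Unique (number ks)
    number-unique []       = []
    number-unique (k ∷ ks) = All.tabulate (λ i eq → <-irrefl refl
      (number-< ks (subst (_∈ number ks) (sym eq) i))) ∷ number-unique ks

    ∈-number : ∀ {k n} ks → n < occurrences _≟_ k ks → (k , n) ∈ number ks
    ∈-number {k} {n} (k′ ∷ ks) n< with k ≟ k′
    ... | no _ = there (∈-number ks n<)
    ... | yes refl with n ℕ.≟ occurrences _≟_ k ks
    ...   | yes refl = here refl
    ...   | no  n≢   = there (∈-number ks (≤∧≢⇒< (≤-pred n<) n≢))

    occurrences≤length : ∀ k ks → occurrences _≟_ k ks ≤ length ks
    occurrences≤length k ks = ≤-trans (∑-≤const ks 1 λ k′ → ⟦⟧≤1 (does (k ≟ k′))) (≤-reflexive (*-identityʳ _))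

  length-number : ∀ {a} {K : Set a} (_≟_ : DecidableEquality K) ks → length (number _≟_ ks) ≡ length ks
  length-number _≟_ []       = refl
  length-number _≟_ (k ∷ ks) = cong suc (length-number _≟_ ks)

  nth : ∀ {a} {A : Set a} → A → List A → ℕ → A
  nth d []       n       = d
  nth d (x ∷ xs) zero    = x
  nth d (x ∷ xs) (suc n) = nth d xs n

  nth-∈ : ∀ {a} {A : Set a} (d : A) xs {n} → n < length xs → nth d xs n ∈ xs
  nth-∈ d (x ∷ xs) {zero}  _       = here refl
  nth-∈ d (x ∷ xs) {suc n} (s≤s p) = there (nth-∈ d xs p)

  nth-injective : ∀ {a} {A : Set a} (d : A) {xs m n} → Unique xs → m < length xs → n < length xs →
    nth d xs m ≡ nth d xs n → m ≡ n
  nth-injective d {x ∷ xs} {zero}  {zero}  _       _       _       _  = refl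
  nth-injective d {x ∷ xs} {zero}  {suc n} (x∉ ∷ _) _      (s≤s q) eq = ⊥-elim (All.lookup x∉ (nth-∈ d xs q) eq)
  nth-injective d {x ∷ xs} {suc m} {zero}  (x∉ ∷ _) (s≤s p) _      eq = ⊥-elim (All.lookup x∉ (nth-∈ d xs p) (sym eq))
  nth-injective d {x ∷ xs} {suc m} {suc n} (_ ∷ u) (s≤s p) (s≤s q) eq = cong suc (nth-injective d u p q eq)

  unique-map : ∀ {a b} {A : Set a} {B : Set b} (f : A → B) {xs} →
    (∀ {x y} → x ∈ xs → y ∈ xs → f x ≡ f y → x ≡ y) → Unique xs → Unique (map f xs)
  unique-map f inj []       = []
  unique-map f inj (x∉ ∷ u) =
    All.map⁺ (All.tabulate λ i eq → All.lookup x∉ i (inj (here refl) (there i) eq))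
    ∷ unique-map f (λ i j → inj (there i) (there j)) u

  extract : ∀ {a} {A : Set a} {xs ys : List A} → Unique xs → (∀ {x} → x ∈ xs → x ∈ ys) → ∃ λ zs → ys ↭ xs ++ zs
  extract {xs = []} {ys} _ _ = ys , ↭-refl
  extract {xs = x ∷ xs} (x∉ ∷ u) sub with ∈-∃++ (sub (here refl))
  ... | as , bs , refl with extract {ys = as ++ bs} u (λ {y} i → avoid (sub (there i)) λ { refl → All.lookup x∉ i refl })
    where
    avoid : ∀ {y} → y ∈ as ++ x ∷ bs → y ≢ x → y ∈ as ++ bs
    avoid i y≢x with ∈-++⁻ as i
    ... | inj₁ j         = ∈-++⁺ˡ j
    ... | inj₂ (here eq) = ⊥-elim (y≢x eq)
    ... | inj₂ (there j) = ∈-++⁺ʳ as j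
  ... | zs , p = zs , ↭-trans (shift x as bs) (prep x p)

  unique-⊆⇒≤ : ∀ {a} {A : Set a} {xs ys : List A} → Unique xs → (∀ {x} → x ∈ xs → x ∈ ys) → length xs ≤ length ys
  unique-⊆⇒≤ {xs = xs} u sub = let zs , p = extract u sub in
    ≤-trans (m≤m+n (length xs) (length zs)) (≤-reflexive (sym (trans (↭-length p) (length-++ xs))))

  module _ {a} {A : Set a} (_≟_ : DecidableEquality A) where

    without : List A → List A → List A
    without rem = filter (λ x → ¬? (_∈?_ _≟_ x rem))

    length-filter-split : ∀ rem xs →
      length xs ≡ length (without rem xs) + length (filter (λ x → _∈?_ _≟_ x rem) xs)
    length-filter-split rem [] = refl
    length-filter-split rem (x ∷ xs) with _∈?_ _≟_ x rem
    ... | yes _ = trans (cong suc (length-filter-split rem xs)) (sym (+-suc _ _))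
    ... | no  _ = cong suc (length-filter-split rem xs)

    length-without : ∀ rem {xs} → Unique xs → length xs ≤ length (without rem xs) + length rem
    length-without rem {xs} u = ≤-trans (≤-reflexive (length-filter-split rem xs))
      (+-monoʳ-≤ (length (without rem xs)) (unique-⊆⇒≤ (Unique.filter⁺ (λ x → _∈?_ _≟_ x rem) u)
        λ i → proj₂ (∈-filter⁻ (λ x → _∈?_ _≟_ x rem) {xs = xs} i)))

  -- The first two entries of a quadruple lie in both edges of the Y.

  Ternary : Set → Set
  Ternary V = V → V → V → Bool

  IsY : ∀ {V} → Ternary V → Vec V 4 → Set
  IsY E (p ∷ q ∷ x ∷ y ∷ []) = E p q x ≡ true × E p q y ≡ true

  flat : ∀ {a} {V : Set a} → List (Vec V 4) → List V
  flat = concatMap toList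

  tileOf : ∀ {I : Set} → I → Vec (I × Fin 7) 4
  tileOf i = (i , 0F) ∷ (i , 1F) ∷ (i , 2F) ∷ (i , 3F) ∷ []

  tileIndices : List (Fin 7)
  tileIndices = 0F ∷ 1F ∷ 2F ∷ 3F ∷ []

  flat-tiles : ∀ {I : Set} (is : List I) → flat (map tileOf is) ≡ cartesianProduct is tileIndices
  flat-tiles []       = refl
  flat-tiles (i ∷ is) = cong (λ xs → (i , 0F) ∷ (i , 1F) ∷ (i , 2F) ∷ (i , 3F) ∷ xs) (flat-tiles is)

  flat-map : ∀ {V W : Set} (f : V → W) qs → flat (map (Vec.map f) qs) ≡ map f (flat qs)
  flat-map f []                                = refl
  flat-map f ((p ∷ q ∷ x ∷ y ∷ []) ∷ qs) = cong (λ xs → f p ∷ f q ∷ f x ∷ f y ∷ xs) (flat-map f qs)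

  tileIndex : ∀ {a} → a ∈ tileIndices → ∃ λ (a′ : Fin 4) → a ≡ a′ ↑ˡ 3
  tileIndex (here refl)                         = 0F , refl
  tileIndex (there (here refl))                 = 1F , refl
  tileIndex (there (there (here refl)))         = 2F , refl
  tileIndex (there (there (there (here refl)))) = 3F , refl

  -- Each vertex of a copy is marked with the number of later uses of the same key, exactly as in
  -- `number`, so no marked key occurs twice. A quadruple lists first the two undoubled vertices,
  -- which form the common pair of the Y, and then the two clones.
  newTiles : List YType → List (Vec (Key × ℕ) 4)
  newTiles [] = []
  newTiles (y ∷ ys) = quadruple y (demands ys) ∷ newTiles ys
    where
    mark : Key → List Key → Key × ℕ
    mark k ks = k , occurrences _≟ᴷ_ k ks
    quadruple : YType → List Key → Vec (Key × ℕ) 4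
    quadruple ((a , b , c) , 0F) ks = mark (1F , b) ((2F , c) ∷ (0F , a) ∷ (0F , a) ∷ ks) ∷ mark (2F , c) ((0F , a) ∷ (0F , a) ∷ ks) ∷ mark (0F , a) ((0F , a) ∷ ks) ∷ mark (0F , a) ks ∷ []
    quadruple ((a , b , c) , 1F) ks = mark (0F , a) ((2F , c) ∷ (1F , b) ∷ (1F , b) ∷ ks) ∷ mark (2F , c) ((1F , b) ∷ (1F , b) ∷ ks) ∷ mark (1F , b) ((1F , b) ∷ ks) ∷ mark (1F , b) ks ∷ []
    quadruple ((a , b , c) , 2F) ks = mark (0F , a) ((1F , b) ∷ (2F , c) ∷ (2F , c) ∷ ks) ∷ mark (1F , b) ((2F , c) ∷ (2F , c) ∷ ks) ∷ mark (2F , c) ((2F , c) ∷ ks) ∷ mark (2F , c) ks ∷ []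

  flat-newTiles : ∀ ys → flat (newTiles ys) ≡ number _≟ᴷ_ (demands ys)
  flat-newTiles [] = refl
  flat-newTiles (((a , b , c) , 0F) ∷ ys) rewrite flat-newTiles ys = refl
  flat-newTiles (((a , b , c) , 1F) ∷ ys) rewrite flat-newTiles ys = refl
  flat-newTiles (((a , b , c) , 2F) ∷ ys) rewrite flat-newTiles ys = refl

  length-newTiles : ∀ ys → length (newTiles ys) ≡ length ys
  length-newTiles []       = refl
  length-newTiles (y ∷ ys) = cong suc (length-newTiles ys)

  length-demands : ∀ ys → length (demands ys) ≡ 4 * length ys
  length-demands [] = refl
  length-demands (((a , b , c) , 0F) ∷ ys) rewrite length-demands ys = sym (*-suc 4 (length ys))
  length-demands (((a , b , c) , 1F) ∷ ys) rewrite length-demands ys = sym (*-suc 4 (length ys))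
  length-demands (((a , b , c) , 2F) ∷ ys) rewrite length-demands ys = sym (*-suc 4 (length ys))

  module _ {I : Set} (_≟_ : DecidableEquality I) (E : Ternary (I × Fin 7))
    (swap₁₂ : ∀ {x y z} → E x y z ≡ true → E y x z ≡ true)
    (swap₂₃ : ∀ {x y z} → E x y z ≡ true → E x z y ≡ true)
    (tiles : ∀ i → IsY E (tileOf i))
    {P : Pattern} (cert : Certificate P) (i₀ : I) (ι : Fin 3 → List I)
    (ι-long : ∀ g → 4 * length (types cert) ≤ length (ι g))
    (ι-unique : ∀ g → Unique (ι g))
    (ι-disjoint : ∀ {g h i} → i ∈ ι g → i ∈ ι h → g ≡ h)
    (blow-up : ∀ {i j k} → i ∈ ι 0F → j ∈ ι 1F → k ∈ ι 2F →
      ∀ a b c → entry P a b c ≡ true → E (i , a) (j , b) (k , c) ≡ true)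
    where

    private
      ks : List Key
      ks = demands (types cert)

      -- The first clones of each group, as many as `caps` prescribes. By `loads` a tile vertex is
      -- used at most that often, so the new copies meet old tiles only at these clones.
      removed : List I
      removed = map (λ (g , n) → nth i₀ (ι g) n) (number Fin._≟_ (caps cert))

      -- Use number `n` of a pattern vertex goes to clone number `n` of its group; `ι-long`
      -- guarantees that there are enough clones.
      place : Key × ℕ → I × Fin 7
      place ((g , a) , n) = nth i₀ (ι g) n , a

      number<ι : ∀ {g a n} → ((g , a) , n) ∈ number _≟ᴷ_ ks → n < length (ι g)
      number<ι {g} {a} i = ≤-trans (number-< _≟ᴷ_ ks i)
        (≤-trans (occurrences≤length _≟ᴷ_ (g , a) ks)
          (≤-trans (≤-reflexive (length-demands (types cert))) (ι-long g)))

      place-injective : ∀ {x y} → x ∈ number _≟ᴷ_ ks → y ∈ number _≟ᴷ_ ks → place x ≡ place y → x ≡ y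
      place-injective {(g , a) , n} {(h , b) , m} i j eq
        with ι-disjoint (nth-∈ i₀ (ι g) (number<ι i))
                        (subst (_∈ ι h) (sym (cong proj₁ eq)) (nth-∈ i₀ (ι h) (number<ι j)))
           | cong proj₂ eq
      ... | refl | refl = cong ((g , a) ,_)
            (nth-injective i₀ (ι-unique g) (number<ι i) (number<ι j) (cong proj₁ eq))

      newAreY : ∀ ys → All (_fits P) ys →
        (∀ {g a n} → ((g , a) , n) ∈ number _≟ᴷ_ (demands ys) → n < length (ι g)) →
        All (IsY E) (map (Vec.map place) (newTiles ys))
      newAreY [] [] small = []
      newAreY (((a , b , c) , 0F) ∷ ys) (f ∷ fs) small =
        -- The doubled vertex is moved to the last position, where `IsY` expects the vertex in which
        -- the two edges differ.
        ( swap₂₃ (swap₁₂ (edge₁ (small (there (there (here refl)))))) , swap₂₃ (swap₁₂ (edge₁ (small (there (there (there (here refl))))))) )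
        ∷ newAreY ys fs (λ i → small (there (there (there (there i)))))
        where
        edge₁ : ∀ {n} → n < length (ι 0F) → _
        edge₁ n< = blow-up (nth-∈ i₀ (ι 0F) n<) (nth-∈ i₀ (ι 1F) (small (here refl))) (nth-∈ i₀ (ι 2F) (small (there (here refl)))) a b c f
      newAreY (((a , b , c) , 1F) ∷ ys) (f ∷ fs) small =
        ( swap₂₃ (edge₁ (small (there (there (here refl))))) , swap₂₃ (edge₁ (small (there (there (there (here refl)))))) )
        ∷ newAreY ys fs (λ i → small (there (there (there (there i)))))
        where
        edge₁ : ∀ {n} → n < length (ι 1F) → _
        edge₁ n< = blow-up (nth-∈ i₀ (ι 0F) (small (here refl))) (nth-∈ i₀ (ι 1F) n<) (nth-∈ i₀ (ι 2F) (small (there (here refl)))) a b c f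
      newAreY (((a , b , c) , 2F) ∷ ys) (f ∷ fs) small =
        ( edge₁ (small (there (there (here refl)))) , edge₁ (small (there (there (there (here refl))))) )
        ∷ newAreY ys fs (λ i → small (there (there (there (there i)))))
        where
        edge₁ : ∀ {n} → n < length (ι 2F) → _
        edge₁ n< = blow-up (nth-∈ i₀ (ι 0F) (small (here refl))) (nth-∈ i₀ (ι 1F) (small (there (here refl)))) (nth-∈ i₀ (ι 2F) n<) a b c f

    -- At most `length (caps cert)` old tiles are dropped and `length (types cert)` copies are
    -- added. Free vertices of a clone belong to no tile, so overlaps with kept tiles can occur only
    -- at tile vertices, where `loads` excludes them.
    augment : ∀ {is} → Unique is →
      ∃ λ T → length is < length T × Unique (flat T) × All (IsY E) T
    augment {is} u = old ++ new , longer , unique , All.++⁺ (All.map⁺ (All.tabulate λ {i} _ → tiles i)) (newAreY (types cert) (fit cert) number<ι)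
      where
      kept : List I
      kept = without _≟_ removed is
      old new : List (Vec (I × Fin 7) 4)
      old = map tileOf kept
      new = map (Vec.map place) (newTiles (types cert))

      longer : length is < length (old ++ new)
      longer = begin-strict
        length is                                        ≤⟨ length-without _≟_ removed u ⟩
        length kept + length removed                     ≡⟨ cong (length kept +_) (trans (length-map _ (number Fin._≟_ (caps cert))) (length-number Fin._≟_ (caps cert))) ⟩
        length kept + length (caps cert)                 <⟨ +-monoʳ-< (length kept) (gain cert) ⟩
        length kept + length (types cert)                ≡⟨ cong₂ _+_ (length-map tileOf kept) (trans (length-map _ (newTiles (types cert))) (length-newTiles (types cert))) ⟨
        length old + length new                          ≡⟨ length-++ old ⟨
        length (old ++ new)                              ∎
        where open ≤-Reasoning

      flat≡ : flat (old ++ new) ≡ cartesianProduct kept tileIndices ++ map place (number _≟ᴷ_ ks)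
      flat≡ = trans (concatMap-++ toList old new)
        (cong₂ _++_ (flat-tiles kept) (trans (flat-map place (newTiles (types cert))) (cong (map place) (flat-newTiles (types cert)))))

      apart : ∀ {v} → ¬ (v ∈ cartesianProduct kept tileIndices × v ∈ map place (number _≟ᴷ_ ks))
      apart (i , j) with ∈-map⁻ place j
      ... | ((g , a) , n) , k , refl with ∈-cartesianProduct⁻ kept tileIndices i
      ...   | i∈kept , a∈ with tileIndex a∈
      ...     | a′ , refl = proj₂ (∈-filter⁻ (λ x → ¬? (_∈?_ _≟_ x removed)) {xs = is} i∈kept)
                (∈-map⁺ (λ (g , n) → nth i₀ (ι g) n)
                  (∈-number Fin._≟_ (caps cert) (≤-trans (number-< _≟ᴷ_ ks k) (loads cert g a′))))

      unique : Unique (flat (old ++ new))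
      unique = subst Unique (sym flat≡) (Unique.++⁺
        (Unique.cartesianProduct⁺ (Unique.filter⁺ (λ x → ¬? (_∈?_ _≟_ x removed)) u) indices)
        (unique-map place place-injective (number-unique _≟ᴷ_ ks)) apart)
        where
        indices : Unique tileIndices
        indices = ((λ ()) ∷ (λ ()) ∷ (λ ()) ∷ []) ∷ ((λ ()) ∷ (λ ()) ∷ []) ∷ ((λ ()) ∷ []) ∷ [] ∷ []

-- A popular dense pattern, its blow-up, and the resulting larger tiling.

module Density where

  open Prelude
  import Data.Bool.Properties as Bool
  import Data.Fin.Properties as Fin
  open import Data.List using (cartesianProductWith)
  open import Data.List.Membership.Propositional.Properties using (∈-cartesianProductWith⁺)
  open import Data.List.Relation.Binary.Permutation.Propositional using (↭⇒↭ₛ)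
  import Data.List.Relation.Binary.Permutation.Setoid.Properties as Permₛ
  import Data.List.Relation.Unary.All as All
  import Data.List.Relation.Unary.All.Properties as All
  import Data.List.Relation.Unary.Unique.Propositional.Properties as Unique
  open import Data.Vec as Vec using (tabulate)
  import Data.Vec.Properties as Vec
  open Sums
  open Count using (F7; ∑F7-≤const)
  open Box
  open Cert
  open Augment

  Unique-resp-↭ : ∀ {A : Set} {xs ys : List A} → xs ↭ ys → Unique xs → Unique ys
  Unique-resp-↭ {A} p = Permₛ.Unique-resp-↭ (setoid A) (↭⇒↭ₛ p)

  Unique-++ˡ : ∀ {a} {A : Set a} (xs : List A) {ys} → Unique (xs ++ ys) → Unique xs
  Unique-++ˡ []       u        = []
  Unique-++ˡ (x ∷ xs) (x∉ ∷ u) = All.++⁻ˡ xs x∉ ∷ Unique-++ˡ xs u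

  ∑-unique≤1 : ∀ {A : Set} (_≟_ : DecidableEquality A) x {ys} → Unique ys → ∑ ys (λ y → ⟦ does (x ≟ y) ⟧) ≤ 1
  ∑-unique≤1 _≟_ x []                   = z≤n
  ∑-unique≤1 _≟_ x {y ∷ ys} (y∉ ∷ u) with x ≟ y
  ... | no  _    = ∑-unique≤1 _≟_ x u
  ... | yes refl = s≤s (absent y∉)
    where
    absent : ∀ {zs} → All (x ≢_) zs → ∑ zs (λ z → ⟦ does (x ≟ z) ⟧) ≤ 0
    absent []                 = z≤n
    absent {z ∷ zs} (x≢z ∷ p) with x ≟ z
    ... | yes eq = ⊥-elim (x≢z eq)
    ... | no  _  = absent p

  opaque
    vectors : ∀ {A : Set} → List A → ∀ n → List (Vec A n)
    vectors xs zero    = [] ∷ []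
    vectors xs (suc n) = cartesianProductWith _∷_ xs (vectors xs n)

    ∈-vectors : ∀ {A : Set} {xs : List A} → (∀ x → x ∈ xs) → ∀ {n} (v : Vec A n) → v ∈ vectors xs n
    ∈-vectors all []      = here refl
    ∈-vectors all (x ∷ v) = ∈-cartesianProductWith⁺ _∷_ (all x) (∈-vectors all v)

  opaque
    -- `capacity` is 7³, the number of entries of a pattern, and `sparse` is 7³ - 6³. Opacity keeps
    -- the numerals from being unfolded in the arithmetic that follows.
    sparse capacity : ℕ
    sparse = 127
    capacity  = 343

    capacity>0 : 0 < capacity
    capacity>0 = s≤s z≤n

  opaque
    patterns : List Pattern
    patterns = vectors (vectors (vectors (false ∷ true ∷ []) 7) 7) 7

    ∈-patterns : ∀ P → P ∈ patterns
    ∈-patterns = ∈-vectors (∈-vectors (∈-vectors λ { false → here refl ; true → there (here refl) }))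

    _≟ᴾ_ : DecidableEquality Pattern
    _≟ᴾ_ = Vec.≡-dec (Vec.≡-dec (Vec.≡-dec Bool._≟_))

  need : ∀ {P} → size P ≤ 127 ⊎ Certificate P → ℕ
  need (inj₁ _) = 0
  need (inj₂ c) = 4 * length (types c)

  opaque
    -- One size that serves every pattern: the sum over the finitely many patterns dominates each of
    -- its terms. `need` counts all four vertices of every copy, which bounds the uses of any single
    -- key.
    blow-up-size : ℕ
    blow-up-size = ∑ patterns (λ P → need (certify P))

    need≤blow-up-size : ∀ P → need (certify P) ≤ blow-up-size
    need≤blow-up-size P = term≤∑ (λ P → need (certify P)) (∈-patterns P)

  opaque
    unfolding sparse capacity

    small-certificate : ∀ P → sparse < size P → ∃ λ (c : Certificate P) → 4 * length (types c) ≤ blow-up-size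
    small-certificate P big = choose (certify P) (need≤blow-up-size P)
      where
      choose : ∀ (r : size P ≤ 127 ⊎ Certificate P) → need r ≤ blow-up-size →
        ∃ λ (c : Certificate P) → 4 * length (types c) ≤ blow-up-size
      choose (inj₁ ≤127) _ = ⊥-elim (<⇒≱ big ≤127)
      choose (inj₂ c)    h = c , h

    size≤capacity : ∀ P → size P ≤ capacity
    size≤capacity P = ∑F7-≤const 49 λ a → ∑F7-≤const 7 λ b → ∑F7-≤const 1 λ c → ⟦⟧≤1 (entry P a b c)

  patterns-nonempty : 0 < length patterns
  patterns-nonempty = nonempty (∈-patterns (Vec.replicate 7 (Vec.replicate 7 (Vec.replicate 7 false))))
    where
    nonempty : ∀ {A : Set} {x : A} {xs} → x ∈ xs → 0 < length xs
    nonempty (here _)  = s≤s z≤n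
    nonempty (there _) = s≤s z≤n

  Distinct : ∀ {t} → Fin t → Fin t → Fin t → Set
  Distinct i j k = i ≢ j × j ≢ k × i ≢ k

  distinct? : ∀ {t} (i j k : Fin t) → Dec (Distinct i j k)
  distinct? i j k = ¬? (i Fin.≟ j) ×-dec ¬? (j Fin.≟ k) ×-dec ¬? (i Fin.≟ k)

  -- The first summand lets `t³` absorb the terms of order `t²`; the second is what `box` asks for
  -- at density `1 / (2 * capacity * c * length patterns)`.
  coreThreshold : ℕ → ℕ → ℕ
  coreThreshold c M = suc (2 * (capacity * 3 * c + M)) + boxThreshold blow-up-size (2 * capacity * c * length patterns)

  module _ (t : ℕ) (E : Ternary (Fin t × Fin 7)) where

    ts : List (Fin t)
    ts = allFin t

    length-ts : length ts ≡ t
    length-ts = length-tabulate (λ i → i)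

    ∑³ : (Fin t → Fin t → Fin t → ℕ) → ℕ
    ∑³ f = ∑ ts λ i → ∑ ts λ j → ∑ ts λ k → f i j k

    patternOf : Fin t → Fin t → Fin t → Pattern
    patternOf i j k = tabulate λ a → tabulate λ b → tabulate λ c → E (i , a) (j , b) (k , c)

    entry-patternOf : ∀ i j k a b c → entry (patternOf i j k) a b c ≡ E (i , a) (j , b) (k , c)
    entry-patternOf i j k a b c
      rewrite Vec.lookup∘tabulate (λ a → tabulate λ b → tabulate λ c → E (i , a) (j , b) (k , c)) a
            | Vec.lookup∘tabulate (λ b → tabulate λ c → E (i , a) (j , b) (k , c)) b
            = Vec.lookup∘tabulate (λ c → E (i , a) (j , b) (k , c)) c

    edgeCount : Fin t → Fin t → Fin t → ℕ
    edgeCount i j k = ∑ F7 λ a → ∑ F7 λ b → ∑ F7 λ c → ⟦ E (i , a) (j , b) (k , c) ⟧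

    size-patternOf : ∀ i j k → size (patternOf i j k) ≡ edgeCount i j k
    size-patternOf i j k = ∑-cong F7 λ a → ∑-cong F7 λ b → ∑-cong F7 λ c → cong ⟦_⟧ (entry-patternOf i j k a b c)

    -- Distinctness of the groups and density of `P` are built into the indicator, so the box found
    -- for it delivers disjoint parts and a pattern that has a certificate.
    rich : Pattern → Fin t → Fin t → Fin t → ℕ
    rich P i j k = ⟦ does (distinct? i j k) ⟧ * (⟦ does (sparse <? size P) ⟧ * ⟦ does (patternOf i j k ≟ᴾ P) ⟧)

    rich≤1 : ∀ P i j k → rich P i j k ≤ 1
    rich≤1 P i j k = *-mono-≤ (⟦⟧≤1 (does (distinct? i j k)))
      (*-mono-≤ (⟦⟧≤1 (does (sparse <? size P))) (⟦⟧≤1 (does (patternOf i j k ≟ᴾ P))))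

    rich⇒ : ∀ {P i j k} → 0 < rich P i j k → Distinct i j k × sparse < size P × patternOf i j k ≡ P
    rich⇒ {P} {i} {j} {k} p =
        indicator⇒ (distinct? i j k) (*-positiveˡ ⟦ does (distinct? i j k) ⟧ p)
      , indicator⇒ (sparse <? size P) (*-positiveˡ ⟦ does (sparse <? size P) ⟧ q)
      , indicator⇒ (patternOf i j k ≟ᴾ P) (*-positiveʳ ⟦ does (sparse <? size P) ⟧ q)
      where
      q = *-positiveʳ ⟦ does (distinct? i j k) ⟧ p

    same : Fin t → Fin t → ℕ
    same i j = ⟦ does (i Fin.≟ j) ⟧

    ⇒rich : ∀ i j k → Distinct i j k → sparse < size (patternOf i j k) → rich (patternOf i j k) i j k ≡ 1
    ⇒rich i j k d big = cong₂ (λ u v → ⟦ u ⟧ * v) (does-yes (distinct? i j k) d)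
      (cong₂ (λ u v → ⟦ u ⟧ * ⟦ v ⟧) (does-yes (sparse <? _) big) (does-yes (patternOf i j k ≟ᴾ patternOf i j k) refl))

    -- A triple of groups has at most 127 edges unless two groups coincide or the triple is rich for
    -- its own pattern; in those cases the trivial bound 343 is charged to the corresponding term.
    edgeCount≤ : ∀ i j k → edgeCount i j k ≤
      sparse + capacity * ∑ patterns (λ P → rich P i j k) + capacity * (same i j + same j k + same i k)
    edgeCount≤ i j k = subst (_≤ bound) (size-patternOf i j k) (case (i Fin.≟ j) (j Fin.≟ k) (i Fin.≟ k) (sparse <? size (patternOf i j k)))
      where
      R = ∑ patterns (λ P → rich P i j k)
      eqs = same i j + same j k + same i k
      bound = sparse + capacity * R + capacity * eqs
      collision : 1 ≤ eqs → size (patternOf i j k) ≤ bound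
      collision h = ≤-trans (size≤capacity (patternOf i j k)) (≤-trans (m≤m*n capacity eqs {{>-nonZero h}}) (m≤n+m _ (sparse + capacity * R)))
      one : ∀ {a b : Fin t} → a ≡ b → 1 ≤ same a b
      one {a} {b} eq = ≤-reflexive (cong ⟦_⟧ (sym (does-yes (a Fin.≟ b) eq)))
      case : Dec (i ≡ j) → Dec (j ≡ k) → Dec (i ≡ k) → Dec (sparse < size (patternOf i j k)) → size (patternOf i j k) ≤ bound
      case (yes p) _ _ _ = collision (≤-trans (one p) (≤-trans (m≤m+n (same i j) _) (m≤m+n _ (same i k))))
      case (no _) (yes p) _ _ = collision (≤-trans (one p) (≤-trans (m≤n+m (same j k) _) (m≤m+n _ (same i k))))
      case (no _) (no _) (yes p) _ = collision (≤-trans (one p) (m≤n+m (same i k) _))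
      case (no _) (no _) (no _) (no ≱) = ≤-trans (≤-pred (≰⇒> ≱)) (≤-trans (m≤m+n sparse (capacity * R)) (m≤m+n _ (capacity * eqs)))
      case (no p) (no q) (no r) (yes big) = ≤-trans (size≤capacity (patternOf i j k))
        (≤-trans (m≤m*n capacity R {{>-nonZero (≤-trans (≤-reflexive (sym (⇒rich i j k (p , q , r) big)))
                                                       (term≤∑ (λ P → rich P i j k) (∈-patterns _)))}})
        (≤-trans (m≤n+m (capacity * R) sparse) (m≤m+n _ (capacity * eqs))))

    ∑-same : ∀ i → ∑ ts (same i) ≤ 1
    ∑-same i = ∑-unique≤1 Fin._≟_ i (Unique.allFin⁺ t)

    ∑ts-≤ : ∀ c {f : Fin t → ℕ} → (∀ i → f i ≤ c) → ∑ ts f ≤ t * c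
    ∑ts-≤ c {f} h = subst (λ n → ∑ ts f ≤ n * c) length-ts (∑-≤const ts c {f} h)

    ∑³-+ : ∀ f g → ∑³ (λ i j k → f i j k + g i j k) ≡ ∑³ f + ∑³ g
    ∑³-+ f g = trans (∑-cong ts λ i → trans (∑-cong ts λ j → ∑-+ ts (f i j) (g i j)) (∑-+ ts _ _)) (∑-+ ts _ _)

    ∑³-* : ∀ c f → ∑³ (λ i j k → c * f i j k) ≡ c * ∑³ f
    ∑³-* c f = trans (∑-cong ts λ i → trans (∑-cong ts λ j → ∑-*ˡ ts c (f i j)) (∑-*ˡ ts c _)) (∑-*ˡ ts c _)

    ∑³-same : ∑³ (λ i j k → same i j + same j k + same i k) ≤ 3 * (t * t)
    ∑³-same = begin
      ∑³ (λ i j k → same i j + same j k + same i k)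
        ≡⟨ trans (∑³-+ (λ i j k → same i j + same j k) (λ i j k → same i k))
             (cong (_+ ∑³ (λ i j k → same i k)) (∑³-+ (λ i j k → same i j) (λ i j k → same j k))) ⟩
      ∑³ (λ i j k → same i j) + ∑³ (λ i j k → same j k) + ∑³ (λ i j k → same i k)
        ≤⟨ +-mono-≤ (+-mono-≤
             (∑ts-≤ t λ i → ≤-trans (≤-reflexive (trans (∑-cong ts λ j → trans (∑-const ts (same i j)) (cong (_* same i j) length-ts))
                                                 (∑-*ˡ ts t (same i))))
                             (≤-trans (*-monoʳ-≤ t (∑-same i)) (≤-reflexive (*-identityʳ t))))
             (∑ts-≤ t λ i → ≤-trans (∑ts-≤ 1 λ j → ∑-same j) (≤-reflexive (*-identityʳ t))))
             (∑ts-≤ t λ i → ≤-trans (∑ts-≤ 1 λ j → ∑-same i) (≤-reflexive (*-identityʳ t))) ⟩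
      t * t + t * t + t * t
        ≡⟨ lemma (t * t) ⟩
      3 * (t * t) ∎
      where
      open ≤-Reasoning
      lemma : ∀ a → a + a + a ≡ 3 * a
      lemma = solve-∀

    ∑³-const : ∀ c → ∑³ (λ _ _ _ → c) ≡ c * (t * (t * t))
    ∑³-const c = begin
      ∑³ (λ _ _ _ → c)                       ≡⟨ ∑-cong ts (λ i → ∑-cong ts λ j → ∑-const ts c) ⟩
      ∑ ts (λ _ → ∑ ts λ _ → length ts * c)  ≡⟨ ∑-cong ts (λ i → ∑-const ts _) ⟩
      ∑ ts (λ _ → length ts * (length ts * c)) ≡⟨ ∑-const ts _ ⟩
      length ts * (length ts * (length ts * c)) ≡⟨ cong (λ n → n * (n * (n * c))) length-ts ⟩
      t * (t * (t * c))                      ≡⟨ lemma t c ⟩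
      c * (t * (t * t))                      ∎
      where
      open ≡-Reasoning
      lemma : ∀ t c → t * (t * (t * c)) ≡ c * (t * (t * t))
      lemma = solve-∀

    ∑³-patterns : ∑³ (λ i j k → ∑ patterns (λ P → rich P i j k)) ≡ ∑ patterns (λ P → ∑³ (rich P))
    ∑³-patterns = begin
      ∑³ (λ i j k → ∑ patterns (λ P → rich P i j k))
        ≡⟨ ∑-cong ts (λ i → ∑-cong ts λ j → ∑-swap ts patterns (λ k P → rich P i j k)) ⟩
      ∑ ts (λ i → ∑ ts λ j → ∑ patterns λ P → ∑ ts λ k → rich P i j k)
        ≡⟨ ∑-cong ts (λ i → ∑-swap ts patterns (λ j P → ∑ ts λ k → rich P i j k)) ⟩
      ∑ ts (λ i → ∑ patterns λ P → ∑ ts λ j → ∑ ts λ k → rich P i j k)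
        ≡⟨ ∑-swap ts patterns (λ i P → ∑ ts λ j → ∑ ts λ k → rich P i j k) ⟩
      ∑ patterns (λ P → ∑³ (rich P)) ∎
      where open ≡-Reasoning

    ∑³-edgeCount≤ : ∑³ edgeCount ≤ sparse * (t * (t * t)) + capacity * ∑ patterns (λ P → ∑³ (rich P)) + capacity * (3 * (t * t))
    ∑³-edgeCount≤ = begin
      ∑³ edgeCount
        ≤⟨ ∑-mono ts (λ i → ∑-mono ts λ j → ∑-mono ts λ k → edgeCount≤ i j k) ⟩
      ∑³ (λ i j k → sparse + capacity * R i j k + capacity * C i j k)
        ≡⟨ trans (∑³-+ (λ i j k → sparse + capacity * R i j k) (λ i j k → capacity * C i j k))
             (cong₂ _+_ (trans (∑³-+ (λ _ _ _ → sparse) (λ i j k → capacity * R i j k)) (cong₂ _+_ (∑³-const sparse) (trans (∑³-* capacity R) (cong (capacity *_) ∑³-patterns))))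
               (∑³-* capacity C)) ⟩
      sparse * (t * (t * t)) + capacity * ∑ patterns (λ P → ∑³ (rich P)) + capacity * ∑³ C
        ≤⟨ +-monoʳ-≤ (sparse * (t * (t * t)) + capacity * ∑ patterns (λ P → ∑³ (rich P))) (*-monoʳ-≤ capacity ∑³-same) ⟩
      sparse * (t * (t * t)) + capacity * ∑ patterns (λ P → ∑³ (rich P)) + capacity * (3 * (t * t)) ∎
      where
      open ≤-Reasoning
      R C : Fin t → Fin t → Fin t → ℕ
      R i j k = ∑ patterns (λ P → rich P i j k)
      C i j k = same i j + same j k + same i k

    -- Multiplying by c and cancelling 127 c t³ leaves t³ ≤ 343 c B + O(t²).
    many-rich : ∀ c M → suc (2 * (capacity * 3 * c + M)) ≤ t →
      t * (t * t) + c * (sparse * (t * (t * t))) ≤ c * ∑³ edgeCount + M * (t * t) →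
      t * (t * t) ≤ 2 * capacity * c * ∑ patterns (λ P → ∑³ (rich P))
    many-rich c M large h = +-cancelʳ-≤ (t * (t * t)) _ _ (begin
      t³ + t³
        ≡⟨ cong (t³ +_) (+-identityʳ t³) ⟨
      2 * t³
        ≤⟨ *-monoʳ-≤ 2 (+-cancelʳ-≤ (c * (sparse * t³)) _ _ (≤-trans h (≤-trans (+-monoˡ-≤ (M * (t * t)) (*-monoʳ-≤ c ∑³-edgeCount≤))
             (≤-reflexive (expand sparse capacity c t³ B (t * t) M))))) ⟩
      2 * (capacity * c * B + (capacity * 3 * c + M) * (t * t))
        ≡⟨ expand′ capacity c B (capacity * 3 * c + M) (t * t) ⟩
      2 * capacity * c * B + 2 * (capacity * 3 * c + M) * (t * t)
        ≤⟨ +-monoʳ-≤ (2 * capacity * c * B) (*-monoˡ-≤ (t * t) (≤-trans (n≤1+n _) large)) ⟩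
      2 * capacity * c * B + t³ ∎)
      where
      open ≤-Reasoning
      t³ = t * (t * t)
      B = ∑ patterns (λ P → ∑³ (rich P))
      expand : ∀ u v c t³ B t² M → c * (u * t³ + v * B + v * (3 * t²)) + M * t² ≡ v * c * B + (v * 3 * c + M) * t² + c * (u * t³)
      expand = solve-∀
      expand′ : ∀ v c B a t² → 2 * (v * c * B + a * t²) ≡ 2 * v * c * B + 2 * a * t²
      expand′ = solve-∀

    popular-pattern : ∀ c → t * (t * t) ≤ 2 * capacity * c * ∑ patterns (λ P → ∑³ (rich P)) →
      ∃ λ P → t * (t * t) ≤ 2 * capacity * c * length patterns * ∑³ (rich P)
    popular-pattern c h =
      let P , _ , B≤ = pigeonhole patterns (λ P → length patterns * ∑³ (rich P)) (∑ patterns (λ P → ∑³ (rich P)))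
            patterns-nonempty (≤-reflexive (sym (∑-*ˡ patterns (length patterns) (λ P → ∑³ (rich P)))))
      in P , ≤-trans h (≤-trans (*-monoʳ-≤ (2 * capacity * c) B≤) (≤-reflexive (sym (*-assoc (2 * capacity * c) (length patterns) _))))

    module _ (swap₁₂ : ∀ {x y z} → E x y z ≡ true → E y x z ≡ true)
             (swap₂₃ : ∀ {x y z} → E x y z ≡ true → E x z y ≡ true)
             (tiles : ∀ i → IsY E (tileOf i)) where

      Larger : Set
      Larger = ∃ λ T → t < length T × Unique (flat T) × All (IsY E) T

      blow-up⇒larger : ∀ P → Fin t → sparse < size P →
        (∃ λ (S : Selection ts blow-up-size) → ∃ λ (T : Selection ts blow-up-size) → ∃ λ (U : Selection ts blow-up-size) →
          ∀ {i j k} → i ∈ chosen S → j ∈ chosen T → k ∈ chosen U → 0 < rich P i j k) → Larger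
      blow-up⇒larger P i₀ big (S , T , U , all-rich) = enlarge (small-certificate P big)
        where
        ι : Fin 3 → List (Fin t)
        ι 0F = chosen S
        ι 1F = chosen T
        ι 2F = chosen U

        selection : ∀ g → ∃ λ rest → ts ↭ ι g ++ rest × length (ι g) ≡ blow-up-size
        selection 0F = rest S , selects S , enough S
        selection 1F = rest T , selects T , enough T
        selection 2F = rest U , selects U , enough U

        enlarge : (∃ λ (c : Certificate P) → 4 * length (types c) ≤ blow-up-size) → Larger
        enlarge (cert , small) =
          let T , longer , unique , ys = augment Fin._≟_ E swap₁₂ swap₂₃ tiles cert i₀ ι long unique-ι disjoint blown (Unique.allFin⁺ t)
          in T , subst (_< length T) length-ts longer , unique , ys
          where
          long : ∀ g → 4 * length (types cert) ≤ length (ι g)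
          long g = let _ , _ , eq = selection g in ≤-trans small (≤-reflexive (sym eq))

          unique-ι : ∀ g → Unique (ι g)
          unique-ι g = let _ , p , _ = selection g in Unique-++ˡ (ι g) (Unique-resp-↭ p (Unique.allFin⁺ t))

          -- Distinctness is known only for full triples, so comparing two parts requires an element
          -- of the third.
          member : ∀ g → nth i₀ (ι g) 0 ∈ ι g
          member g = nth-∈ i₀ (ι g) (≤-trans (≤-trans (≤-trans (s≤s z≤n) (gain cert)) (m≤n*m (length (types cert)) 4)) (long g))

          distinct : ∀ {i j k} → i ∈ ι 0F → j ∈ ι 1F → k ∈ ι 2F → Distinct i j k
          distinct p q r = proj₁ (rich⇒ (all-rich p q r))

          disjoint : ∀ {g h i} → i ∈ ι g → i ∈ ι h → g ≡ h
          disjoint {0F} {0F} p q = refl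
          disjoint {1F} {1F} p q = refl
          disjoint {2F} {2F} p q = refl
          disjoint {0F} {1F} p q = let d , _ , _ = distinct p q (member 2F) in ⊥-elim (d refl)
          disjoint {1F} {0F} p q = let d , _ , _ = distinct q p (member 2F) in ⊥-elim (d refl)
          disjoint {1F} {2F} p q = let _ , d , _ = distinct (member 0F) p q in ⊥-elim (d refl)
          disjoint {2F} {1F} p q = let _ , d , _ = distinct (member 0F) q p in ⊥-elim (d refl)
          disjoint {0F} {2F} p q = let _ , _ , d = distinct p (member 1F) q in ⊥-elim (d refl)
          disjoint {2F} {0F} p q = let _ , _ , d = distinct q (member 1F) p in ⊥-elim (d refl)

          blown : ∀ {i j k} → i ∈ ι 0F → j ∈ ι 1F → k ∈ ι 2F →
            ∀ a b c → entry P a b c ≡ true → E (i , a) (j , b) (k , c) ≡ true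
          blown {i} {j} {k} p q r a b c f = trans (sym (entry-patternOf i j k a b c))
            (trans (cong (λ P → entry P a b c) (proj₂ (proj₂ (rich⇒ (all-rich p q r))))) f)

      popular⇒larger : ∀ P D → 0 < D → boxThreshold blow-up-size D ≤ t → 0 < t →
        t * (t * t) ≤ D * ∑³ (rich P) → Larger
      popular⇒larger P D 0<D large 0<t density = witness (∑-positive ts _ (*-positiveʳ D (≤-trans (*-mono-≤ 0<t (*-mono-≤ 0<t 0<t)) density)))
        where
        selections = box blow-up-size D 0<D ts (rich P) (rich≤1 P)
          (subst (boxThreshold blow-up-size D ≤_) (sym length-ts) large)
          (subst (0 <_) (sym length-ts) 0<t)
          (subst (λ n → n * (n * n) ≤ D * ∑³ (rich P)) (sym length-ts) density)
        -- A single rich triple already shows that `P` is dense and provides the default element for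
        -- `nth`.
        witness : (∃ λ i → i ∈ ts × 0 < ∑ ts (λ j → ∑ ts (rich P i j))) → Larger
        witness (i , _ , p) with ∑-positive ts _ p
        ... | j , _ , q with ∑-positive ts _ q
        ...   | k , _ , r = blow-up⇒larger P i (proj₁ (proj₂ (rich⇒ {P} {i} {j} {k} r))) selections

      core : ∀ c M → 0 < c → coreThreshold c M ≤ t →
        t * (t * t) + c * (sparse * (t * (t * t))) ≤ c * ∑³ edgeCount + M * (t * t) → Larger
      core c M 0<c large density =
        let P , popular = popular-pattern c (many-rich c M (≤-trans (m≤m+n _ _) large) density)
        in popular⇒larger P (2 * capacity * c * length patterns) (*-mono-≤ (*-mono-≤ (*-mono-≤ {1} {2} (s≤s z≤n) capacity>0) 0<c) patterns-nonempty)
             (≤-trans (m≤n+m _ (suc (2 * (capacity * 3 * c + M)))) large)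
             (≤-trans (s≤s z≤n) large) popular

-- Partition into groups of seven with added universal vertices, and one improvement step.

module Groups where

  open Prelude
  open import Data.Bool using (not)
  import Data.Empty
  import Data.List as List
  open import Data.List.Relation.Binary.Permutation.Propositional using (module PermutationReasoning)
  open import Data.List.Relation.Binary.Permutation.Propositional.Properties using (↭-length; ++⁺ˡ; ++⁺ʳ; ++-comm; map⁺; ++⁺)
  import Data.List.Relation.Unary.All as All
  import Data.List.Relation.Unary.All.Properties as All
  import Data.List.Relation.Unary.Unique.Propositional.Properties as Unique
  open import Data.Nat.DivMod using (_/_; _%_; m≡m%n+[m/n]*n; m%n<n)
  open import Data.Sum.Properties using (inj₁-injective; inj₂-injective)
  open import Data.Vec as Vec using (lookup; toList)
  import Data.Vec.Properties as Vec
  open Sums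
  open Count using (F7)
  open Augment
  open Density

  takeVec : ∀ {A : Set} m (xs : List A) → m ≤ length xs → ∃₂ λ (v : Vec A m) ys → xs ≡ toList v ++ ys
  takeVec zero    xs       _       = [] , xs , refl
  takeVec (suc m) (x ∷ xs) (s≤s p) = let v , ys , eq = takeVec m xs p in x ∷ v , ys , cong (x ∷_) eq

  toLists : ∀ {A : Set} {k} → List (Vec A k) → List A
  toLists = concatMap toList

  interchange : ∀ {A : Set} (as bs cs ds : List A) → (as ++ bs) ++ (cs ++ ds) ↭ (as ++ cs) ++ (bs ++ ds)
  interchange as bs cs ds = begin
    (as ++ bs) ++ (cs ++ ds)   ≡⟨ ++-assoc as bs (cs ++ ds) ⟩
    as ++ (bs ++ (cs ++ ds))   ≡⟨ cong (as ++_) (++-assoc bs cs ds) ⟨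
    as ++ ((bs ++ cs) ++ ds)   ↭⟨ ++⁺ˡ as (++⁺ʳ ds (++-comm bs cs)) ⟩
    as ++ ((cs ++ bs) ++ ds)   ≡⟨ cong (as ++_) (++-assoc cs bs ds) ⟩
    as ++ (cs ++ (bs ++ ds))   ≡⟨ ++-assoc as cs (bs ++ ds) ⟨
    (as ++ cs) ++ (bs ++ ds)   ∎
    where open PermutationReasoning

  -- Used with `k = 4`, `m = 3` for the tiles and with `k = 1`, `m = 6` for the added vertices.
  record Distribution {A : Set} (k m : ℕ) (heads : List (Vec A k)) (pool : List A) : Set where
    field
      groups   : List (Vec A (k + m))
      unused   : List A
      length≡  : length groups ≡ length heads
      extended : All (λ g → ∃₂ λ h w → h ∈ heads × g ≡ h Vec.++ w) groups
      permutes : toLists heads ++ pool ↭ toLists groups ++ unused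
      unused≡  : length pool ≡ m * length heads + length unused

  open Distribution

  distribute : ∀ {A : Set} k m (heads : List (Vec A k)) pool → m * length heads ≤ length pool →
    Distribution k m heads pool
  distribute k m [] pool _ = record
    { groups = [] ; unused = pool ; length≡ = refl ; extended = [] ; permutes = ↭-refl
    ; unused≡ = cong (_+ length pool) (sym (*-zeroʳ m)) }
  distribute k m (h ∷ hs) pool enough with takeVec m pool (≤-trans (≤-trans (m≤m+n m (m * length hs)) (≤-reflexive (sym (*-suc m (length hs))))) enough)
  ... | w , rest , refl = record
    { groups = (h Vec.++ w) ∷ groups D ; unused = unused D ; length≡ = cong suc (length≡ D)
    ; extended = (h , w , here refl , refl) ∷ All.map (λ (h , w , i , eq) → h , w , there i , eq) (extended D)
    ; permutes = (begin
        (toList h ++ toLists hs) ++ (toList w ++ rest)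
          ↭⟨ interchange (toList h) (toLists hs) (toList w) rest ⟩
        (toList h ++ toList w) ++ (toLists hs ++ rest)
          ↭⟨ ++⁺ˡ (toList h ++ toList w) (permutes D) ⟩
        (toList h ++ toList w) ++ (toLists (groups D) ++ unused D)
          ≡⟨ ++-assoc (toList h ++ toList w) (toLists (groups D)) (unused D) ⟨
        ((toList h ++ toList w) ++ toLists (groups D)) ++ unused D
          ≡⟨ cong (λ u → (u ++ toLists (groups D)) ++ unused D) (sym (Vec.toList-++ h w)) ⟩
        (toList (h Vec.++ w) ++ toLists (groups D)) ++ unused D ∎)
    ; unused≡ = trans split (trans (cong (m +_) (unused≡ D))
        (trans (sym (+-assoc m (m * length hs) _)) (cong (_+ length (unused D)) (sym (*-suc m (length hs)))))) }
    where
    open PermutationReasoning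
    split : length (toList w ++ rest) ≡ m + length rest
    split = trans (length-++ (toList w)) (cong (_+ length rest) (Vec.length-toList w))
    D : Distribution k m hs rest
    D = distribute k m hs rest (+-cancelˡ-≤ m _ _ (≤-trans (≤-reflexive (sym (*-suc m (length hs)))) (≤-trans enough (≤-reflexive split))))

  ∑-toList : ∀ {A : Set} (v : Vec A 7) (f : A → ℕ) → ∑ (toList v) f ≡ ∑ F7 (λ a → f (lookup v a))
  ∑-toList = helper
    where
    opaque
      unfolding F7
      helper : ∀ {A : Set} (v : Vec A 7) (f : A → ℕ) → ∑ (toList v) f ≡ ∑ F7 (λ a → f (lookup v a))
      helper (_ ∷ _ ∷ _ ∷ _ ∷ _ ∷ _ ∷ _ ∷ []) f = refl

  ∑-lookup : ∀ {A : Set} {t} (v : Vec A t) (f : A → ℕ) → ∑ (allFin t) (λ i → f (lookup v i)) ≡ ∑ (toList v) f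
  ∑-lookup v f = tabulated v (λ i → i) (λ i → f (lookup v i)) λ i → refl
    where
    tabulated : ∀ {B : Set} {t} (v : Vec _ t) (φ : Fin t → B) (h : B → ℕ) → (∀ i → h (φ i) ≡ f (lookup v i)) →
      ∑ (List.tabulate φ) h ≡ ∑ (toList v) f
    tabulated []      φ h eq = refl
    tabulated (x ∷ v) φ h eq = cong₂ _+_ (eq zero) (tabulated v (φ ∘ suc) h (eq ∘ suc))

  unique-++-disjoint : ∀ {A : Set} (xs : List A) {ys} → Unique (xs ++ ys) → ∀ {x} → x ∈ xs → x ∈ ys → ∀ {B : Set} → B
  unique-++-disjoint (x ∷ xs) (x∉ ∷ u) (here refl) j = ⊥-elim (All.lookup x∉ (∈-++⁺ʳ xs j) refl)
  unique-++-disjoint (x ∷ xs) (x∉ ∷ u) (there i)   j = unique-++-disjoint xs u i j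

  Unique-++ʳ : ∀ {A : Set} (xs : List A) {ys} → Unique (xs ++ ys) → Unique ys
  Unique-++ʳ []       u       = u
  Unique-++ʳ (x ∷ xs) (_ ∷ u) = Unique-++ʳ xs u

  lookup∈ : ∀ {A : Set} {n} (v : Vec A n) i → lookup v i ∈ toList v
  lookup∈ (x ∷ v) zero    = here refl
  lookup∈ (x ∷ v) (suc i) = there (lookup∈ v i)

  lookup-injective : ∀ {A : Set} {n} (v : Vec A n) → Unique (toList v) → ∀ {i j} → lookup v i ≡ lookup v j → i ≡ j
  lookup-injective (x ∷ v) u        {zero}  {zero}  eq = refl
  lookup-injective (x ∷ v) (x∉ ∷ u) {zero}  {suc j} eq = ⊥-elim (All.lookup x∉ (lookup∈ v j) eq)
  lookup-injective (x ∷ v) (x∉ ∷ u) {suc i} {zero}  eq = ⊥-elim (All.lookup x∉ (lookup∈ v i) (sym eq))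
  lookup-injective (x ∷ v) (x∉ ∷ u) {suc i} {suc j} eq = cong suc (lookup-injective v u eq)

  module _ {A : Set} where

    cell : ∀ {t} → Vec (Vec A 7) t → Fin t × Fin 7 → A
    cell gs (i , a) = lookup (lookup gs i) a

    cells∈ : ∀ {t} (gs : Vec (Vec A 7) t) i a → cell gs (i , a) ∈ toLists (toList gs)
    cells∈ (g ∷ gs) zero    a = ∈-++⁺ˡ (lookup∈ g a)
    cells∈ (g ∷ gs) (suc i) a = ∈-++⁺ʳ (toList g) (cells∈ gs i a)

    cell-injective : ∀ {t} (gs : Vec (Vec A 7) t) → Unique (toLists (toList gs)) →
      ∀ {x y} → cell gs x ≡ cell gs y → x ≡ y
    cell-injective (g ∷ gs) u {zero , a} {zero , b} eq = cong (zero ,_) (lookup-injective g (Unique-++ˡ (toList g) u) eq)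
    cell-injective (g ∷ gs) u {zero , a} {suc j , b} eq =
      unique-++-disjoint (toList g) u (lookup∈ g a) (subst (_∈ toLists (toList gs)) (sym eq) (cells∈ gs j b))
    cell-injective (g ∷ gs) u {suc i , a} {zero , b} eq =
      unique-++-disjoint (toList g) u (lookup∈ g b) (subst (_∈ toLists (toList gs)) eq (cells∈ gs i a))
    cell-injective (g ∷ gs) u {suc i , a} {suc j , b} eq =
      cong (λ (i , a) → suc i , a) (cell-injective gs (Unique-++ʳ (toList g) u) {i , a} {j , b} eq)

    ∑-cells : ∀ {t} (gs : Vec (Vec A 7) t) (f : A → ℕ) →
      ∑ (allFin t) (λ i → ∑ F7 λ a → f (cell gs (i , a))) ≡ ∑ (toLists (toList gs)) f
    ∑-cells gs f = begin
      ∑ (allFin _) (λ i → ∑ F7 λ a → f (lookup (lookup gs i) a))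
        ≡⟨ ∑-cong (allFin _) (λ i → ∑-toList (lookup gs i) f) ⟨
      ∑ (allFin _) (λ i → ∑ (toList (lookup gs i)) f)
        ≡⟨ ∑-lookup gs (λ g → ∑ (toList g) f) ⟩
      ∑ (toList gs) (λ g → ∑ (toList g) f)
        ≡⟨ ∑-concatMap toList (toList gs) f ⟨
      ∑ (toLists (toList gs)) f ∎
      where open ≡-Reasoning

    ∑∑∑ : List A → (A → A → A → ℕ) → ℕ
    ∑∑∑ xs f = ∑ xs λ x → ∑ xs λ y → ∑ xs λ z → f x y z

    ∑∑∑-cells : ∀ {t} (gs : Vec (Vec A 7) t) (E : Ternary A) →
      ∑³ t (λ x y z → E (cell gs x) (cell gs y) (cell gs z))
         (edgeCount t (λ x y z → E (cell gs x) (cell gs y) (cell gs z)))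
      ≡ ∑∑∑ (toLists (toList gs)) (λ x y z → ⟦ E x y z ⟧)
    ∑∑∑-cells {t} gs E = begin
      (∑ ts′ λ i → ∑ ts′ λ j → ∑ ts′ λ k → ∑ F7 λ a → ∑ F7 λ b → ∑ F7 λ c → f i a j b k c)
        ≡⟨ ∑-cong ts′ (λ i → ∑-cong ts′ λ j → ∑-swap ts′ F7 _) ⟩
      (∑ ts′ λ i → ∑ ts′ λ j → ∑ F7 λ a → ∑ ts′ λ k → ∑ F7 λ b → ∑ F7 λ c → f i a j b k c)
        ≡⟨ ∑-cong ts′ (λ i → ∑-swap ts′ F7 _) ⟩
      (∑ ts′ λ i → ∑ F7 λ a → ∑ ts′ λ j → ∑ ts′ λ k → ∑ F7 λ b → ∑ F7 λ c → f i a j b k c)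
        ≡⟨ ∑-cong ts′ (λ i → ∑-cong F7 λ a → ∑-cong ts′ λ j → ∑-swap ts′ F7 _) ⟩
      (∑ ts′ λ i → ∑ F7 λ a → ∑ ts′ λ j → ∑ F7 λ b → ∑ ts′ λ k → ∑ F7 λ c → f i a j b k c)
        ≡⟨ ∑-cong ts′ (λ i → ∑-cong F7 λ a → ∑-cong ts′ λ j → ∑-cong F7 λ b →
             ∑-cells gs (λ z → ⟦ E (cell gs (i , a)) (cell gs (j , b)) z ⟧)) ⟩
      (∑ ts′ λ i → ∑ F7 λ a → ∑ ts′ λ j → ∑ F7 λ b → ∑ xs λ z → ⟦ E (cell gs (i , a)) (cell gs (j , b)) z ⟧)
        ≡⟨ ∑-cong ts′ (λ i → ∑-cong F7 λ a → ∑-cells gs (λ y → ∑ xs λ z → ⟦ E (cell gs (i , a)) y z ⟧)) ⟩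
      (∑ ts′ λ i → ∑ F7 λ a → ∑ xs λ y → ∑ xs λ z → ⟦ E (cell gs (i , a)) y z ⟧)
        ≡⟨ ∑-cells gs (λ x → ∑ xs λ y → ∑ xs λ z → ⟦ E x y z ⟧) ⟩
      ∑∑∑ xs (λ x y z → ⟦ E x y z ⟧) ∎
      where
      open ≡-Reasoning
      ts′ = allFin t
      xs = toLists (toList gs)
      f : Fin t → Fin 7 → Fin t → Fin 7 → Fin t → Fin 7 → ℕ
      f i a j b k c = ⟦ E (cell gs (i , a)) (cell gs (j , b)) (cell gs (k , c)) ⟧

    -- Missing triples are counted rather than edges because their number does not increase when
    -- spare vertices are discarded and does not change when universal vertices are added.
    nonEdges : List A → Ternary A → ℕ
    nonEdges xs E = ∑∑∑ xs λ x y z → ⟦ not (E x y z) ⟧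

    edges+nonEdges : ∀ xs (E : Ternary A) →
      ∑∑∑ xs (λ x y z → ⟦ E x y z ⟧) + nonEdges xs E ≡ length xs * (length xs * length xs)
    edges+nonEdges xs E = begin
      ∑∑∑ xs (λ x y z → ⟦ E x y z ⟧) + nonEdges xs E
        ≡⟨ trans (∑-cong xs λ x → trans (∑-cong xs λ y → ∑-+ xs (λ z → ⟦ E x y z ⟧) (λ z → ⟦ not (E x y z) ⟧)) (∑-+ xs _ _)) (∑-+ xs _ _) ⟨
      (∑ xs λ x → ∑ xs λ y → ∑ xs λ z → ⟦ E x y z ⟧ + ⟦ not (E x y z) ⟧)
        ≡⟨ ∑-cong xs (λ x → ∑-cong xs λ y → trans (∑-cong xs λ z → complement (E x y z)) (trans (∑-const xs 1) (*-identityʳ _))) ⟩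
      (∑ xs λ x → ∑ xs λ y → length xs)
        ≡⟨ trans (∑-cong xs λ x → ∑-const xs (length xs)) (∑-const xs _) ⟩
      length xs * (length xs * length xs) ∎
      where
      open ≡-Reasoning
      complement : ∀ b → ⟦ b ⟧ + ⟦ not b ⟧ ≡ 1
      complement true  = refl
      complement false = refl

    ∑-++ˡ-≤ : ∀ xs ys (f : A → ℕ) → ∑ xs f ≤ ∑ (xs ++ ys) f
    ∑-++ˡ-≤ xs ys f = ≤-trans (m≤m+n _ _) (≤-reflexive (sym (∑-++ xs ys f)))

    nonEdges-++ : ∀ xs ys E → nonEdges xs E ≤ nonEdges (xs ++ ys) E
    nonEdges-++ xs ys E = ≤-trans (∑-mono xs λ x → ≤-trans (∑-mono xs λ y → ∑-++ˡ-≤ xs ys _) (∑-++ˡ-≤ xs ys _)) (∑-++ˡ-≤ xs ys _)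

    nonEdges-↭ : ∀ {xs ys} E → xs ↭ ys → nonEdges xs E ≡ nonEdges ys E
    nonEdges-↭ {xs} E p = trans (∑-cong xs λ x → trans (∑-cong xs λ y → ∑-↭ _ p) (∑-↭ _ p)) (∑-↭ _ p)

  -- Adding d vertices that are adjacent to everything.
  module _ {n : ℕ} (E : Ternary (Fin n)) (d : ℕ) where

    Extended : Set
    Extended = Fin n ⊎ Fin d

    extendE : Ternary Extended
    extendE (inj₁ a) (inj₁ b) (inj₁ c) = E a b c
    extendE (inj₁ _) (inj₁ _) (inj₂ _) = true
    extendE (inj₁ _) (inj₂ _) _        = true
    extendE (inj₂ _) _        _        = true

    extended-swap₁₂ : (∀ {x y z} → E x y z ≡ true → E y x z ≡ true) →
      ∀ {x y z} → extendE x y z ≡ true → extendE y x z ≡ true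
    extended-swap₁₂ swap {inj₁ _} {inj₁ _} {inj₁ _} e = swap e
    extended-swap₁₂ swap {inj₁ _} {inj₁ _} {inj₂ _} e = refl
    extended-swap₁₂ swap {inj₁ _} {inj₂ _} e = refl
    extended-swap₁₂ swap {inj₂ _} {inj₁ _} e = refl
    extended-swap₁₂ swap {inj₂ _} {inj₂ _} e = refl

    extended-swap₂₃ : (∀ {x y z} → E x y z ≡ true → E x z y ≡ true) →
      ∀ {x y z} → extendE x y z ≡ true → extendE x z y ≡ true
    extended-swap₂₃ swap {inj₁ _} {inj₁ _} {inj₁ _} e = swap e
    extended-swap₂₃ swap {inj₁ _} {inj₁ _} {inj₂ _} e = refl
    extended-swap₂₃ swap {inj₁ _} {inj₂ _} {inj₁ _} e = refl
    extended-swap₂₃ swap {inj₁ _} {inj₂ _} {inj₂ _} e = refl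
    extended-swap₂₃ swap {inj₂ _} e = refl

    everything : List Extended
    everything = map inj₁ (allFin n) ++ map inj₂ (allFin d)

    ∑-everything : ∀ (f : Extended → ℕ) → (∀ i → f (inj₂ i) ≡ 0) → ∑ everything f ≡ ∑ (allFin n) (f ∘ inj₁)
    ∑-everything f zero₂ = begin
      ∑ everything f                                               ≡⟨ ∑-++ (map inj₁ (allFin n)) _ f ⟩
      ∑ (map inj₁ (allFin n)) f + ∑ (map inj₂ (allFin d)) f        ≡⟨ cong₂ _+_ (∑-map inj₁ (allFin n) f) (∑-map inj₂ (allFin d) f) ⟩
      ∑ (allFin n) (f ∘ inj₁) + ∑ (allFin d) (f ∘ inj₂)            ≡⟨ cong (∑ (allFin n) (f ∘ inj₁) +_)
                                                                        (trans (∑-cong (allFin d) zero₂) (∑-zero (allFin d))) ⟩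
      ∑ (allFin n) (f ∘ inj₁) + 0                                  ≡⟨ +-identityʳ _ ⟩
      ∑ (allFin n) (f ∘ inj₁)                                      ∎
      where open ≡-Reasoning

    nonEdges-extended : nonEdges everything extendE ≡ nonEdges (allFin n) E
    nonEdges-extended = trans
      (∑-everything _ λ i → trans (∑-cong everything λ y → ∑-zero everything) (∑-zero everything))
      (∑-cong (allFin n) λ a → trans
        (∑-everything _ λ i → ∑-zero everything)
        (∑-cong (allFin n) λ b → ∑-everything _ λ i → refl))

    -- Every copy that meets added vertices is represented by one of them. Disjointness makes these
    -- representatives distinct, so there are at most `d` such copies.
    record Restriction (T : List (Vec Extended 4)) : Set where
      field
        kept     : List (Vec (Fin n) 4)
        dummies  : List (Fin d)
        total    : length T ≡ length kept + length dummies
        kept∈    : ∀ {v} → v ∈ flat kept → inj₁ v ∈ flat T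
        dummies∈ : ∀ {i} → i ∈ dummies → inj₂ i ∈ flat T
        keptU    : Unique (flat kept)
        dummiesU : Unique dummies
        keptY    : All (IsY E) kept

    split : ∀ {k} (q : Vec Extended k) → (∃ λ p → q ≡ Vec.map inj₁ p) ⊎ (∃ λ i → inj₂ i ∈ toList q)
    split []           = inj₁ ([] , refl)
    split (inj₂ i ∷ q) = inj₂ (i , here refl)
    split (inj₁ v ∷ q) with split q
    ... | inj₁ (p , refl) = inj₁ (v ∷ p , refl)
    ... | inj₂ (i , i∈)   = inj₂ (i , there i∈)

    restrict : ∀ T → Unique (flat T) → All (IsY extendE) T → Restriction T
    restrict [] _ _ = record
      { kept = [] ; dummies = [] ; total = refl ; kept∈ = λ () ; dummies∈ = λ () ; keptU = [] ; dummiesU = [] ; keptY = [] }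
    restrict (q ∷ T) u (y ∷ ys) with split q | restrict T (Unique-++ʳ (toList q) u) ys
    ... | inj₂ (i , i∈) | R = record
      { kept = R.kept ; dummies = i ∷ R.dummies ; total = trans (cong suc R.total) (sym (+-suc _ _))
      ; kept∈ = λ v∈ → ∈-++⁺ʳ (toList q) (R.kept∈ v∈)
      ; dummies∈ = λ { (here refl) → ∈-++⁺ˡ i∈ ; (there j) → ∈-++⁺ʳ (toList q) (R.dummies∈ j) }
      ; keptU = R.keptU
      ; dummiesU = All.tabulate (λ { j refl → unique-++-disjoint (toList q) u i∈ (R.dummies∈ j) }) ∷ R.dummiesU
      ; keptY = R.keptY }
      where module R = Restriction R
    ... | inj₁ (p , refl) | R = record
      { kept = p ∷ R.kept ; dummies = R.dummies ; total = cong suc R.total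
      ; kept∈ = λ v∈ → mapped (∈-++⁻ (toList p) v∈)
      ; dummies∈ = λ i∈ → ∈-++⁺ʳ (toList (Vec.map inj₁ p)) (R.dummies∈ i∈)
      ; keptU = Unique.++⁺ (Unique.map⁻ {f = inj₁} (subst Unique (Vec.toList-map inj₁ p) (Unique-++ˡ (toList (Vec.map inj₁ p)) u))) R.keptU
          (λ (v∈p , v∈) → unique-++-disjoint (toList (Vec.map inj₁ p)) u (inside v∈p) (R.kept∈ v∈))
      ; dummiesU = R.dummiesU
      ; keptY = restricted p y ∷ R.keptY }
      where
      module R = Restriction R
      inside : ∀ {v} → v ∈ toList p → inj₁ v ∈ toList (Vec.map inj₁ p)
      inside v∈ = subst (_ ∈_) (sym (Vec.toList-map inj₁ p)) (∈-map⁺ inj₁ v∈)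
      mapped : ∀ {v} → v ∈ toList p ⊎ v ∈ flat R.kept → inj₁ v ∈ toList (Vec.map inj₁ p) ++ flat T
      mapped (inj₁ v∈) = ∈-++⁺ˡ (inside v∈)
      mapped (inj₂ v∈) = ∈-++⁺ʳ (toList (Vec.map inj₁ p)) (R.kept∈ v∈)
      restricted : ∀ p → IsY extendE (Vec.map inj₁ p) → IsY E p
      restricted (_ ∷ _ ∷ _ ∷ _ ∷ []) y = y

    kept-length : ∀ {T} (R : Restriction T) → length T ≤ length (Restriction.kept R) + d
    kept-length R = ≤-trans (≤-reflexive R.total) (+-monoʳ-≤ (length R.kept)
      (≤-trans (unique-⊆⇒≤ R.dummiesU (λ {i} _ → ∈-allFin i)) (≤-reflexive (length-tabulate (λ i → i)))))
      where module R = Restriction R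

  heads⇒tile : ∀ {V : Set} (E : Ternary V) {t} (gs : Vec (Vec V 7) t) →
    (∀ i → IsY E (Vec.take 4 (lookup gs i))) →
    ∀ i → IsY (λ x y z → E (cell gs x) (cell gs y) (cell gs z)) (tileOf i)
  heads⇒tile E gs y i with lookup gs i | y i
  ... | _ ∷ _ ∷ _ ∷ _ ∷ _ ∷ _ ∷ _ ∷ [] | yᵢ = yᵢ

  length-flat : ∀ {V : Set} (qs : List (Vec V 4)) → length (flat qs) ≡ 4 * length qs
  length-flat []       = refl
  length-flat (q ∷ qs) = trans (length-++ (toList q))
    (trans (cong₂ _+_ (Vec.length-toList q) (length-flat qs)) (sym (*-suc 4 (length qs))))

  module _ {V : Set} where

    toLists-length : ∀ {k} (gs : List (Vec V k)) → length (toLists gs) ≡ k * length gs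
    toLists-length {k} []       = sym (*-zeroʳ k)
    toLists-length {k} (g ∷ gs) = trans (length-++ (toList g))
      (trans (cong₂ _+_ (Vec.length-toList g) (toLists-length gs)) (sym (*-suc k (length gs))))

    toLists-singletons : ∀ {B : Set} (f : B → V) xs → toLists (map (λ x → f x ∷ []) xs) ≡ map f xs
    toLists-singletons f []       = refl
    toLists-singletons f (x ∷ xs) = cong (f x ∷_) (toLists-singletons f xs)

  record Grouping {n} (E : Ternary (Fin n)) (s d : ℕ) : Set where
    field
      cells   : List (Vec (Extended E d) 7)
      spare   : List (Extended E d)
      count   : length cells ≡ s + d
      allOf   : everything E d ↭ toLists cells ++ spare
      headsY  : All (λ g → IsY (extendE E d) (Vec.take 4 g)) cells

  -- Two rounds: the tiles take three uncovered vertices each, then the added vertices take six each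
  -- from what is left.
  grouping : ∀ {n} (E : Ternary (Fin n)) (qs : List (Vec (Fin n) 4)) d → Unique (flat qs) → All (IsY E) qs →
    7 * length qs + 6 * d ≤ n → Grouping E (length qs) d
  grouping {n} E qs d u ys room = record
    { cells = groups D₁ ++ groups D₂
    ; spare = unused D₂
    ; count = trans (length-++ (groups D₁)) (cong₂ _+_
        (trans (length≡ D₁) (length-map _ qs))
        (trans (length≡ D₂) heads₂-length))
    ; allOf = begin
        map inj₁ (allFin n) ++ dummies
          ↭⟨ ++⁺ʳ dummies (map⁺ inj₁ (proj₂ outside)) ⟩
        map inj₁ (flat qs ++ W) ++ dummies
          ≡⟨ cong (_++ dummies) (trans (map-++ inj₁ (flat qs) W) (cong (_++ map inj₁ W) (sym (flat-map inj₁ qs)))) ⟩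
        (toLists heads₁ ++ map inj₁ W) ++ dummies
          ↭⟨ ++⁺ʳ dummies (permutes D₁) ⟩
        (toLists (groups D₁) ++ unused D₁) ++ dummies
          ≡⟨ ++-assoc (toLists (groups D₁)) (unused D₁) dummies ⟩
        toLists (groups D₁) ++ (unused D₁ ++ dummies)
          ↭⟨ ++⁺ˡ (toLists (groups D₁)) (++-comm (unused D₁) dummies) ⟩
        toLists (groups D₁) ++ (dummies ++ unused D₁)
          ≡⟨ cong (λ u → toLists (groups D₁) ++ (u ++ unused D₁)) (toLists-singletons inj₂ (allFin d)) ⟨
        toLists (groups D₁) ++ (toLists heads₂ ++ unused D₁)
          ↭⟨ ++⁺ˡ (toLists (groups D₁)) (permutes D₂) ⟩
        toLists (groups D₁) ++ (toLists (groups D₂) ++ unused D₂)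
          ≡⟨ ++-assoc (toLists (groups D₁)) (toLists (groups D₂)) (unused D₂) ⟨
        (toLists (groups D₁) ++ toLists (groups D₂)) ++ unused D₂
          ≡⟨ cong (_++ unused D₂) (concatMap-++ toList (groups D₁) (groups D₂)) ⟨
        toLists (groups D₁ ++ groups D₂) ++ unused D₂ ∎
    ; headsY = All.++⁺ (All.map headY₁ (extended D₁)) (All.map headY₂ (extended D₂)) }
    where
    open PermutationReasoning
    outside : ∃ λ W → allFin n ↭ flat qs ++ W
    outside = extract u (λ {v} _ → ∈-allFin v)
    W = proj₁ outside
    dummies : List (Extended E d)
    dummies = map inj₂ (allFin d)
    heads₁ : List (Vec (Extended E d) 4)
    heads₁ = map (Vec.map inj₁) qs
    heads₂ : List (Vec (Extended E d) 1)
    heads₂ = map (λ i → inj₂ i ∷ []) (allFin d)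
    heads₂-length : length heads₂ ≡ d
    heads₂-length = trans (length-map (λ i → inj₂ i ∷ []) (allFin d)) (length-tabulate {n = d} (λ i → i))

    n≡ : n ≡ 4 * length qs + length W
    n≡ = trans (sym (length-tabulate (λ i → i))) (trans (↭-length (proj₂ outside)) (trans (length-++ (flat qs)) (cong (_+ length W) (length-flat qs))))
    pool≥ : 3 * length qs + 6 * d ≤ length W
    pool≥ = +-cancelˡ-≤ (4 * length qs) _ _ (≤-trans (≤-reflexive (regroup (length qs) d)) (≤-trans room (≤-reflexive n≡)))
      where
      regroup : ∀ s d → 4 * s + (3 * s + 6 * d) ≡ 7 * s + 6 * d
      regroup = solve-∀
    D₁ : Distribution 4 3 heads₁ (map inj₁ W)
    D₁ = distribute 4 3 heads₁ (map inj₁ W) (≤-trans (≤-reflexive (cong (3 *_) (length-map _ qs)))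
      (≤-trans (m≤m+n _ (6 * d)) (≤-trans pool≥ (≤-reflexive (sym (length-map inj₁ W))))))
    D₂ : Distribution 1 6 heads₂ (unused D₁)
    D₂ = distribute 1 6 heads₂ (unused D₁) (≤-trans (≤-reflexive (cong (6 *_) heads₂-length))
      (+-cancelˡ-≤ (3 * length qs) _ _ (≤-trans pool≥ (≤-reflexive (trans (sym (length-map inj₁ W))
        (trans (unused≡ D₁) (cong (λ m → 3 * m + length (unused D₁)) (length-map (Vec.map inj₁) qs))))))))

    headY₁ : ∀ {g} → (∃₂ λ h w → h ∈ heads₁ × g ≡ h Vec.++ w) → IsY (extendE E d) (Vec.take 4 g)
    headY₁ (h , w , h∈ , refl) with ∈-map⁻ (Vec.map inj₁) h∈
    ... | q ∷ q′ ∷ x ∷ y ∷ [] , q∈ , refl = All.lookup ys q∈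
    -- The added vertex comes first in its group, hence lies in both edges of the tile it starts.
    headY₂ : ∀ {g} → (∃₂ λ h w → h ∈ heads₂ × g ≡ h Vec.++ w) → IsY (extendE E d) (Vec.take 4 g)
    headY₂ (h , _ ∷ _ ∷ _ ∷ _ ∷ _ ∷ _ ∷ [] , h∈ , refl) with ∈-map⁻ (λ i → inj₂ i ∷ []) h∈
    ... | i , _ , refl = refl , refl

  everything-unique : ∀ {n} (E : Ternary (Fin n)) d → Unique (everything E d)
  everything-unique {n} E d = Unique.++⁺ (Unique.map⁺ inj₁-injective (Unique.allFin⁺ n)) (Unique.map⁺ inj₂-injective (Unique.allFin⁺ d))
    λ (i , j) → clash (∈-map⁻ inj₁ i) (∈-map⁻ inj₂ j)
    where
    clash : ∀ {v : Fin n ⊎ Fin d} → (∃ λ a → a ∈ allFin n × v ≡ inj₁ a) → (∃ λ b → b ∈ allFin d × v ≡ inj₂ b) → Data.Empty.⊥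
    clash (_ , _ , refl) (_ , _ , ())

  -- The sum of the coefficients of the lower-order terms of `(a t + q)³`, once each power of `t` in
  -- them is bounded by `t²`.
  slack : ℕ → ℕ → ℕ
  slack a q = 3 * (a * a) * q + 3 * a * (q * q) + q * (q * q)

  cube≤ : ∀ a q t r → 1 ≤ t → r ≤ q →
    (a * t + r) * ((a * t + r) * (a * t + r)) ≤ a * (a * a) * (t * (t * t)) + slack a q * (t * t)
  cube≤ a q t r 1≤t r≤q = begin
    (a * t + r) * ((a * t + r) * (a * t + r))
      ≤⟨ *-mono-≤ m (*-mono-≤ m m) ⟩
    (a * t + q) * ((a * t + q) * (a * t + q))
      ≡⟨ expand a t q ⟩
    a * (a * a) * (t * (t * t)) + (3 * (a * a) * q * (t * t) + 3 * a * (q * q) * t + q * (q * q))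
      ≤⟨ +-monoʳ-≤ (a * (a * a) * (t * (t * t))) (+-mono-≤
           (+-monoʳ-≤ (3 * (a * a) * q * (t * t)) (*-monoʳ-≤ (3 * a * (q * q)) t≤t²))
           (≤-trans (≤-reflexive (sym (*-identityʳ (q * (q * q))))) (*-monoʳ-≤ (q * (q * q)) (≤-trans 1≤t t≤t²)))) ⟩
    a * (a * a) * (t * (t * t)) + (3 * (a * a) * q * (t * t) + 3 * a * (q * q) * (t * t) + q * (q * q) * (t * t))
      ≡⟨ cong (a * (a * a) * (t * (t * t)) +_) (collect (3 * (a * a) * q) (3 * a * (q * q)) (q * (q * q)) (t * t)) ⟩
    a * (a * a) * (t * (t * t)) + slack a q * (t * t) ∎
    where
    open ≤-Reasoning
    m = +-monoʳ-≤ (a * t) r≤q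
    t≤t² : t ≤ t * t
    t≤t² = m≤m*n t t {{>-nonZero 1≤t}}
    expand : ∀ a t q → (a * t + q) * ((a * t + q) * (a * t + q))
      ≡ a * (a * a) * (t * (t * t)) + (3 * (a * a) * q * (t * t) + 3 * a * (q * q) * t + q * (q * q))
    expand = solve-∀
    collect : ∀ x y z w → x * w + y * w + z * w ≡ (x + y + z) * w
    collect = solve-∀

  -- The numerals 6, 7, 127 = 7³ - 6³ and 5 enter as the variables a, b, u and q.
  density-arithmetic : ∀ a b u q → b * (b * b) ≡ u + a * (a * a) → ∀ c n m t r S non non′ →
    1 ≤ t → t ≤ n → r ≤ q → m ≡ a * t + r → S + non′ ≡ b * t * (b * t * (b * t)) → non′ ≤ non →
    c * non + n * (n * n) ≤ c * (m * (m * m)) →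
    t * (t * t) + c * (u * (t * (t * t))) ≤ c * S + c * slack a q * (t * t)
  density-arithmetic a b u q cubes c n m t r S non non′ 1≤t t≤n r≤q refl S+non′ non′≤ sparse =
    +-cancelʳ-≤ (c * (a * (a * a) * t³)) _ _ (begin
      t³ + c * (u * t³) + c * (a * (a * a) * t³)
        ≡⟨ factor t³ c u (a * (a * a)) ⟩
      c * ((u + a * (a * a)) * t³) + t³
        ≡⟨ cong (λ v → c * (v * t³) + t³) cubes ⟨
      c * (b * (b * b) * t³) + t³
        ≡⟨ cong (λ v → c * v + t³) (trans (distribute-cube b t) (sym S+non′)) ⟩
      c * (S + non′) + t³
        ≤⟨ +-mono-≤ (*-monoʳ-≤ c (+-monoʳ-≤ S non′≤)) (*-mono-≤ t≤n (*-mono-≤ t≤n t≤n)) ⟩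
      c * (S + non) + n * (n * n)
        ≡⟨ trans (cong (_+ n * (n * n)) (*-distribˡ-+ c S non)) (+-assoc (c * S) (c * non) _) ⟩
      c * S + (c * non + n * (n * n))
        ≤⟨ +-monoʳ-≤ (c * S) (≤-trans sparse (*-monoʳ-≤ c (cube≤ a q t r 1≤t r≤q))) ⟩
      c * S + c * (a * (a * a) * t³ + slack a q * (t * t))
        ≡⟨ regroup (c * S) c (a * (a * a) * t³) (slack a q) (t * t) ⟩
      c * S + c * slack a q * (t * t) + c * (a * (a * a) * t³) ∎)
    where
    open ≤-Reasoning
    t³ = t * (t * t)
    factor : ∀ w c u v → w + c * (u * w) + c * (v * w) ≡ c * ((u + v) * w) + w
    factor = solve-∀
    distribute-cube : ∀ b t → b * (b * b) * (t * (t * t)) ≡ b * t * (b * t * (b * t))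
    distribute-cube = solve-∀
    regroup : ∀ x c y z w → x + c * (y + z * w) ≡ x + c * z * w + c * y
    regroup = solve-∀

  opaque
    unfolding sparse

    cubes-6-7 : 7 * (7 * 7) ≡ sparse + 6 * (6 * 6)
    cubes-6-7 = refl

  opaque
    -- The vertices form `t` groups with `n ≤ 7 * t + 5`, so a large `n` brings `t` up to the
    -- threshold of `core`.
    improveThreshold : ℕ → ℕ
    improveThreshold c = 7 * coreThreshold c (c * slack 6 5) + 6

    improveThreshold≡ : ∀ c → improveThreshold c ≡ 7 * coreThreshold c (c * slack 6 5) + 6
    improveThreshold≡ c = refl

  module _ {n} (E : Ternary (Fin n))
    (swap₁₂ : ∀ {x y z} → E x y z ≡ true → E y x z ≡ true)
    (swap₂₃ : ∀ {x y z} → E x y z ≡ true → E x z y ≡ true) where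

    Tiles : List (Vec (Fin n) 4) → Set
    Tiles qs = Unique (flat qs) × All (IsY E) qs

    -- The hypothesis says that at most `(n - s)³ - n³ / c` ordered triples are missing. As
    -- `n - s = 6 t + r`, on average a triple of groups misses fewer than 6³ of its 7³ triples by a
    -- fixed amount, up to `O(t²)` in total, which is the density that `core` requires.
    improve-grouping : ∀ c {s d r} → 0 < c → improveThreshold c ≤ n → n ≡ 7 * s + 6 * d + r → r ≤ 5 →
      c * nonEdges (allFin n) E + n * (n * n) ≤ c * ((n ∸ s) * ((n ∸ s) * (n ∸ s))) →
      Grouping E s d → ∃ λ qs → s < length qs × Tiles qs
    improve-grouping c {s} {d} {r} 0<c large n≡ r≤5 sparse-complement G =
      finish (core t F swapF₁₂ swapF₂₃ tiles c (c * slack 6 5) 0<c thr≤t dense)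
      where
      open Grouping G
      gs : Vec (Vec (Extended E d) 7) (length cells)
      gs = Vec.fromList cells
      t = length cells
      F : Ternary (Fin t × Fin 7)
      F x y z = extendE E d (cell gs x) (cell gs y) (cell gs z)

      swapF₁₂ : ∀ {x y z} → F x y z ≡ true → F y x z ≡ true
      swapF₁₂ {x} {y} {z} = extended-swap₁₂ E d swap₁₂ {cell gs x} {cell gs y} {cell gs z}
      swapF₂₃ : ∀ {x y z} → F x y z ≡ true → F x z y ≡ true
      swapF₂₃ {x} {y} {z} = extended-swap₂₃ E d swap₂₃ {cell gs x} {cell gs y} {cell gs z}

      toList-gs : toList gs ≡ cells
      toList-gs = Vec.toList∘fromList cells

      tiles : ∀ i → IsY F (tileOf i)
      tiles = heads⇒tile (extendE E d) gs (λ i → All.lookup headsY (subst (lookup gs i ∈_) toList-gs (lookup∈ gs i)))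

      cells-unique : Unique (toLists (toList gs))
      cells-unique = subst (λ v → Unique (toLists v)) (sym toList-gs)
        (Unique-++ˡ (toLists cells) (Unique-resp-↭ allOf (everything-unique E d)))

      n≤7t+5 : n ≤ 7 * t + 5
      n≤7t+5 = begin
        n                     ≡⟨ n≡ ⟩
        7 * s + 6 * d + r     ≤⟨ +-mono-≤ (+-monoʳ-≤ (7 * s) (*-monoˡ-≤ d (n≤1+n 6))) r≤5 ⟩
        7 * s + 7 * d + 5     ≡⟨ cong (_+ 5) (trans (sym (*-distribˡ-+ 7 s d)) (cong (7 *_) (sym count))) ⟩
        7 * t + 5             ∎
        where open ≤-Reasoning

      thr≤t : coreThreshold c (c * slack 6 5) ≤ t
      thr≤t = *-cancelˡ-≤ 7 (+-cancelʳ-≤ 6 _ _ (≤-trans (subst (_≤ n) (improveThreshold≡ c) large) (≤-trans n≤7t+5 (+-monoʳ-≤ (7 * t) (n≤1+n 5)))))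

      dense : t * (t * t) + c * (sparse * (t * (t * t))) ≤ c * ∑³ t F (edgeCount t F) + c * slack 6 5 * (t * t)
      dense = density-arithmetic 6 7 sparse 5 cubes-6-7 c n (n ∸ s) t r _ (nonEdges (allFin n) E) (nonEdges (toLists (toList gs)) (extendE E d))
        (≤-trans (s≤s z≤n) thr≤t) t≤n r≤5 n∸s≡
        (trans (cong (_+ nonEdges (toLists (toList gs)) (extendE E d)) (∑∑∑-cells gs (extendE E d)))
          (trans (edges+nonEdges (toLists (toList gs)) (extendE E d)) (cong (λ m → m * (m * m)) (trans (toLists-length (toList gs)) (cong (7 *_) (Vec.length-toList gs))))))
        (≤-trans (nonEdges-++ (toLists (toList gs)) spare (extendE E d))
          (≤-reflexive (trans (trans (cong (λ v → nonEdges (toLists v ++ spare) (extendE E d)) toList-gs)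
            (sym (nonEdges-↭ (extendE E d) allOf))) (nonEdges-extended E d))))
        sparse-complement
        where
        t≤n : t ≤ n
        t≤n = begin
          t                   ≡⟨ count ⟩
          s + d               ≤⟨ +-mono-≤ (m≤n*m s 7) (m≤n*m d 6) ⟩
          7 * s + 6 * d       ≤⟨ m≤m+n _ r ⟩
          7 * s + 6 * d + r   ≡⟨ n≡ ⟨
          n                   ∎
          where open ≤-Reasoning
        n∸s≡ : n ∸ s ≡ 6 * t + r
        n∸s≡ = trans (cong (_∸ s) (trans n≡ (trans (regroup s d r) (cong (λ m → s + (6 * m + r)) (sym count))))) (m+n∸m≡n s _)
          where
          regroup : ∀ s d r → 7 * s + 6 * d + r ≡ s + (6 * (s + d) + r)
          regroup = solve-∀

      finish : Larger t F swapF₁₂ swapF₂₃ tiles → ∃ λ qs → s < length qs × Tiles qs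
      finish (T , longer , u , ys) = Restriction.kept R , +-cancelʳ-< d _ _ (begin-strict
          s + d                              ≡⟨ count ⟨
          t                                  <⟨ longer ⟩
          length T                           ≡⟨ length-map _ T ⟨
          length T′                          ≤⟨ kept-length E d R ⟩
          length (Restriction.kept R) + d    ∎)
        , Restriction.keptU R , Restriction.keptY R
        where
        open ≤-Reasoning
        T′ : List (Vec (Extended E d) 4)
        T′ = map (Vec.map (cell gs)) T
        placed : ∀ {q} → IsY F q → IsY (extendE E d) (Vec.map (cell gs) q)
        placed {_ ∷ _ ∷ _ ∷ _ ∷ []} y = y
        R : Restriction E d T′
        R = restrict E d T′
          (subst Unique (sym (flat-map (cell gs) T)) (unique-map (cell gs) (λ _ _ → cell-injective gs cells-unique) u))
          (All.map⁺ (All.map placed ys))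

    improve : ∀ c → 0 < c → improveThreshold c ≤ n → ∀ qs → Tiles qs → 7 * length qs ≤ n →
      c * nonEdges (allFin n) E + n * (n * n) ≤ c * ((n ∸ length qs) * ((n ∸ length qs) * (n ∸ length qs))) →
      ∃ λ qs′ → length qs < length qs′ × Tiles qs′
    improve c 0<c large qs (u , ys) 7s≤n sparse-complement =
      improve-grouping c {length qs} {d} {r} 0<c large n≡ (≤-pred (m%n<n (n ∸ 7 * length qs) 6)) sparse-complement
        (grouping E qs d u ys (≤-trans (m≤m+n _ r) (≤-reflexive (sym n≡))))
      where
      d = (n ∸ 7 * length qs) / 6
      r = (n ∸ 7 * length qs) % 6
      n≡ : n ≡ 7 * length qs + 6 * d + r
      n≡ = begin
        n                                            ≡⟨ m+[n∸m]≡n 7s≤n ⟨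
        7 * length qs + (n ∸ 7 * length qs)          ≡⟨ cong (7 * length qs +_) (m≡m%n+[m/n]*n (n ∸ 7 * length qs) 6) ⟩
        7 * length qs + (r + d * 6)                  ≡⟨ regroup (7 * length qs) r d ⟩
        7 * length qs + 6 * d + r                    ∎
        where
        open ≡-Reasoning
        regroup : ∀ x r d → x + (r + d * 6) ≡ x + 6 * d + r
        regroup = solve-∀

-- Translation between 3-graphs and symmetric ternary relations.

module Graphs where

  open Prelude
  import Data.Bool.Properties as Bool
  import Data.Fin.Properties as Fin
  open import Data.Fin.Subset using (Subset; inside; outside; ⁅_⁆; _∪_; ∣_∣; ⊤) renaming (_∈_ to _∈ˢ_)
  open import Data.Fin.Subset.Properties using (∪-comm; ∪-assoc; ⊆-antisym; x∈p∪q⁺; x∈p∪q⁻; x∈p∩q⁻; x∈⁅x⁆; x∈⁅y⁆⇒x≡y; ∈⊤) renaming (_∈?_ to _∈ˢ?_)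
  open import Data.List.Membership.DecPropositional using (_∈?_)
  import Data.List.Relation.Unary.All as All
  import Data.List.Relation.Unary.Unique.Propositional.Properties as Unique
  open import Data.Sum using ([_,_]′)
  open import Data.Vec as Vec using (lookup; toList; here; there)
  import Data.Vec.Properties as Vec
  open import Defs using (3-Graph; edges; unique; uniform; e; image; Copy; embed; vertices; Tiling; copies; covered; Y₃₂)
  open Sums
  open Augment
  open Groups using (nonEdges; ∑∑∑; edges+nonEdges; lookup∈; lookup-injective; length-flat; Unique-++ʳ; unique-++-disjoint; ∑-++ˡ-≤)
  open Density using (∑-unique≤1; Unique-++ˡ)

  infix 4 _≟ˢ_
  _≟ˢ_ : ∀ {n} → DecidableEquality (Subset n)
  _≟ˢ_ = Vec.≡-dec Bool._≟_

  set₃ : ∀ {n} → Fin n → Fin n → Fin n → Subset n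
  set₃ a b c = ⁅ a ⁆ ∪ (⁅ b ⁆ ∪ ⁅ c ⁆)

  set₃-swap₂₃ : ∀ {n} (a b c : Fin n) → set₃ a b c ≡ set₃ a c b
  set₃-swap₂₃ a b c = cong (⁅ a ⁆ ∪_) (∪-comm ⁅ b ⁆ ⁅ c ⁆)

  set₃-swap₁₂ : ∀ {n} (a b c : Fin n) → set₃ a b c ≡ set₃ b a c
  set₃-swap₁₂ a b c = trans (sym (∪-assoc ⁅ a ⁆ ⁅ b ⁆ ⁅ c ⁆))
    (trans (cong (_∪ ⁅ c ⁆) (∪-comm ⁅ a ⁆ ⁅ b ⁆)) (∪-assoc ⁅ b ⁆ ⁅ a ⁆ ⁅ c ⁆))

  ∈-set₃⁻ : ∀ {n} {a b c w : Fin n} → w ∈ˢ set₃ a b c → w ∈ a ∷ b ∷ c ∷ []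
  ∈-set₃⁻ {a = a} {b} {c} i with x∈p∪q⁻ ⁅ a ⁆ _ i
  ... | inj₁ j = here (x∈⁅y⁆⇒x≡y a j)
  ... | inj₂ j with x∈p∪q⁻ ⁅ b ⁆ _ j
  ...   | inj₁ k = there (here (x∈⁅y⁆⇒x≡y b k))
  ...   | inj₂ k = there (there (here (x∈⁅y⁆⇒x≡y c k)))

  ∈-set₃⁺ : ∀ {n} {a b c w : Fin n} → w ∈ a ∷ b ∷ c ∷ [] → w ∈ˢ set₃ a b c
  ∈-set₃⁺ {a = a} (here refl)                 = x∈p∪q⁺ (inj₁ (x∈⁅x⁆ a))
  ∈-set₃⁺ {b = b} (there (here refl))         = x∈p∪q⁺ (inj₂ (x∈p∪q⁺ (inj₁ (x∈⁅x⁆ b))))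
  ∈-set₃⁺ {c = c} (there (there (here refl))) = x∈p∪q⁺ (inj₂ (x∈p∪q⁺ (inj₂ (x∈⁅x⁆ c))))

  elements : ∀ {n} → Subset n → List (Fin n)
  elements []            = []
  elements (inside ∷ S)  = zero ∷ map suc (elements S)
  elements (outside ∷ S) = map suc (elements S)

  length-elements : ∀ {n} (S : Subset n) → length (elements S) ≡ ∣ S ∣
  length-elements []            = refl
  length-elements (inside ∷ S)  = cong suc (trans (length-map suc (elements S)) (length-elements S))
  length-elements (outside ∷ S) = trans (length-map suc (elements S)) (length-elements S)

  ∈-elements⁺ : ∀ {n} {S : Subset n} {x} → x ∈ˢ S → x ∈ elements S
  ∈-elements⁺ here = here refl
  ∈-elements⁺ {S = inside ∷ S}  (there i) = there (∈-map⁺ suc (∈-elements⁺ i))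
  ∈-elements⁺ {S = outside ∷ S} (there i) = ∈-map⁺ suc (∈-elements⁺ i)

  ∈-elements⁻ : ∀ {n} (S : Subset n) {x} → x ∈ elements S → x ∈ˢ S
  ∈-elements⁻ (inside ∷ S) (here refl) = here
  ∈-elements⁻ (inside ∷ S) (there i) with ∈-map⁻ suc i
  ... | y , j , refl = there (∈-elements⁻ S j)
  ∈-elements⁻ (outside ∷ S) i with ∈-map⁻ suc i
  ... | y , j , refl = there (∈-elements⁻ S j)

  elements-unique : ∀ {n} (S : Subset n) → Unique (elements S)
  elements-unique []            = []
  elements-unique (inside ∷ S)  = All.tabulate (λ i eq → zero≢ (∈-map⁻ suc (subst (_∈ map suc (elements S)) (sym eq) i)))
    ∷ Unique.map⁺ Fin.suc-injective (elements-unique S)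
    where
    zero≢ : ∀ {A : Set} {m} {xs : List (Fin m)} → (∃ λ y → y ∈ xs × zero {m} ≡ suc y) → A
    zero≢ (_ , _ , ())
  elements-unique (outside ∷ S) = Unique.map⁺ Fin.suc-injective (elements-unique S)

  unique-⊆⇒≤∣∣ : ∀ {n} {xs} (S : Subset n) → Unique xs → (∀ {x} → x ∈ xs → x ∈ˢ S) → length xs ≤ ∣ S ∣
  unique-⊆⇒≤∣∣ S u sub = ≤-trans (unique-⊆⇒≤ u (λ i → ∈-elements⁺ (sub i))) (≤-reflexive (length-elements S))

  triple-of : ∀ {n} (S : Subset n) → ∣ S ∣ ≡ 3 →
    ∃ λ x → ∃₂ λ y z → Unique (x ∷ y ∷ z ∷ []) × set₃ x y z ≡ S
  triple-of S ∣S∣≡3 with elements S in eq | length-elements S | elements-unique S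
  ... | x ∷ y ∷ z ∷ []        | l | u = x , y , z , u , ⊆-antisym
          (λ i → ∈-elements⁻ S (subst (_ ∈_) (sym eq) (∈-set₃⁻ i)))
          (λ i → ∈-set₃⁺ (subst (_ ∈_) eq (∈-elements⁺ i)))
  ... | []                    | l | u with () ← trans l ∣S∣≡3
  ... | _ ∷ []                | l | u with () ← trans l ∣S∣≡3
  ... | _ ∷ _ ∷ []            | l | u with () ← trans l ∣S∣≡3
  ... | _ ∷ _ ∷ _ ∷ _ ∷ _     | l | u with () ← trans l ∣S∣≡3

  ∑-unique-⊆ : ∀ {A : Set} {xs ys : List A} → Unique xs → (∀ {x} → x ∈ xs → x ∈ ys) →
    ∀ (f : A → ℕ) → ∑ xs f ≤ ∑ ys f
  ∑-unique-⊆ {xs = xs} u sub f = let zs , p = extract u sub in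
    ≤-trans (∑-++ˡ-≤ xs zs f) (≤-reflexive (sym (∑-↭ f p)))

  module _ {n} (H : 3-Graph n) where

    edge? : ∀ a b c → Dec (set₃ a b c ∈ edges H)
    edge? a b c = _∈?_ _≟ˢ_ (set₃ a b c) (edges H)

    adjacent : Ternary (Fin n)
    adjacent a b c = does (edge? a b c)

    adjacent-swap₁₂ : ∀ {a b c} → adjacent a b c ≡ true → adjacent b a c ≡ true
    adjacent-swap₁₂ {a} {b} {c} p = trans (cong (λ S → does (_∈?_ _≟ˢ_ S (edges H))) (set₃-swap₁₂ b a c)) p

    adjacent-swap₂₃ : ∀ {a b c} → adjacent a b c ≡ true → adjacent a c b ≡ true
    adjacent-swap₂₃ {a} {b} {c} p = trans (cong (λ S → does (_∈?_ _≟ˢ_ S (edges H))) (set₃-swap₂₃ a c b)) p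

    hits : Subset n → Fin n → Fin n → Fin n → ℕ
    hits S a b c = ⟦ does (set₃ a b c ≟ˢ S) ⟧

    ∑-hits≤ : ∀ a b c → ∑ (edges H) (λ S → hits S a b c) ≤ ⟦ adjacent a b c ⟧
    ∑-hits≤ a b c = bound (edge? a b c)
      where
      bound : (d : Dec (set₃ a b c ∈ edges H)) → ∑ (edges H) (λ S → hits S a b c) ≤ ⟦ does d ⟧
      bound (yes _) = ∑-unique≤1 _≟ˢ_ (set₃ a b c) (unique H)
      bound (no ∉)  = ≤-trans (∑-mono∈ (edges H) λ S S∈ → ≤-reflexive (indicator-no (set₃ a b c ≟ˢ S)
        λ eq → ⊥-elim (∉ (subst (_∈ edges H) (sym eq) S∈)))) (≤-reflexive (∑-zero (edges H)))

    -- Each of the three vertices can come first, followed by the other two in either order.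
    six-orders : ∀ S → ∣ S ∣ ≡ 3 → 6 ≤ ∑∑∑ (allFin n) (hits S)
    six-orders S ∣S∣≡3 with triple-of S ∣S∣≡3
    ... | x , y , z , (x≢y ∷ x≢z ∷ []) ∷ (y≢z ∷ []) ∷ [] ∷ [] , eq = ≤-trans
      (+-mono-≤ (two x y z x≢y x≢z y≢z eq)
        (+-mono-≤ (two y x z (≢-sym x≢y) y≢z x≢z (trans (set₃-swap₁₂ y x z) eq))
          (+-monoˡ-≤ 0 (two z x y (≢-sym x≢z) (≢-sym y≢z) x≢y
            (trans (trans (set₃-swap₁₂ z x y) (set₃-swap₂₃ x z y)) eq)))))
      (∑-unique-⊆ {xs = x ∷ y ∷ z ∷ []} ((x≢y ∷ x≢z ∷ []) ∷ (y≢z ∷ []) ∷ [] ∷ []) (λ {v} _ → ∈-allFin v) _)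
      where
      one : ∀ a b c → set₃ a b c ≡ S → 1 ≤ ∑ (allFin n) (hits S a b)
      one a b c eq = ≤-trans (≤-reflexive (sym (cong ⟦_⟧ (does-yes (set₃ a b c ≟ˢ S) eq)))) (term≤∑ (hits S a b) (∈-allFin c))
      two : ∀ a b c → a ≢ b → a ≢ c → b ≢ c → set₃ a b c ≡ S →
        2 ≤ ∑ (allFin n) (λ b → ∑ (allFin n) (hits S a b))
      two a b c _ _ b≢c eq = ≤-trans
        (+-mono-≤ (one a b c eq) (+-monoˡ-≤ 0 (one a c b (trans (set₃-swap₂₃ a c b) eq))))
        (∑-unique-⊆ {xs = b ∷ c ∷ []} ((b≢c ∷ []) ∷ [] ∷ []) (λ {v} _ → ∈-allFin v) (λ b → ∑ (allFin n) (hits S a b)))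

    6e≤ : 6 * e H ≤ ∑∑∑ (allFin n) (λ a b c → ⟦ adjacent a b c ⟧)
    6e≤ = begin
      6 * e H
        ≡⟨ trans (*-comm 6 (e H)) (sym (∑-const (edges H) 6)) ⟩
      ∑ (edges H) (λ _ → 6)
        ≤⟨ ∑-mono∈ (edges H) (λ S S∈ → six-orders S (All.lookup (uniform H) S∈)) ⟩
      ∑ (edges H) (λ S → ∑∑∑ V (hits S))
        ≡⟨ ∑-swap (edges H) V (λ S a → ∑ V λ b → ∑ V λ c → hits S a b c) ⟩
      (∑ V λ a → ∑ (edges H) λ S → ∑ V λ b → ∑ V λ c → hits S a b c)
        ≡⟨ ∑-cong V (λ a → ∑-swap (edges H) V (λ S b → ∑ V λ c → hits S a b c)) ⟩
      (∑ V λ a → ∑ V λ b → ∑ (edges H) λ S → ∑ V λ c → hits S a b c)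
        ≡⟨ ∑-cong V (λ a → ∑-cong V λ b → ∑-swap (edges H) V (λ S c → hits S a b c)) ⟩
      (∑ V λ a → ∑ V λ b → ∑ V λ c → ∑ (edges H) λ S → hits S a b c)
        ≤⟨ ∑-mono V (λ a → ∑-mono V λ b → ∑-mono V λ c → ∑-hits≤ a b c) ⟩
      ∑∑∑ V (λ a b c → ⟦ adjacent a b c ⟧) ∎
      where
      open ≤-Reasoning
      V = allFin n

    6e+nonEdges≤n³ : 6 * e H + nonEdges (allFin n) adjacent ≤ n * (n * n)
    6e+nonEdges≤n³ = ≤-trans (+-monoˡ-≤ _ 6e≤) (≤-reflexive (trans (edges+nonEdges (allFin n) adjacent)
      (cong (λ m → m * (m * m)) (length-tabulate {n = n} (λ i → i)))))

    ∈-image⁻ : ∀ {m} (φ : Fin m → Fin n) S {w} → w ∈ˢ image φ S → ∃ λ i → i ∈ˢ S × φ i ≡ w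
    ∈-image⁻ φ S {w} i = yes-does (Fin.any? λ i → (i ∈ˢ? S) ×-dec (φ i Fin.≟ w))
      (trans (sym (Vec.lookup∘tabulate (λ v → does (Fin.any? λ i → (i ∈ˢ? S) ×-dec (φ i Fin.≟ v))) w)) (Vec.[]=⇒lookup i))

    ∈-image⁺ : ∀ {m} (φ : Fin m → Fin n) S {i} → i ∈ˢ S → φ i ∈ˢ image φ S
    ∈-image⁺ φ S {i} i∈ = Vec.lookup⇒[]= (φ i) _
      (trans (Vec.lookup∘tabulate (λ v → does (Fin.any? λ i → (i ∈ˢ? S) ×-dec (φ i Fin.≟ v))) (φ i))
        (does-yes (Fin.any? λ j → (j ∈ˢ? S) ×-dec (φ j Fin.≟ φ i)) (i , i∈ , refl)))

    image-edge₁ : ∀ (φ : Fin 4 → Fin n) → image φ (inside ∷ inside ∷ inside ∷ outside ∷ []) ≡ set₃ (φ 0F) (φ 1F) (φ 2F)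
    image-edge₁ φ = ⊆-antisym (λ w∈ → ∈-set₃⁺ (to (∈-image⁻ φ (inside ∷ inside ∷ inside ∷ outside ∷ []) w∈))) (λ w∈ → from (∈-set₃⁻ w∈))
      where
      to : ∀ {w} → (∃ λ i → i ∈ˢ (inside ∷ inside ∷ inside ∷ outside ∷ []) × φ i ≡ w) → w ∈ φ 0F ∷ φ 1F ∷ φ 2F ∷ []
      to (0F , _ , refl) = here refl
      to (1F , _ , refl) = there (here refl)
      to (2F , _ , refl) = there (there (here refl))
      to (3F , there (there (there ())) , _)
      from : ∀ {w} → w ∈ φ 0F ∷ φ 1F ∷ φ 2F ∷ [] → w ∈ˢ image φ (inside ∷ inside ∷ inside ∷ outside ∷ [])
      from (here refl)                 = ∈-image⁺ φ (inside ∷ inside ∷ inside ∷ outside ∷ []) {0F} here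
      from (there (here refl))         = ∈-image⁺ φ (inside ∷ inside ∷ inside ∷ outside ∷ []) {1F} (there here)
      from (there (there (here refl))) = ∈-image⁺ φ (inside ∷ inside ∷ inside ∷ outside ∷ []) {2F} (there (there here))

    image-edge₂ : ∀ (φ : Fin 4 → Fin n) → image φ (inside ∷ inside ∷ outside ∷ inside ∷ []) ≡ set₃ (φ 0F) (φ 1F) (φ 3F)
    image-edge₂ φ = ⊆-antisym (λ w∈ → ∈-set₃⁺ (to (∈-image⁻ φ (inside ∷ inside ∷ outside ∷ inside ∷ []) w∈))) (λ w∈ → from (∈-set₃⁻ w∈))
      where
      to : ∀ {w} → (∃ λ i → i ∈ˢ (inside ∷ inside ∷ outside ∷ inside ∷ []) × φ i ≡ w) → w ∈ φ 0F ∷ φ 1F ∷ φ 3F ∷ []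
      to (0F , _ , refl) = here refl
      to (1F , _ , refl) = there (here refl)
      to (2F , there (there ()) , _)
      to (3F , _ , refl) = there (there (here refl))
      from : ∀ {w} → w ∈ φ 0F ∷ φ 1F ∷ φ 3F ∷ [] → w ∈ˢ image φ (inside ∷ inside ∷ outside ∷ inside ∷ [])
      from (here refl)                 = ∈-image⁺ φ (inside ∷ inside ∷ outside ∷ inside ∷ []) {0F} here
      from (there (here refl))         = ∈-image⁺ φ (inside ∷ inside ∷ outside ∷ inside ∷ []) {1F} (there here)
      from (there (there (here refl))) = ∈-image⁺ φ (inside ∷ inside ∷ outside ∷ inside ∷ []) {3F} (there (there (there here)))

    copyOf : ∀ q → Unique (toList q) → IsY adjacent q → Copy Y₃₂ H
    copyOf q@(a ∷ b ∷ x ∷ y ∷ []) u (abx , aby) = record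
      { embed     = lookup q
      ; injective = lookup-injective q u
      ; preserves = λ where
          (here refl)         → subst (_∈ edges H) (sym (image-edge₁ (lookup q))) (yes-does (edge? a b x) abx)
          (there (here refl)) → subst (_∈ edges H) (sym (image-edge₂ (lookup q))) (yes-does (edge? a b y) aby)
      }

    vertices-copyOf⁻ : ∀ q u y {w} → w ∈ˢ vertices (copyOf q u y) → w ∈ toList q
    vertices-copyOf⁻ q@(_ ∷ _ ∷ _ ∷ _ ∷ []) u y w∈ with ∈-image⁻ (lookup q) ⊤ w∈
    ... | i , _ , refl = lookup∈ q i

    vertices-copyOf⁺ : ∀ q u y {w} → w ∈ toList q → w ∈ˢ vertices (copyOf q u y)
    vertices-copyOf⁺ q@(_ ∷ _ ∷ _ ∷ _ ∷ []) u y w∈ =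
      let i , eq = index q w∈ in subst (_∈ˢ image (lookup q) ⊤) eq (∈-image⁺ (lookup q) ⊤ {i} ∈⊤)
      where
      index : ∀ {k} (v : Vec (Fin n) k) {w} → w ∈ toList v → ∃ λ i → lookup v i ≡ w
      index (x ∷ v) (here refl) = zero , refl
      index (x ∷ v) (there i)   = let j , eq = index v i in suc j , eq

    -- `within` is the invariant that keeps a newly added copy disjoint from all the others.
    record Realisation (qs : List (Vec (Fin n) 4)) : Set where
      field
        tiling  : Tiling Y₃₂ H
        within  : All (λ c → ∀ w → w ∈ˢ vertices c → w ∈ flat qs) (copies tiling)
        covers  : ∀ {w} → w ∈ flat qs → w ∈ˢ covered tiling

    realise : ∀ qs → Unique (flat qs) → All (IsY adjacent) qs → Realisation qs
    realise [] _ _ = record { tiling = record { copies = [] ; disjoint = [] } ; within = [] ; covers = λ () }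
    realise (q ∷ qs) u (y ∷ ys) = record
      { tiling = record
          { copies   = c ∷ copies R.tiling
          ; disjoint = All.map (λ within (w , w∈) → let w∈c , w∈d = x∈p∩q⁻ (vertices c) _ w∈ in
                unique-++-disjoint (toList q) u (vertices-copyOf⁻ q uq y w∈c) (within w w∈d)) R.within
              ∷ Tiling.disjoint R.tiling }
      ; within = (λ w w∈ → ∈-++⁺ˡ (vertices-copyOf⁻ q uq y w∈)) ∷ All.map (λ within w w∈ → ∈-++⁺ʳ (toList q) (within w w∈)) R.within
      ; covers = λ w∈ → x∈p∪q⁺ ([ (λ i → inj₁ (vertices-copyOf⁺ q uq y i)) , (λ i → inj₂ (R.covers i)) ]′ (∈-++⁻ (toList q) w∈)) }
      where
      module R = Realisation (realise qs (Unique-++ʳ (toList q) u) ys)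
      uq = Unique-++ˡ (toList q) u
      c = copyOf q uq y

    tiles⇒tiling : ∀ qs → Unique (flat qs) → All (IsY adjacent) qs →
      ∃ λ (T : Tiling Y₃₂ H) → 4 * length qs ≤ ∣ covered T ∣
    tiles⇒tiling qs u ys = R.tiling , ≤-trans (≤-reflexive (sym (length-flat qs))) (unique-⊆⇒≤∣∣ (covered R.tiling) u R.covers)
      where module R = Realisation (realise qs u ys)

-- Naturals as rationals, and the cubic inequality behind the density step.

module Rationals where

  open import Data.Integer using (+_; +≤+)
  import Data.Integer.Properties as ℤ
  open import Data.Nat as ℕ using (ℕ)
  import Data.Nat.Properties as ℕ
  open import Data.Rational
  open import Data.Rational.Properties
  open import Data.Rational.Solver using (module +-*-Solver)
  import Data.Rational.Unnormalised as ℚᵘ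
  import Data.Rational.Unnormalised.Properties as ℚᵘ
  open import Relation.Binary.PropositionalEquality

  ι : ℕ → ℚ
  ι n = + n / 1

  toℚᵘ-ι : ∀ n → toℚᵘ (ι n) ℚᵘ.≃ ℚᵘ.mkℚᵘ (+ n) 0
  toℚᵘ-ι n = toℚᵘ-fromℚᵘ (ℚᵘ.mkℚᵘ (+ n) 0)

  ι-+ : ∀ m n → ι (m ℕ.+ n) ≡ ι m + ι n
  ι-+ m n = toℚᵘ-injective (begin
    toℚᵘ (ι (m ℕ.+ n))                          ≈⟨ toℚᵘ-ι (m ℕ.+ n) ⟩
    ℚᵘ.mkℚᵘ (+ (m ℕ.+ n)) 0                     ≈⟨ ℚᵘ.*≡* (cong (Data.Integer._* + 1) (trans (ℤ.pos-+ m n)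
                                                     (sym (cong₂ Data.Integer._+_ (ℤ.*-identityʳ (+ m)) (ℤ.*-identityʳ (+ n)))))) ⟩
    ℚᵘ.mkℚᵘ (+ m) 0 ℚᵘ.+ ℚᵘ.mkℚᵘ (+ n) 0        ≈⟨ ℚᵘ.+-cong (toℚᵘ-ι m) (toℚᵘ-ι n) ⟨
    toℚᵘ (ι m) ℚᵘ.+ toℚᵘ (ι n)                  ≈⟨ toℚᵘ-homo-+ (ι m) (ι n) ⟨
    toℚᵘ (ι m + ι n)                            ∎)
    where open ℚᵘ.≃-Reasoning

  ι-* : ∀ m n → ι (m ℕ.* n) ≡ ι m * ι n
  ι-* m n = toℚᵘ-injective (begin
    toℚᵘ (ι (m ℕ.* n))                          ≈⟨ toℚᵘ-ι (m ℕ.* n) ⟩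
    ℚᵘ.mkℚᵘ (+ (m ℕ.* n)) 0                     ≈⟨ ℚᵘ.*≡* (cong (Data.Integer._* + 1) (ℤ.pos-* m n)) ⟩
    ℚᵘ.mkℚᵘ (+ m) 0 ℚᵘ.* ℚᵘ.mkℚᵘ (+ n) 0        ≈⟨ ℚᵘ.*-cong (toℚᵘ-ι m) (toℚᵘ-ι n) ⟨
    toℚᵘ (ι m) ℚᵘ.* toℚᵘ (ι n)                  ≈⟨ toℚᵘ-homo-* (ι m) (ι n) ⟨
    toℚᵘ (ι m * ι n)                            ∎)
    where open ℚᵘ.≃-Reasoning

  ι-mono : ∀ {m n} → m ℕ.≤ n → ι m ≤ ι n
  ι-mono {m} {n} m≤n = toℚᵘ-cancel-≤ (ℚᵘ.≤-respˡ-≃ (ℚᵘ.≃-sym (toℚᵘ-ι m)) (ℚᵘ.≤-respʳ-≃ (ℚᵘ.≃-sym (toℚᵘ-ι n))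
    (ℚᵘ.*≤* (subst₂ Data.Integer._≤_ (sym (ℤ.*-identityʳ (+ m))) (sym (ℤ.*-identityʳ (+ n))) (+≤+ m≤n)))))

  ι-cancel : ∀ {m n} → ι m ≤ ι n → m ℕ.≤ n
  ι-cancel {m} {n} p = ℤ.drop‿+≤+ (subst₂ Data.Integer._≤_ (ℤ.*-identityʳ (+ m)) (ℤ.*-identityʳ (+ n))
    (ℚᵘ.drop-*≤* (ℚᵘ.≤-respˡ-≃ (toℚᵘ-ι m) (ℚᵘ.≤-respʳ-≃ (toℚᵘ-ι n) (toℚᵘ-mono-≤ p)))))

  0≤ι : ∀ n → 0ℚ ≤ ι n
  0≤ι n = ι-mono {0} {n} ℕ.z≤n

  0≤*  : ∀ {p q} → 0ℚ ≤ p → 0ℚ ≤ q → 0ℚ ≤ p * q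
  0≤* {p} {q} 0≤p 0≤q = nonNegative⁻¹ (p * q) {{nonNeg*nonNeg⇒nonNeg p {{nonNegative 0≤p}} q {{nonNegative 0≤q}}}}

  0≤+ : ∀ {p q} → 0ℚ ≤ p → 0ℚ ≤ q → 0ℚ ≤ p + q
  0≤+ {p} {q} 0≤p 0≤q = +-mono-≤ {0ℚ} {p} {0ℚ} {q} 0≤p 0≤q

  p≤q⇒0≤q-p : ∀ {p q} → p ≤ q → 0ℚ ≤ q - p
  p≤q⇒0≤q-p {p} {q} h = subst (_≤ q - p) (+-inverseʳ p) (+-monoˡ-≤ (- p) h)

  0≤q-p⇒p≤q : ∀ {p q} → 0ℚ ≤ q - p → p ≤ q
  0≤q-p⇒p≤q {p} {q} h = subst₂ _≤_ (+-identityˡ p) (lemma q p) (+-monoˡ-≤ p h)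
    where
    open +-*-Solver
    lemma : ∀ q p → q - p + p ≡ q
    lemma = solve 2 (λ q p → q :- p :+ p := q) refl

  mono² : ∀ {p q r s} → 0ℚ ≤ p → p ≤ q → 0ℚ ≤ s → r ≤ s → p * r ≤ q * s
  mono² {p} {q} {r} {s} 0≤p p≤q 0≤s r≤s = ≤-trans
    (*-monoˡ-≤-nonNeg p {{nonNegative 0≤p}} r≤s) (*-monoʳ-≤-nonNeg s {{nonNegative 0≤s}} p≤q)

  -- By computation these are the terms of the sequence `choose₃`, just as `ν * (ν * (ν * ι 1))`
  -- below is the term of a third power; so the hypothesis on reals is literally a statement about
  -- these rationals.
  choose : ℚ → ℚ
  choose x = x * (x - ι 1) * (x - ι 2) * (+ 1 / 6)

  -- Here x is n - αn, y is n - s and z bounds the error x - y; both sides are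
  -- multiplied by κ ≥ 1 / ε and all slacks are collected in one identity.
  cubic-bound : ∀ κ e ν x y z ε →
    0ℚ ≤ κ → 1ℚ ≤ ν → 0ℚ ≤ x → x ≤ ν → 0ℚ ≤ y → y ≤ ν → 0ℚ ≤ z → z ≤ ν →
    x ≤ y + z → 1ℚ ≤ κ * ε → ι 3 * κ ≤ ν → ι 7 * κ * z ≤ ν →
    choose ν - choose x + ε * (ν * (ν * (ν * ι 1))) ≤ e + 1ℚ →
    κ * (ν * (ν * ν)) + ν * (ν * ν) ≤ κ * (ι 6 * e) + κ * (y * (y * y))
  cubic-bound κ e ν x y z ε 0≤κ 1≤ν 0≤x x≤ν 0≤y y≤ν 0≤z z≤ν x≤y+z 1≤κε 3κ≤ν 7κz≤ν h =
    0≤q-p⇒p≤q (subst (0ℚ ≤_) (sym (identity κ e ν x y z ε))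
      (0≤+ (0≤+ (0≤+ (0≤+ (0≤+ (0≤+ (0≤+ (0≤+ (0≤+
        (0≤* (0≤* (0≤ι 6) 0≤κ) (p≤q⇒0≤q-p h))
        (0≤* (0≤* (0≤ι 6) 0≤κ) (p≤q⇒0≤q-p (mono² {1ℚ} {ν} {1ℚ} {ν} 0≤1 1≤ν 0≤ν 1≤ν))))
        (0≤* (0≤* (0≤ι 2) 0≤κ) (p≤q⇒0≤q-p x≤ν)))
        (0≤* (0≤* (0≤ι 3) 0≤κ) (0≤* 0≤x 0≤x)))
        (0≤* (0≤* 0≤κ (p≤q⇒0≤q-p x≤y+z)) (0≤+ (0≤+ (0≤* 0≤y+z 0≤y+z) (0≤* 0≤y+z 0≤x)) (0≤* 0≤x 0≤x))))
        (0≤* (0≤* 0≤κ 0≤z) (0≤+ (0≤+ (0≤* (0≤ι 3) (p≤q⇒0≤q-p (mono² 0≤y y≤ν 0≤ν y≤ν)))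
          (0≤* (0≤ι 3) (p≤q⇒0≤q-p (mono² 0≤y y≤ν 0≤ν z≤ν)))) (p≤q⇒0≤q-p (mono² 0≤z z≤ν 0≤ν z≤ν)))))
        (0≤* (0≤ι 6) (0≤* (p≤q⇒0≤q-p 1≤κε) 0≤ν³)))
        (0≤* (0≤ι 3) (0≤* (p≤q⇒0≤q-p 3κ≤ν) (0≤* 0≤ν 0≤ν))))
        (0≤* (p≤q⇒0≤q-p 7κz≤ν) (0≤* 0≤ν 0≤ν)))
        0≤ν³))
    where
    0≤1 : 0ℚ ≤ 1ℚ
    0≤1 = 0≤ι 1
    0≤ν : 0ℚ ≤ ν
    0≤ν = ≤-trans 0≤1 1≤ν
    0≤ν³ : 0ℚ ≤ ν * (ν * ν)
    0≤ν³ = 0≤* 0≤ν (0≤* 0≤ν 0≤ν)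
    0≤y+z : 0ℚ ≤ y + z
    0≤y+z = 0≤+ 0≤y 0≤z
    open +-*-Solver
    -- Of the gain `6 κ ε ν³ ≥ 6 ν³`, one `ν³` is the claim; three absorb the lower-order terms
    -- `9 κ ν²`, of which six come from the additive 1 and three from the quadratic part of
    -- `choose ν`; one absorbs the error `7 κ z ν²` of replacing `x` by `y`; and one is left over.
    identity : ∀ κ e ν x y z ε →
      (κ * (ι 6 * e) + κ * (y * (y * y))) - (κ * (ν * (ν * ν)) + ν * (ν * ν)) ≡
      ι 6 * κ * ((e + 1ℚ) - (choose ν - choose x + ε * (ν * (ν * (ν * ι 1)))))
      + ι 6 * κ * (ν * ν - 1ℚ * 1ℚ)
      + ι 2 * κ * (ν - x)
      + ι 3 * κ * (x * x)
      + κ * ((y + z) - x) * ((y + z) * (y + z) + (y + z) * x + x * x)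
      + κ * z * (ι 3 * (ν * ν - y * y) + ι 3 * (ν * ν - y * z) + (ν * ν - z * z))
      + ι 6 * ((κ * ε - 1ℚ) * (ν * (ν * ν)))
      + ι 3 * ((ν - ι 3 * κ) * (ν * ν))
      + (ν - ι 7 * κ * z) * (ν * ν)
      + ν * (ν * ν)
    identity = solve 7 (λ κ e ν x y z ε →
      let ch = λ x → x :* (x :- con (ι 1)) :* (x :- con (ι 2)) :* con (+ 1 / 6) in
      (κ :* (con (ι 6) :* e) :+ κ :* (y :* (y :* y))) :- (κ :* (ν :* (ν :* ν)) :+ ν :* (ν :* ν)) :=
      con (ι 6) :* κ :* ((e :+ con 1ℚ) :- (ch ν :- ch x :+ ε :* (ν :* (ν :* (ν :* con (ι 1))))))
      :+ con (ι 6) :* κ :* (ν :* ν :- con 1ℚ :* con 1ℚ)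
      :+ con (ι 2) :* κ :* (ν :- x)
      :+ con (ι 3) :* κ :* (x :* x)
      :+ κ :* ((y :+ z) :- x) :* ((y :+ z) :* (y :+ z) :+ (y :+ z) :* x :+ x :* x)
      :+ κ :* z :* (con (ι 3) :* (ν :* ν :- y :* y) :+ con (ι 3) :* (ν :* ν :- y :* z) :+ (ν :* ν :- z :* z))
      :+ con (ι 6) :* ((κ :* ε :- con 1ℚ) :* (ν :* (ν :* ν)))
      :+ con (ι 3) :* ((ν :- con (ι 3) :* κ) :* (ν :* ν))
      :+ (ν :- con (ι 7) :* κ :* z) :* (ν :* ν)
      :+ ν :* (ν :* ν)) refl

-- Iterating the improvement, and passage from rational approximations to Cauchy reals.

module Assembly where

  open import Data.Empty using (⊥-elim)
  open import Data.Fin using (Fin)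
  open import Data.Fin.Subset using () renaming (∣_∣ to ∣_∣ˢ)
  open import Data.Integer using (+_; +≤+)
  import Data.Integer.Properties as ℤ
  open import Data.List using (List; []; length; allFin)
  open import Data.List.Relation.Unary.All using (All; [])
  open import Data.List.Relation.Unary.AllPairs using ([])
  open import Data.List.Relation.Unary.Unique.Propositional using (Unique)
  open import Data.Nat as ℕ using (ℕ; zero; suc; _∸_)
  import Data.Nat.Properties as ℕ
  open import Data.Nat.Tactic.RingSolver using (solve-∀)
  open import Data.Product using (∃; _×_; _,_)
  open import Data.Rational
  open import Data.Rational.Properties
  open import Data.Rational.Solver using (module +-*-Solver)
  import Data.Rational.Unnormalised as ℚᵘ
  import Data.Rational.Unnormalised.Properties as ℚᵘ
  open import Data.Sum using (_⊎_; inj₁; inj₂)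
  open import Data.Vec using (Vec)
  open import Relation.Binary.PropositionalEquality
  open import Relation.Nullary using (yes; no)
  open import Relation.Nullary.Decidable using (toWitness)
  open import Defs using (3-Graph; e; Tiling; Y₃₂; covered; Cauchy)
  open Augment using (IsY; flat)
  open Groups using (nonEdges; improve; improveThreshold)
  open Graphs
  open Rationals

  cube : ℕ → ℕ
  cube n = n ℕ.* (n ℕ.* n)

  module _ {n} (H : 3-Graph n) (c : ℕ) (0<c : 0 ℕ.< c) (large : improveThreshold c ℕ.≤ n)
    (Stop : ℕ → Set)
    (step : ∀ s → Stop s ⊎ (7 ℕ.* s ℕ.≤ n × c ℕ.* cube n ℕ.+ cube n ℕ.≤ c ℕ.* (6 ℕ.* e H) ℕ.+ c ℕ.* cube (n ∸ s))) where

    YTiles : List (Vec (Fin n) 4) → Set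
    YTiles qs = Unique (flat qs) × All (IsY (adjacent H)) qs

    few-nonEdges : ∀ {m} → c ℕ.* cube n ℕ.+ cube n ℕ.≤ c ℕ.* (6 ℕ.* e H) ℕ.+ c ℕ.* m →
      c ℕ.* nonEdges (allFin n) (adjacent H) ℕ.+ cube n ℕ.≤ c ℕ.* m
    few-nonEdges {m} dense = ℕ.+-cancelˡ-≤ (c ℕ.* (6 ℕ.* e H)) _ _ (begin
      c ℕ.* (6 ℕ.* e H) ℕ.+ (c ℕ.* N ℕ.+ cube n)   ≡⟨ regroup c (6 ℕ.* e H) N (cube n) ⟩
      c ℕ.* (6 ℕ.* e H ℕ.+ N) ℕ.+ cube n           ≤⟨ ℕ.+-monoˡ-≤ (cube n) (ℕ.*-monoʳ-≤ c (6e+nonEdges≤n³ H)) ⟩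
      c ℕ.* cube n ℕ.+ cube n                      ≤⟨ dense ⟩
      c ℕ.* (6 ℕ.* e H) ℕ.+ c ℕ.* m                ∎)
      where
      open ℕ.≤-Reasoning
      N = nonEdges (allFin n) (adjacent H)
      regroup : ∀ c x y z → c ℕ.* x ℕ.+ (c ℕ.* y ℕ.+ z) ≡ c ℕ.* (x ℕ.+ y) ℕ.+ z
      regroup = solve-∀

    opaque
      one-more : ∀ qs → YTiles qs → 7 ℕ.* length qs ℕ.≤ n →
        c ℕ.* cube n ℕ.+ cube n ℕ.≤ c ℕ.* (6 ℕ.* e H) ℕ.+ c ℕ.* cube (n ∸ length qs) →
        ∃ λ qs′ → length qs ℕ.< length qs′ × YTiles qs′
      one-more qs tiles 7s≤n dense = improve (adjacent H)
        (λ {x} {y} {z} → adjacent-swap₁₂ H {x} {y} {z}) (λ {x} {y} {z} → adjacent-swap₂₃ H {x} {y} {z})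
        c 0<c large qs tiles 7s≤n (few-nonEdges dense)

    -- Until it stops, `7 * s ≤ n` bounds the number `s` of tiles, and every step adds at least one
    -- tile, so fuel exceeding `n` cannot run out.
    grow : ∀ fuel qs → YTiles qs → n ℕ.< fuel ℕ.+ length qs → ∃ λ qs → YTiles qs × Stop (length qs)
    grow fuel qs tiles enough with step (length qs)
    grow fuel       qs tiles enough | inj₁ stop = qs , tiles , stop
    grow zero       qs tiles enough | inj₂ (7s≤n , _) =
      ⊥-elim (ℕ.<⇒≱ enough (ℕ.≤-trans (ℕ.m≤n*m (length qs) 7) 7s≤n))
    grow (suc fuel) qs tiles enough | inj₂ (7s≤n , dense) =
      let qs′ , longer , tiles′ = one-more qs tiles 7s≤n dense
      in grow fuel qs′ tiles′ (ℕ.≤-trans enough (ℕ.≤-trans (ℕ.≤-reflexive (sym (ℕ.+-suc fuel (length qs)))) (ℕ.+-monoʳ-≤ fuel longer)))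

    opaque
      large-tiling : ∃ λ (T : Tiling Y₃₂ H) → ∃ λ s → 4 ℕ.* s ℕ.≤ ∣ covered T ∣ˢ × Stop s
      large-tiling =
        let qs , (u , ys) , stop = grow (suc n) [] ([] , []) (ℕ.m≤m+n (suc n) 0)
            T , covers = tiles⇒tiling H qs u ys
        in T , length qs , covers , stop

  reciprocal : ∀ p → 0ℚ < p → ∃ λ r → 0ℚ < r × p * r ≡ 1ℚ
  reciprocal p 0<p = 1/p , positive⁻¹ 1/p {{1/pos⇒pos p {{positive 0<p}}}} , *-inverseʳ p {{p≢0}}
    where
    p≢0 : NonZero p
    p≢0 = pos⇒nonZero p {{positive 0<p}}
    1/p : ℚ
    1/p = 1/_ p {{p≢0}}

  denominator-large : ∀ c δ → + c ≡ ↧ δ → 0ℚ < δ → 1ℚ ≤ ι c * δ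
  denominator-large c δ@(mkℚ (+ suc p) d-1 _) c≡ _ = toℚᵘ-cancel-≤
    (ℚᵘ.≤-respʳ-≃ (ℚᵘ.≃-sym (ℚᵘ.≃-trans (toℚᵘ-homo-* (ι c) δ) (ℚᵘ.*-congʳ (toℚᵘ-ι c))))
      (ℚᵘ.*≤* (subst₂ Data.Integer._≤_ (trans c≡ (units d-1))
        (trans (ℤ.pos-* c (suc p)) (sym (ℤ.*-identityʳ (+ c Data.Integer.* + suc p))))
        (+≤+ (ℕ.m≤m*n c (suc p))))))
    where
    units : ∀ d → + suc d ≡ + (1 ℕ.* (1 ℕ.* suc d))
    units d = cong +_ (sym (trans (ℕ.*-identityˡ _) (ℕ.*-identityˡ _)))
  denominator-large c (mkℚ (+ zero) _ _)              _ (*<* (Data.Integer.+<+ ()))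
  denominator-large c (mkℚ Data.Integer.-[1+ _ ] _ _) _ (*<* ())

  -- A positive fraction times its denominator is a positive integer.
  archimedean : ∀ δ → 0ℚ < δ → ∃ λ c → 0 ℕ.< c × 1ℚ ≤ ι c * δ
  archimedean δ 0<δ = ↧ₙ δ , ℕ.s≤s ℕ.z≤n , denominator-large (↧ₙ δ) δ refl 0<δ

  ∣p-q∣<η⇒p≤q+η : ∀ {p q η} → ∣ p - q ∣ < η → p ≤ q + η
  ∣p-q∣<η⇒p≤q+η {p} {q} {η} h = subst (_≤ q + η) (lemma q p) (+-monoʳ-≤ q (≤-trans (p≤∣p∣ (p - q)) (<⇒≤ h)))
    where
    open +-*-Solver
    lemma : ∀ q p → q + (p - q) ≡ p
    lemma = solve 2 (λ q p → q :+ (p :- q) := p) refl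
    p≤∣p∣ : ∀ p → p ≤ ∣ p ∣
    p≤∣p∣ p with ≤-total 0ℚ p
    ... | inj₁ 0≤p = ≤-reflexive (sym (0≤p⇒∣p∣≡p 0≤p))
    ... | inj₂ p≤0 = ≤-trans p≤0 (0≤∣p∣ p)

  -- The cubic estimate is applied with `κ = c`. Since `x - y = s - a n ≤ (q - a) n ≤ 2 η n`, the
  -- error is bounded by `z = 2 η n`, and `14 c η = 1` gives `7 κ z = ν`.
  density-at : ∀ c n s eH (a ε η q : ℚ) → 3 ℕ.* c ℕ.≤ n → 1 ℕ.≤ n → 1 ℕ.≤ c → s ℕ.≤ n →
    0ℚ ≤ a → a ≤ 1ℚ → 0ℚ ≤ η → ι 14 * ι c * η ≡ 1ℚ → 1ℚ ≤ ι c * ε → q ≤ a + (η + η) → ι s ≤ q * ι n →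
    choose (ι n) - choose (ι n - a * ι n) + ε * (ι n * (ι n * (ι n * ι 1))) ≤ ι eH + 1ℚ →
    c ℕ.* cube n ℕ.+ cube n ℕ.≤ c ℕ.* (6 ℕ.* eH) ℕ.+ c ℕ.* cube (n ∸ s)
  density-at c n s eH a ε η q 3c≤n 1≤n 1≤c s≤n 0≤a a≤1 0≤η 14cη≡1 1≤cε q≤ s≤qν h =
    ι-cancel (subst₂ _≤_ (sym lhs) (sym rhs) (cubic-bound (ι c) (ι eH) ν x y z ε
      (0≤ι c) (ι-mono {1} {n} 1≤n)
      (p≤q⇒0≤q-p (subst (a * ν ≤_) (*-identityˡ ν) (*-monoʳ-≤-nonNeg ν {{nonNegative 0≤ν}} a≤1)))
      (0≤q-p⇒p≤q (subst (0ℚ ≤_) (sym (x-slack ν (a * ν))) (0≤* 0≤a 0≤ν)))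
      (0≤ι (n ∸ s)) (ι-mono (ℕ.m∸n≤m n s)) 0≤z z≤ν x≤y+z 1≤cε
      (subst (_≤ ν) (ι-* 3 c) (ι-mono 3c≤n)) (≤-reflexive 7cz≡ν) h))
    where
    open +-*-Solver
    ν = ι n
    x = ν - a * ν
    y = ι (n ∸ s)
    z = (η + η) * ν
    0≤ν : 0ℚ ≤ ν
    0≤ν = 0≤ι n
    0≤z : 0ℚ ≤ z
    0≤z = 0≤* (0≤+ 0≤η 0≤η) 0≤ν
    x-slack : ∀ u v → u - (u - v) ≡ v
    x-slack = solve 2 (λ u v → u :- (u :- v) := v) refl
    7cz≡ν : ι 7 * ι c * z ≡ ν
    7cz≡ν = trans (regroup (ι c) η ν) (trans (cong (_* ν) 14cη≡1) (*-identityˡ ν))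
      where
      regroup : ∀ c η ν → ι 7 * c * ((η + η) * ν) ≡ ι 14 * c * η * ν
      regroup = solve 3 (λ c η ν → con (ι 7) :* c :* ((η :+ η) :* ν) := con (ι 14) :* c :* η :* ν) refl
    z≤ν : z ≤ ν
    z≤ν = ≤-trans (≤-reflexive (sym (*-identityˡ z))) (≤-trans
      (*-monoʳ-≤-nonNeg z {{nonNegative 0≤z}} (subst (1ℚ ≤_) (ι-* 7 c) (ι-mono {1} {7 ℕ.* c} (ℕ.≤-trans 1≤c (ℕ.m≤n*m c 7)))))
      (≤-reflexive 7cz≡ν))
    ν≡ : ν ≡ y + ι s
    ν≡ = trans (cong ι (sym (ℕ.m∸n+n≡m s≤n))) (ι-+ (n ∸ s) s)
    x≤y+z : x ≤ y + z
    x≤y+z = subst₂ _≤_ (cong (_- a * ν) (sym ν≡)) (cancel y a (η + η) ν)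
      (+-monoˡ-≤ (- (a * ν)) (+-monoʳ-≤ y (≤-trans s≤qν (*-monoʳ-≤-nonNeg ν {{nonNegative 0≤ν}} q≤))))
      where
      cancel : ∀ y a t ν → y + (a + t) * ν - a * ν ≡ y + t * ν
      cancel = solve 4 (λ y a t ν → y :+ (a :+ t) :* ν :- a :* ν := y :+ t :* ν) refl
    ι-cube : ∀ m → ι (cube m) ≡ ι m * (ι m * ι m)
    ι-cube m = trans (ι-* m (m ℕ.* m)) (cong (ι m *_) (ι-* m m))
    lhs : ι (c ℕ.* cube n ℕ.+ cube n) ≡ ι c * (ν * (ν * ν)) + ν * (ν * ν)
    lhs = trans (ι-+ (c ℕ.* cube n) (cube n)) (cong₂ _+_ (trans (ι-* c (cube n)) (cong (ι c *_) (ι-cube n))) (ι-cube n))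
    rhs : ι (c ℕ.* (6 ℕ.* eH) ℕ.+ c ℕ.* cube (n ∸ s)) ≡ ι c * (ι 6 * ι eH) + ι c * (y * (y * y))
    rhs = trans (ι-+ (c ℕ.* (6 ℕ.* eH)) (c ℕ.* cube (n ∸ s))) (cong₂ _+_
      (trans (ι-* c (6 ℕ.* eH)) (cong (ι c *_) (ι-* 6 eH)))
      (trans (ι-* c (cube (n ∸ s))) (cong (ι c *_) (ι-cube (n ∸ s)))))

  module _ (α ε : ℕ → ℚ) (α-cauchy : Cauchy α)
    (Nα : ℕ) (0≤α : ∀ k → Nα ℕ.≤ k → 0ℚ ≤ α k)
    (α≤ : ∀ δ → 0ℚ < δ → ∃ λ N → ∀ k → N ℕ.≤ k → α k ≤ + 1 / 7 + δ)
    (δ : ℚ) (0<δ : 0ℚ < δ) (Nε : ℕ) (δ≤ε : ∀ k → Nε ℕ.≤ k → δ ≤ ε k) where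

    private
      module Constants (c : ℕ) (0<c : 0 ℕ.< c) (1≤cδ : 1ℚ ≤ ι c * δ)
        (η : ℚ) (0<η : 0ℚ < η) (14cη≡1 : ι 14 * ι c * η ≡ 1ℚ)
        (K : ℕ) (close : ∀ m n → K ℕ.≤ m → K ℕ.≤ n → ∣ α m - α n ∣ < η) where

        n₀ : ℕ
        -- The summand `3 c + 1` supplies the conditions `3 κ ≤ ν` and `1 ≤ ν` of the cubic
        -- estimate.
        n₀ = improveThreshold c ℕ.+ (3 ℕ.* c ℕ.+ 1)

        -- Within 2 η of every late term of α, and above all of them.
        q : ℚ
        q = α K + η

        α≤q : ∀ k → K ℕ.≤ k → α k ≤ q
        α≤q k K≤k = ∣p-q∣<η⇒p≤q+η {α k} {α K} {η} (close k K K≤k ℕ.≤-refl)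

        q≤α+2η : ∀ k → K ℕ.≤ k → q ≤ α k + (η + η)
        q≤α+2η k K≤k = subst (q ≤_) (+-assoc (α k) η η)
          (+-monoˡ-≤ η (∣p-q∣<η⇒p≤q+η {α K} {α k} {η} (close K k ℕ.≤-refl K≤k)))

        module _ {n} (n≥n₀ : n₀ ℕ.≤ n) (H : 3-Graph n)
          (dense : ∃ λ N → ∀ k → N ℕ.≤ k →
            choose (ι n) - choose (ι n - α k * ι n) + ε k * (ι n * (ι n * (ι n * ι 1))) ≤ ι (e H) + 1ℚ) where

          ν : ℚ
          ν = ι n

          3c≤n : 3 ℕ.* c ℕ.≤ n
          3c≤n = ℕ.≤-trans (ℕ.≤-trans (ℕ.m≤m+n (3 ℕ.* c) 1) (ℕ.m≤n+m _ (improveThreshold c))) n≥n₀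

          1≤n : 1 ℕ.≤ n
          1≤n = ℕ.≤-trans (ℕ.≤-trans (ℕ.m≤n+m 1 (3 ℕ.* c)) (ℕ.m≤n+m _ (improveThreshold c))) n≥n₀

          -- A decidable substitute for `α n ≤ s`: `q` is rational and bounds every late term of
          -- `α`, while `n < 7 s` suffices because `α ≤ 1/7`. If neither holds, there is room for
          -- the groups and `s` exceeds `α n` by at most `2 η n`.
          Stop : ℕ → Set
          Stop s = n ℕ.< 7 ℕ.* s ⊎ q * ν ≤ ι s

          dense-step : ∀ s → 7 ℕ.* s ℕ.≤ n → ι s ≤ q * ν →
            c ℕ.* cube n ℕ.+ cube n ℕ.≤ c ℕ.* (6 ℕ.* e H) ℕ.+ c ℕ.* cube (n ∸ s)
          dense-step s 7s≤n s≤qν =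
            let N₁ , dense₁ = dense
                -- Late terms of `α` only have to be at most 1, so that `x = ν - α ν` is
                -- nonnegative, and `1/7 + 1/2` is below 1.
                N₂ , α≤₂    = α≤ ½ (positive⁻¹ ½)
                k           = K ℕ.+ Nα ℕ.+ Nε ℕ.+ N₁ ℕ.+ N₂
                K≤k         = ℕ.≤-trans (ℕ.m≤m+n K Nα) (ℕ.≤-trans (ℕ.m≤m+n _ Nε) (ℕ.≤-trans (ℕ.m≤m+n _ N₁) (ℕ.m≤m+n _ N₂)))
                Nα≤k        = ℕ.≤-trans (ℕ.m≤n+m Nα K) (ℕ.≤-trans (ℕ.m≤m+n _ Nε) (ℕ.≤-trans (ℕ.m≤m+n _ N₁) (ℕ.m≤m+n _ N₂)))
                Nε≤k        = ℕ.≤-trans (ℕ.m≤n+m Nε _) (ℕ.≤-trans (ℕ.m≤m+n _ N₁) (ℕ.m≤m+n _ N₂))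
                N₁≤k        = ℕ.≤-trans (ℕ.m≤n+m N₁ _) (ℕ.m≤m+n _ N₂)
                N₂≤k        = ℕ.m≤n+m N₂ _
            in density-at c n s (e H) (α k) (ε k) η q 3c≤n 1≤n 0<c (ℕ.≤-trans (ℕ.m≤n*m s 7) 7s≤n)
                 (0≤α k Nα≤k) (≤-trans (α≤₂ k N₂≤k) (toWitness {a? = + 1 / 7 + ½ ≤? 1ℚ} _))
                 (<⇒≤ 0<η) 14cη≡1
                 (≤-trans 1≤cδ (*-monoˡ-≤-nonNeg (ι c) {{nonNegative (0≤ι c)}} (δ≤ε k Nε≤k)))
                 (q≤α+2η k K≤k) s≤qν (dense₁ k N₁≤k)

          step : ∀ s → Stop s ⊎ (7 ℕ.* s ℕ.≤ n × c ℕ.* cube n ℕ.+ cube n ℕ.≤ c ℕ.* (6 ℕ.* e H) ℕ.+ c ℕ.* cube (n ∸ s))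
          step s with 7 ℕ.* s ℕ.≤? n | q * ν ≤? ι s
          ... | no 7s≰n  | _         = inj₁ (inj₁ (ℕ.≰⇒> 7s≰n))
          ... | yes _    | yes qν≤s  = inj₁ (inj₂ qν≤s)
          ... | yes 7s≤n | no  qν≰s  = inj₂ (7s≤n , dense-step s 7s≤n (<⇒≤ (≰⇒> qν≰s)))

          -- If `n < 7 s`, integrality gives `n + 1 ≤ 7 s`, and this unit covers the excess of late
          -- terms of `α` over 1/7: for `ρ = 1 / (7 n)` they satisfy `7 n α ≤ n + 1`.
          stop⇒αν≤s : ∀ {s} → Stop s → ∃ λ N → ∀ k → N ℕ.≤ k → α k * ν ≤ ι s
          stop⇒αν≤s {s} (inj₂ qν≤s) = K , λ k K≤k →
            ≤-trans (*-monoʳ-≤-nonNeg ν {{nonNegative (0≤ι n)}} (α≤q k K≤k)) qν≤s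
          stop⇒αν≤s {s} (inj₁ n<7s) =
            let ρ , 0<ρ , νρ≡1 = reciprocal (ι 7 * ν) (<-≤-trans (positive⁻¹ 1ℚ)
                  (subst (1ℚ ≤_) (ι-* 7 n) (ι-mono {1} {7 ℕ.* n} (ℕ.≤-trans 1≤n (ℕ.m≤n*m n 7)))))
                N , α≤₁ = α≤ ρ 0<ρ
            in N , λ k N≤k → *-cancelˡ-≤-pos (ι 7) (begin
              ι 7 * (α k * ν)                ≡⟨ rearrange (α k) ν ⟩
              ι 7 * ν * α k                  ≤⟨ *-monoˡ-≤-nonNeg (ι 7 * ν) {{nonNegative (0≤* (0≤ι 7) (0≤ι n))}} (α≤₁ k N≤k) ⟩
              ι 7 * ν * (+ 1 / 7 + ρ)        ≡⟨ expand ν ρ ⟩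
              ν + ι 7 * ν * ρ                ≡⟨ cong (λ u → ν + u) νρ≡1 ⟩
              ν + 1ℚ                         ≡⟨ trans (cong ι (ℕ.+-comm 1 n)) (ι-+ n 1) ⟨
              ι (suc n)                      ≤⟨ ι-mono n<7s ⟩
              ι (7 ℕ.* s)                    ≡⟨ ι-* 7 s ⟩
              ι 7 * ι s                      ∎)
            where
            open ≤-Reasoning
            open +-*-Solver
            rearrange : ∀ a ν → ι 7 * (a * ν) ≡ ι 7 * ν * a
            rearrange = solve 2 (λ a ν → con (ι 7) :* (a :* ν) := con (ι 7) :* ν :* a) refl
            expand : ∀ ν ρ → ι 7 * ν * (+ 1 / 7 + ρ) ≡ ν + ι 7 * ν * ρ
            expand = solve 2 (λ ν ρ → con (ι 7) :* ν :* (con (+ 1 / 7) :+ ρ) := ν :+ con (ι 7) :* ν :* ρ) refl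

          tiling : ∃ λ (T : Tiling Y₃₂ H) → ∀ δ′ → 0ℚ < δ′ →
            ∃ λ N → ∀ k → N ℕ.≤ k → ι 4 * α k * ν ≤ ι ∣ covered T ∣ˢ + δ′
          tiling =
            let T , s , 4s≤ , stop = large-tiling H c 0<c (ℕ.≤-trans (ℕ.m≤m+n _ _) n≥n₀) Stop step
                N , αν≤s = stop⇒αν≤s {s} stop
            in T , λ δ′ 0<δ′ → N , λ k N≤k → begin
              ι 4 * α k * ν          ≡⟨ *-assoc (ι 4) (α k) ν ⟩
              ι 4 * (α k * ν)        ≤⟨ *-monoˡ-≤-nonNeg (ι 4) (αν≤s k N≤k) ⟩
              ι 4 * ι s              ≡⟨ ι-* 4 s ⟨
              ι (4 ℕ.* s)            ≤⟨ ι-mono 4s≤ ⟩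
              ι ∣ covered T ∣ˢ         ≡⟨ +-identityʳ (ι ∣ covered T ∣ˢ) ⟨
              ι ∣ covered T ∣ˢ + 0ℚ    ≤⟨ +-monoʳ-≤ (ι ∣ covered T ∣ˢ) (<⇒≤ 0<δ′) ⟩
              ι ∣ covered T ∣ˢ + δ′    ∎
            where open ≤-Reasoning

    approximate-theorem : ∃ λ n₀ → ∀ n → n₀ ℕ.≤ n → ∀ (H : 3-Graph n) →
      (∃ λ N → ∀ k → N ℕ.≤ k →
        choose (ι n) - choose (ι n - α k * ι n) + ε k * (ι n * (ι n * (ι n * ι 1))) ≤ ι (e H) + 1ℚ) →
      ∃ λ (T : Tiling Y₃₂ H) → ∀ δ′ → 0ℚ < δ′ →
        ∃ λ N → ∀ k → N ℕ.≤ k → ι 4 * α k * ι n ≤ ι ∣ covered T ∣ˢ + δ′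
    approximate-theorem =
      let c , 0<c , 1≤cδ = archimedean δ 0<δ
          η , 0<η , 14cη≡1 = reciprocal (ι 14 * ι c) (<-≤-trans (positive⁻¹ 1ℚ)
            (subst (1ℚ ≤_) (ι-* 14 c) (ι-mono {1} {14 ℕ.* c} (ℕ.≤-trans 0<c (ℕ.m≤n*m c 14)))))
          K , close = α-cauchy η 0<η
          open Constants c 0<c 1≤cδ η 0<η 14cη≡1 K close
      in n₀ , λ n n≥n₀ H dense → tiling n≥n₀ H dense

open import Defs
open import Data.Fin.Subset using (∣_∣)
open import Data.Integer using (+_)
open import Data.Nat as ℕ using (ℕ)
open import Data.Product using (∃; _,_)
open import Data.Rational as ℚ using (1ℚ)
import Data.Rational.Properties as ℚ
open import Relation.Binary.PropositionalEquality using (subst)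

theorem1p4 : ∀ (α ε : ℝ) →
    fromℕ 0 < α → α ≤ fromℚ (+ 1 ℚ./ 7) →
    fromℕ 0 < ε → ε ≤ fromℚ (+ 1 ℚ./ 7) →
    ∃ λ (n₀ : ℕ) → ∀ (n : ℕ) → n ℕ.≥ n₀ → ∀ (H : 3-Graph n) →
    fromℕ (e H) ≥ choose₃ (fromℕ n) - choose₃ (fromℕ n - α * fromℕ n) + ε * fromℕ n ^ 3 →
    ∃ λ (T : Tiling Y₃₂ H) → fromℕ ∣ covered T ∣ ≥ fromℕ 4 * α * fromℕ n
theorem1p4 α ε (δα , 0<δα , Nα , δα≤α) α≤1/7 (δ , 0<δ , Nε , δ≤ε) _ =
  let n₀ , tile = Assembly.approximate-theorem (seq α) (seq ε) (cauchy α)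
        Nα (λ k Nα≤k → ℚ.≤-trans (ℚ.<⇒≤ 0<δα) (subst (ℚ._≤ seq α k) (ℚ.+-identityˡ δα) (δα≤α k Nα≤k)))
        α≤1/7
        δ 0<δ Nε (λ k Nε≤k → subst (ℚ._≤ seq ε k) (ℚ.+-identityˡ δ) (δ≤ε k Nε≤k))
  -- The order on reals permits any positive tolerance; tolerance 1 costs only a lower-order term in
  -- the cubic estimate.
  in n₀ , λ n n≥n₀ H dense → tile n n≥n₀ H (dense 1ℚ (ℚ.positive⁻¹ 1ℚ))
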